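{- For every positive integer $n\notin\{4,6\}$ there exists an $N_\infty$ Latin square of order $n$.
   Context: A Latin square of order $n$ is an $n\times n$ matrix on $n$ symbols in which each symbol occurs exactly once in each row and each column. A subsquare of order $k$ of a Latin square $L$ is a $k\times k$ submatrix (on some $k$ rows and $k$ columns, not necessarily contiguous) that is itself a Latin square. A subsquare of order $k\in\{2,3,\dots,n-1\}$ is proper. A Latin square with no proper subsquare is called $N_\infty$. -}

module Defs where

open import Data.Nat using (ℕ; _≤_; _<_)
open import Data.Fin using (Fin)
open import Data.Product using (Σ; ∃; ∃-syntax; _×_)
open import Relation.Binary.PropositionalEquality using (_≡_)
open import Relation.Nullary using (¬_)
open import Function.Definitions using (Injective)

Matrix : ℕ → Set
Matrix n = Fin n → Fin n → Fin n

∃! : ∀ {n} → (Fin n → Set) → Set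
∃! {n} P = Σ (Fin n) λ x → P x × (∀ y → P y → y ≡ x)

IsLatin : ∀ {n} → Matrix n → Set
IsLatin {n} L =
  (∀ (r s : Fin n) → ∃! λ c → L r c ≡ s) ×
  (∀ (c s : Fin n) → ∃! λ r → L r c ≡ s)

-- A subsquare of order k of L: k distinct rows ρ, k distinct columns γ, such that the
-- k×k submatrix (i , j) ↦ L (ρ i) (γ j) is itself a Latin square on some k symbols
-- (given by distinct symbols σ and a Latin square M of order k with
-- L (ρ i) (γ j) = σ (M i j)).
HasSubsquare : ∀ {n} → Matrix n → ℕ → Set
HasSubsquare {n} L k =
  Σ (Fin k → Fin n) λ ρ → Σ (Fin k → Fin n) λ γ → Σ (Fin k → Fin n) λ σ →
  Σ (Matrix k) λ M →
    Injective _≡_ _≡_ ρ × Injective _≡_ _≡_ γ × Injective _≡_ _≡_ σ ×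
    IsLatin M × (∀ i j → L (ρ i) (γ j) ≡ σ (M i j))

IsNinfty : ∀ {n} → Matrix n → Set
IsNinfty {n} L = ∀ k → 2 ≤ k → k < n → ¬ HasSubsquare L k

module Submission where

-- For n = a m, put on Q × ℤ/m, with |Q| = a, the product
--   (i , x) (j , y) = (κ , x + y + ε)   where κ = F x y i j,
-- for simple Latin squares F x y on Q and with ε = 1 if κ is a distinguished symbol ∞ and the row i
-- is of type true, and ε = 0 otherwise. Assume that the symbol ∞ occurs only where the row and the
-- column have the same type. A subsquare with two rows in one fibre contains this fibre, since F x
-- y is simple, and then everything: the symbol (∞ , x + y + 1) is met over y from a row of type
-- true, and over y + 1 from a row of type false, hence the columns are closed under translation by
-- 1. A subsquare that meets each fibre at most once and never sees the twist is a section: F agrees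
-- on it with the group ℤ/m over a coset. If it does see the twist, comparing ∞ from rows of both
-- types again yields a section, or else a 2 × 2 pattern (excluded by no-window) over x, x + d and
-- y, y + d where 2 d + 1 = 0.
--
-- If a = p ≥ 5 is a prime factor of n, let F x y i j = θ i + j over ℤ/p, with θ the identity, the
-- negation or the transposition of 0 and 2, according to the halves of ℤ/m in which x and y lie.
-- Otherwise n = 2^i 3^j, and for n > 3 we take a ∈ {8, 9, 12, 16, 18} with explicit squares; there
-- every nontrivial subgroup of ℤ/m contains one of order 2 or 3, so sections need only be excluded
-- over these.

open import Defs
open import Data.Nat
open import Data.Nat.Properties as ℕ using (module ≤-Reasoning)
open import Data.Nat.DivMod
open import Data.Nat.Divisibility
open import Data.Nat.GCD using (gcd; gcd-GCD; gcd[m,n]∣m; gcd[m,n]∣n; module Bézout)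
open import Data.Nat.Primality using (Prime; prime?; ¬prime[0]; ¬prime[1]; euclidsLemma; prime⇒irreducible; prime⇒nonZero)
open import Data.Nat.Primality.Factorisation using (factorise)
open import Data.Nat.Tactic.RingSolver using (solve-∀)
open import Data.Bool using (Bool; true; false; _∧_; _∨_; not; if_then_else_)
import Data.Bool.Properties as Bool
open import Data.Fin as Fin using (Fin; toℕ; #_)
import Data.Fin.Properties as Fin
open import Data.List using (List; []; _∷_)
open import Data.List.Relation.Unary.All using (All; []; _∷_)
open import Data.Vec as Vec using (Vec; []; _∷_; lookup; tabulate; _[_]≔_; replicate)
import Data.Vec.Properties as Vec
open import Data.Unit using (⊤; tt)
open import Data.Product using (Σ; ∃; _×_; _,_; proj₁; proj₂)
open import Data.Sum using (_⊎_; inj₁; inj₂)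
open import Data.Empty using (⊥; ⊥-elim)
open import Function.Base using (_∘_)
open import Function.Bundles using (_↔_; module Inverse; module Equivalence)
open import Function.Construct.Identity using (↔-id)
open import Relation.Nullary using (¬_; Dec; yes; no; does)
open import Relation.Nullary.Decidable using (_×-dec_; ¬?; dec-true; dec-false; from-no)
open import Relation.Unary using (Decidable)
open import Relation.Binary.Definitions using (tri<; tri≈; tri>)
open import Relation.Binary.PropositionalEquality hiding ([_]; J)
open import Algebra.Bundles using (AbelianGroup)
open import Algebra.Structures using (IsAbelianGroup)
import Algebra.Properties.AbelianGroup as AbelianGroupProperties
import Algebra.Solver.CommutativeMonoid as CommutativeMonoidSolver

-- Latin squares and their subsquares

-- Without the shift ε, every Q × H with H a subgroup of ℤ/m would remain a subsquare. A shift that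
-- depends on the row keeps the rows Latin; for the columns it must also be a function of the column
-- and the symbol, whence the types. Varying F is just as necessary: if F were constant, each cell
-- (i , j) of it would give a section with the rows (i , x) and the columns (j , y).
--
-- In the 2 × 2 pattern a row of type false over x meets (∞ , v) over y, and a row of type true over
-- x + d meets it over y + d, so x + y = (x + d) + (y + d) + 1. Such a d exists only if m is odd,
-- while subgroups of order 2 exist only if m is even. For n = 2^i 3^j the fibre therefore absorbs
-- all factors 2 when there are at most four of them; then m is a power of 3, and only windows and
-- subgroups of order 3 remain to be excluded. With more factors 2 the fibre is 16, m is even, and
-- there are no windows. A prime fibre treats both parities of m with the same F, because 2 and 3
-- are invertible modulo p.

record Quasigroup (A : Set) : Set where
  field
    op    : A → A → A
    colOf : A → A → A
    rowOf : A → A → A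
    op-colOf : ∀ r s → op r (colOf r s) ≡ s
    colOf-op : ∀ r c → colOf r (op r c) ≡ c
    op-rowOf : ∀ c s → op (rowOf c s) c ≡ s
    rowOf-op : ∀ r c → rowOf c (op r c) ≡ r

  op-injʳ : ∀ r {c c'} → op r c ≡ op r c' → c ≡ c'
  op-injʳ r {c} {c'} e = trans (sym (colOf-op r c)) (trans (cong (colOf r) e) (colOf-op r c'))

  op-injˡ : ∀ c {r r'} → op r c ≡ op r' c → r ≡ r'
  op-injˡ c {r} {r'} e = trans (sym (rowOf-op r c)) (trans (cong (rowOf c) e) (rowOf-op r' c))

open Quasigroup

-- A subsquare, given by its sets of rows, columns and symbols.
record Subsquare {A : Set} (q : Quasigroup A) (R C W : A → Set) : Set where
  field
    inside : ∀ {r c} → R r → C c → W (op q r c)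
    inRow  : ∀ {r s} → R r → W s → ∃ λ c → C c × op q r c ≡ s
    inCol  : ∀ {c s} → C c → W s → ∃ λ r → R r × op q r c ≡ s

open Subsquare

-- There is no proper subsquare: a subsquare has as many rows as columns, so it suffices that two rows
-- force all of them.
Simple : {A : Set} → Quasigroup A → Set₁
Simple {A} q = ∀ {R C W : A → Set} → Decidable R → Decidable C → Subsquare q R C W →
  ∀ {r r' c} → R r → R r' → r ≢ r' → C c → ∀ t → R t

module _ {A : Set} {q : Quasigroup A} {R C W : A → Set} (S : Subsquare q R C W) where

  allRows⇒allCols : (∀ r → R r) → ∀ {c} → C c → ∀ c' → C c'
  allRows⇒allCols allR {c} Cc c' = C-c'
    where
    -- Any row would serve; `c'` is at hand since rows and columns share the type `A`.
    s = op q c' c'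
    r = c'
    Ws : W s
    Ws = subst W (op-rowOf q c s) (inside S (allR (rowOf q c s)) Cc)
    C-c' : C c'
    C-c' with inRow S (allR r) Ws
    ... | d , Cd , e = subst C (op-injʳ q r e) Cd

  allCols⇒allRows : (∀ c → C c) → ∀ {r} → R r → ∀ r' → R r'
  allCols⇒allRows allC {r} Rr r' with inCol S (allC r') Ws
    where
    s = op q r' r'
    Ws : W s
    Ws = subst W (op-colOf q r s) (inside S Rr (allC (colOf q r s)))
  ... | t , Rt , e = subst R (op-injˡ q r' e) Rt

  twoCols⇒twoRows : ∀ {r c c'} → R r → C c → C c' → c ≢ c' → ∃ λ r' → R r' × r ≢ r'
  twoCols⇒twoRows {r} {c} {c'} Rr Cc Cc' c≢c' with inCol S Cc (inside S Rr Cc')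
  ... | r' , Rr' , e = r' , Rr' , λ { refl → c≢c' (op-injʳ q r e) }

module ToMatrix {A : Set} {n : ℕ} (iso : Fin n ↔ A) (q : Quasigroup A) where
  open Inverse iso renaming (to to ⟦_⟧; from to ⌜_⌝)

  private
    ⟦⌜_⌝⟧ : ∀ x → ⟦ ⌜ x ⌝ ⟧ ≡ x
    ⟦⌜ x ⌝⟧ = inverseˡ refl
    ⌜⟦_⟧⌝ : ∀ i → ⌜ ⟦ i ⟧ ⌝ ≡ i
    ⌜⟦ i ⟧⌝ = inverseʳ refl

  matrix : Matrix n
  matrix i j = ⌜ op q ⟦ i ⟧ ⟦ j ⟧ ⌝

  isLatin : IsLatin matrix
  isLatin = rows , cols
    where
    rows : ∀ (r s : Fin n) → ∃! λ c → matrix r c ≡ s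
    rows r s = ⌜ colOf q ⟦ r ⟧ ⟦ s ⟧ ⌝
      , trans (cong ⌜_⌝ (trans (cong (op q ⟦ r ⟧) ⟦⌜ _ ⌝⟧) (op-colOf q _ _))) ⌜⟦ s ⟧⌝
      , λ { y refl → trans (sym ⌜⟦ y ⟧⌝)
              (cong ⌜_⌝ (trans (sym (colOf-op q ⟦ r ⟧ ⟦ y ⟧)) (cong (colOf q ⟦ r ⟧) (sym ⟦⌜ _ ⌝⟧)))) }
    cols : ∀ (c s : Fin n) → ∃! λ r → matrix r c ≡ s
    cols c s = ⌜ rowOf q ⟦ c ⟧ ⟦ s ⟧ ⌝
      , trans (cong ⌜_⌝ (trans (cong (λ r → op q r ⟦ c ⟧) ⟦⌜ _ ⌝⟧) (op-rowOf q _ _))) ⌜⟦ s ⟧⌝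
      , λ { y refl → trans (sym ⌜⟦ y ⟧⌝)
              (cong ⌜_⌝ (trans (sym (rowOf-op q ⟦ y ⟧ ⟦ c ⟧)) (cong (rowOf q ⟦ c ⟧) (sym ⟦⌜ _ ⌝⟧)))) }

  -- As `2 ≤ k` there are two rows, so simplicity puts every row into the image of `ρ`; choosing
  -- preimages injects `Fin n` into `Fin k`.
  isNinfty : Simple q → IsNinfty matrix
  isNinfty simple k 2≤k k<n (ρ , γ , σ , M , ρ-inj , γ-inj , σ-inj , (rowsM , colsM) , eq) =
    ℕ.<⇒≱ k<n (Fin.injective⇒≤ {f = index} index-inj)
    where
    Image : (Fin k → Fin n) → A → Set
    Image f x = ∃ λ t → ⟦ f t ⟧ ≡ x
    image? : ∀ f x → Dec (Image f x)
    image? f x with Fin.any? (λ t → f t Fin.≟ ⌜ x ⌝)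
    ... | yes (t , e) = yes (t , trans (cong ⟦_⟧ e) ⟦⌜ x ⌝⟧)
    ... | no ¬e = no λ { (t , refl) → ¬e (t , sym ⌜⟦ f t ⟧⌝) }
    entry : ∀ i j → op q ⟦ ρ i ⟧ ⟦ γ j ⟧ ≡ ⟦ σ (M i j) ⟧
    entry i j = trans (sym ⟦⌜ _ ⌝⟧) (cong ⟦_⟧ (eq i j))
    S : Subsquare q (Image ρ) (Image γ) (Image σ)
    S = record
      { inside = λ { (i , refl) (j , refl) → M i j , sym (entry i j) }
      ; inRow = λ { (i , refl) (t , refl) → let j , e , _ = rowsM i t in
                    ⟦ γ j ⟧ , (j , refl) , trans (entry i j) (cong (⟦_⟧ ∘ σ) e) }
      ; inCol = λ { (j , refl) (t , refl) → let i , e , _ = colsM j t in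
                    ⟦ ρ i ⟧ , (i , refl) , trans (entry i j) (cong (⟦_⟧ ∘ σ) e) }
      }
    first second : ∀ {k} → 2 ≤ k → Fin k
    first (s≤s _) = Fin.zero
    second (s≤s (s≤s _)) = Fin.suc Fin.zero
    first≢second : ∀ {k} (p : 2 ≤ k) → first p ≢ second p
    first≢second (s≤s (s≤s _)) ()
    full : ∀ x → Image ρ x
    full = simple (image? ρ) (image? γ) S (first 2≤k , refl) (second 2≤k , refl)
      (λ e → first≢second 2≤k (ρ-inj (trans (sym ⌜⟦ _ ⟧⌝) (trans (cong ⌜_⌝ e) ⌜⟦ _ ⟧⌝))))
      (first 2≤k , refl)
    index : Fin n → Fin k
    index r = proj₁ (full ⟦ r ⟧)
    index-inj : ∀ {r r'} → index r ≡ index r' → r ≡ r'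
    index-inj {r} {r'} e = trans (sym ⌜⟦ r ⟧⌝) (trans (cong ⌜_⌝
      (trans (sym (proj₂ (full ⟦ r ⟧))) (trans (cong (⟦_⟧ ∘ ρ) e) (proj₂ (full ⟦ r' ⟧))))) ⌜⟦ r' ⟧⌝)

-- P is not assumed decidable: a preimage of x is found on the orbit of x.
module _ {n : ℕ} (g : Fin n → Fin n) (g-inj : ∀ {x y} → g x ≡ g y → x ≡ y) where
  private
    iter : ℕ → Fin n → Fin n
    iter zero x = x
    iter (suc t) x = g (iter t x)

    iter-P : ∀ {P : Fin n → Set} → (∀ {x} → P x → P (g x)) → ∀ t {x} → P x → P (iter t x)
    iter-P gP zero Px = Px
    iter-P {P} gP (suc t) Px = gP (iter-P {P} gP t Px)

    preimage : ∀ {s t} x → s < t → iter s x ≡ iter t x → ∃ λ u → g (iter u x) ≡ x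
    preimage {zero} {suc t} x (s≤s _) e = t , sym e
    preimage {suc s} {suc t} x (s≤s s<t) e = preimage x s<t (g-inj e)

  injective-onto : {P : Fin n → Set} → (∀ {x} → P x → P (g x)) → ∀ {x} → P x → ∃ λ y → P y × g y ≡ x
  injective-onto {P} gP {x} Px
    with Fin.pigeonhole (ℕ.n<1+n n) (λ t → iter (Fin.toℕ t) x)
  ... | s , t , s<t , e with preimage x s<t e
  ... | u , e' = iter u x , iter-P {P} gP u Px , e'

module _ {n : ℕ} (P : Fin n → Set) (f f' f⁻¹ : Fin n → Fin n)
  (inv : ∀ x → f⁻¹ (f x) ≡ x) (f'-inj : ∀ {x y} → f' x ≡ f' y → x ≡ y) where

  -- For two lines f and f' of a fibre of the twisted product: the symbol ω may leave the fibre, but it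
  -- is recovered since f⁻¹ ∘ f' permutes P.
  exchange : ∀ ω → (∀ x → P x → f' x ≢ ω → ∃ λ y → P y × f y ≡ f' x) →
    (f∘inv : ∀ x → f (f⁻¹ x) ≡ x) → ∀ {x} → P x → f x ≡ ω → ∃ λ y → P y × f' y ≡ ω
  exchange ω sub inv' {x} Px fx≡ω with injective-onto g g-inj {P} gP Px
    where
    g : Fin n → Fin n
    g y = f⁻¹ (f' y)
    g-inj : ∀ {y z} → g y ≡ g z → y ≡ z
    g-inj e = f'-inj (trans (sym (inv' _)) (trans (cong f e) (inv' _)))
    gP : ∀ {y} → P y → P (g y)
    gP {y} Py with f' y Fin.≟ ω
    ... | yes e = subst P (trans (sym (inv x)) (cong f⁻¹ (trans fx≡ω (sym e)))) Px
    ... | no ¬e with sub y Py ¬e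
    ...   | z , Pz , e = subst P (trans (sym (inv z)) (cong f⁻¹ e)) Pz
  ... | y , Py , e = y , Py , trans (sym (inv' _)) (trans (cong f e) fx≡ω)

-- Twisted products

-- Rows and columns of Q × G, at most one in each fibre, closed under translation by δ, on which the
-- squares F x y agree with the table of G.
record Section {Q G : Set} (_+_ : G → G → G) (F : G → G → Quasigroup Q) (δ : G) : Set₁ where
  field
    R C W  : Q → G → Set
    R-func : ∀ {i i' x} → R i x → R i' x → i ≡ i'
    C-func : ∀ {j j' y} → C j y → C j' y → j ≡ j'
    W-func : ∀ {κ κ' v} → W κ v → W κ' v → κ ≡ κ'
    R-step : ∀ {i x} → R i x → ∃ λ i' → R i' (x + δ)
    C-step : ∀ {j y} → C j y → ∃ λ j' → C j' (y + δ)
    value∈ : ∀ {i x j y} → R i x → C j y → W (op (F x y) i j) (x + y)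
    row    : ∃ λ i → ∃ λ x → R i x
    column : ∃ λ j → ∃ λ y → C j y

module Twist {a m : ℕ} {_+_ : Fin m → Fin m → Fin m} {0# : Fin m} { -_ : Fin m → Fin m}
  (isAbelianGroup : IsAbelianGroup _≡_ _+_ 0# -_) (1# : Fin m)
  (generates : ∀ {P : Fin m → Set} → (∀ {x} → P x → P (x + 1#)) → ∀ {x} → P x → ∀ y → P y)
  (F : Fin m → Fin m → Quasigroup (Fin a))
  (F-simple : ∀ x y → Simple (F x y))
  (∞ : Fin a) (T J : Fin a → Bool)
  (same-type : ∀ x y {i j} → op (F x y) i j ≡ ∞ → T i ≡ J j)
  {iF iT : Fin a} (T-iF : T iF ≡ false) (T-iT : T iT ≡ true)
  (no-section : ∀ {δ} → δ ≢ 0# → ¬ Section _+_ F δ)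
  (no-window : ∀ x y d {i i' j j'} → (d + d) + 1# ≡ 0# → T i ≡ false → T i' ≡ true →
    op (F x y) i j ≡ ∞ → op (F (x + d) (y + d)) i' j' ≡ ∞ →
    op (F x (y + d)) i j' ≢ op (F (x + d) y) i' j)
  where

  open IsAbelianGroup isAbelianGroup using (assoc; comm; identityˡ; identityʳ; inverseˡ; inverseʳ; isGroup)

  private
    G = Fin m
    Q = Fin a

    +-cancelˡ : ∀ x {y z} → x + y ≡ x + z → y ≡ z
    +-cancelˡ x {y} {z} e = trans (sym (drop y)) (trans (cong ((- x) +_) e) (drop z))
      where
      drop : ∀ y → (- x) + (x + y) ≡ y
      drop y = trans (sym (assoc (- x) x y)) (trans (cong (_+ y) (inverseˡ x)) (identityˡ y))

    +-cancelʳ : ∀ x {y z} → y + x ≡ z + x → y ≡ z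
    +-cancelʳ x {y} {z} e = +-cancelˡ x (trans (comm x y) (trans e (comm z x)))

    x+[z-x] : ∀ x z → x + (z + (- x)) ≡ z
    x+[z-x] x z = trans (comm x _) (trans (assoc z (- x) x) (trans (cong (z +_) (inverseˡ x)) (identityʳ z)))

    [z-x]+x : ∀ x z → (z + (- x)) + x ≡ z
    [z-x]+x x z = trans (comm _ x) (x+[z-x] x z)

    swap₂₃ : ∀ x y z → (x + y) + z ≡ (x + z) + y
    swap₂₃ x y z = trans (assoc x y z) (trans (cong (x +_) (comm y z)) (sym (assoc x z y)))

  infixl 6 _-_
  _-_ : G → G → G
  z - x = z + (- x)

  -- The twist: the symbols (∞ , v) are shifted by one in the rows of type true.
  ε : Bool → Q → G
  ε false _ = 0#
  ε true κ with κ Fin.≟ ∞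
  ... | yes _ = 1#
  ... | no  _ = 0#

  private
    ε-∞ : ε true ∞ ≡ 1#
    ε-∞ with ∞ Fin.≟ ∞
    ... | yes _ = refl
    ... | no ¬e = ⊥-elim (¬e refl)

    ε-≢∞ : ∀ t {κ} → κ ≢ ∞ → ε t κ ≡ 0#
    ε-≢∞ false _ = refl
    ε-≢∞ true {κ} κ≢∞ with κ Fin.≟ ∞
    ... | yes e = ⊥-elim (κ≢∞ e)
    ... | no _ = refl

    -- Only ∞ is ever shifted, and where it occurs the two types agree. So the shift can be read
    -- from the column as well, which is what makes the columns Latin.
    ε-type : ∀ x y i j → ε (T i) (op (F x y) i j) ≡ ε (J j) (op (F x y) i j)
    ε-type x y i j with op (F x y) i j Fin.≟ ∞
    ... | yes e = cong (λ t → ε t (op (F x y) i j)) (same-type x y e)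
    ... | no ¬e = trans (ε-≢∞ (T i) ¬e) (sym (ε-≢∞ (J j) ¬e))

  A : Set
  A = Q × G

  -- A division finds the group coordinate first: the shift depends only on the type of the given
  -- line and on the symbol, so the coordinate is known before the fibre square, which depends on
  -- it, is consulted.
  square : Quasigroup A
  square = record
    { op = λ { (i , x) (j , y) → let κ = op (F x y) i j in κ , (x + y) + ε (T i) κ }
    ; colOf = λ { (i , x) (κ , v) → let y = v - ε (T i) κ - x in colOf (F x y) i κ , y }
    ; rowOf = λ { (j , y) (κ , v) → let x = v - ε (J j) κ - y in rowOf (F x y) j κ , x }
    ; op-colOf = λ { (i , x) (κ , v) → let y = v - ε (T i) κ - x in
        lemma (op-colOf (F x y) i κ) (trans (cong₂ _+_ (x+[z-x] x _) (cong (ε (T i)) (op-colOf (F x y) i κ))) ([z-x]+x _ v)) }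
    ; colOf-op = λ { (i , x) (j , y) → let κ = op (F x y) i j in
        colOf-lemma i x j (back x y (ε (T i) κ)) }
    ; op-rowOf = λ { (j , y) (κ , v) → let x = v - ε (J j) κ - y in
        lemma (op-rowOf (F x y) j κ)
          (trans (cong₂ _+_ ([z-x]+x y _) (trans (ε-type x y _ j) (cong (ε (J j)) (op-rowOf (F x y) j κ)))) ([z-x]+x _ v)) }
    ; rowOf-op = λ { (i , x) (j , y) → let κ = op (F x y) i j in
        rowOf-lemma j y i (trans (cong₂ (λ p q → p - q - y) (cong (_+ ε (T i) κ) (comm x y)) (sym (ε-type x y i j))) (back y x (ε (T i) κ))) }
    }
    where
    lemma : ∀ {κ κ' : Q} {v v' : G} → κ ≡ κ' → v ≡ v' → (κ , v) ≡ (κ' , v')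
    lemma = cong₂ _,_
    back : ∀ x y e → (x + y) + e - e - x ≡ y
    back x y e = +-cancelˡ x (trans (x+[z-x] x _) (+-cancelʳ e ([z-x]+x e _)))
    colOf-lemma : ∀ i x j {y y'} → y' ≡ y → (colOf (F x y') i (op (F x y) i j) , y') ≡ (j , y)
    colOf-lemma i x j {y} refl = cong (_, y) (colOf-op (F x y) i j)
    rowOf-lemma : ∀ j y i {x x'} → x' ≡ x → (rowOf (F x' y) j (op (F x y) i j) , x') ≡ (i , x)
    rowOf-lemma j y i {x} refl = cong (_, x) (rowOf-op (F x y) i j)

  private
   module Proof {R C W : A → Set} (R? : Decidable R) (C? : Decidable C)
    (S : Subsquare square R C W) where

    Y : G → Set
    Y y = ∃ λ j → C (j , y)

    value : ∀ {i x j y} → R (i , x) → C (j , y) → W (op square (i , x) (j , y))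
    value = inside S

    -- In a given row the symbol determines the shift, so cancellation tells over which `y` the
    -- symbol occurs, and this `y` can be named in advance.
    inRow' : ∀ {i x y v κ} → R (i , x) → W (κ , v) → (x + y) + ε (T i) κ ≡ v →
      ∃ λ j → C (j , y) × op (F x y) i j ≡ κ
    inRow' {i} {x} {y} {v} {κ} r w e with inRow S r w
    ... | (j , y') , c , e' with cong proj₁ e' | cong proj₂ e'
    ...   | refl | e'' with +-cancelˡ x (+-cancelʳ (ε (T i) κ) (trans e (sym e'')))
    ...     | refl = j , c , refl

    inCol' : ∀ {j y x v κ} → C (j , y) → W (κ , v) → (x + y) + ε (J j) κ ≡ v →
      ∃ λ i → R (i , x) × op (F x y) i j ≡ κ
    inCol' {j} {y} {x} {v} {κ} c w e with inCol S c w
    ... | (i , x') , r , e' with cong proj₁ e' | cong proj₂ e'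
    ...   | refl | e'' with +-cancelʳ y (+-cancelʳ (ε (J j) κ)
                              (trans e (trans (sym e'') (cong ((x' + y) +_) (ε-type x' y i j)))))
    ...     | refl = i , r , refl

    plain : ∀ {x t κ v} → κ ≢ ∞ → x ≡ v → x + ε t κ ≡ v
    plain {x} {t} κ≢∞ e = trans (cong (x +_) (ε-≢∞ t κ≢∞)) (trans (identityʳ x) e)

    -- A symbol other than ∞ is unshifted, so it recurs over the same `x` and `y`. Only ∞ can escape
    -- from the block; as it is a single symbol, `exchange` recovers its position from the others.
    -- The symbols are those that occur in the block, not those of `W`.
    block : ∀ x y → Subsquare (F x y) (λ i → R (i , x)) (λ j → C (j , y))
      (λ κ → ∃ λ i → ∃ λ j → R (i , x) × C (j , y) × op (F x y) i j ≡ κ)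
    block x y = record
      { inside = λ r c → _ , _ , r , c , refl
      ; inRow = λ { {i'} r' (i , j , r , c , refl) → row r' r c }
      ; inCol = λ { {j'} c' (i , j , r , c , refl) → col c' r c }
      }
      where
      f = F x y
      unshift : ∀ {i j} → op f i j ≢ ∞ → R (i , x) → C (j , y) → W (op f i j , x + y)
      unshift {i} ¬∞ r c = subst (λ v → W (_ , v)) (plain {t = T i} ¬∞ refl) (value r c)
      rowSub : ∀ {i i' j} → R (i , x) → R (i' , x) → C (j , y) → op f i' j ≢ ∞ →
        ∃ λ j' → C (j' , y) × op f i j' ≡ op f i' j
      rowSub {i} r r' c ¬∞ = inRow' r (unshift ¬∞ r' c) (plain {t = T i} ¬∞ refl)
      colSub : ∀ {i j j'} → C (j , y) → C (j' , y) → R (i , x) → op f i j' ≢ ∞ →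
        ∃ λ i' → R (i' , x) × op f i' j ≡ op f i j'
      colSub {j = j} c c' r ¬∞ = inCol' c (unshift ¬∞ r c') (plain {t = J j} ¬∞ refl)
      row : ∀ {i i' j} → R (i' , x) → R (i , x) → C (j , y) →
        ∃ λ j' → C (j' , y) × op f i' j' ≡ op f i j
      row {i} {i'} {j} r' r c with op f i j Fin.≟ ∞
      ... | no ¬∞ = rowSub r' r c ¬∞
      ... | yes e with exchange (λ j → C (j , y)) (op f i) (op f i') (colOf f i)
                         (colOf-op f i) (op-injʳ f i') ∞ (λ j c → rowSub r r' c) (op-colOf f i) c e
      ...   | j' , c' , e' = j' , c' , trans e' (sym e)
      col : ∀ {i j j'} → C (j' , y) → R (i , x) → C (j , y) →
        ∃ λ i' → R (i' , x) × op f i' j' ≡ op f i j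
      col {i} {j} {j'} c' r c with op f i j Fin.≟ ∞
      ... | no ¬∞ = colSub c' c r ¬∞
      ... | yes e with exchange (λ i → R (i , x)) (λ i → op f i j) (λ i → op f i j')
                         (rowOf f j) (λ i → rowOf-op f i j) (op-injˡ f j') ∞ (λ i r → colSub c c' r)
                         (op-rowOf f j) r e
      ...   | i' , r' , e' = i' , r' , trans e' (sym e)

    fullRows : ∀ {i i' x j y} → R (i , x) → R (i' , x) → i ≢ i' → C (j , y) → ∀ i → R (i , x)
    fullRows {x = x} {y = y} r r' i≢i' c =
      F-simple x y (λ i → R? (i , x)) (λ j → C? (j , y)) (block x y) r r' i≢i' c

    full : ∀ {i i' x j y} → R (i , x) → R (i' , x) → i ≢ i' → C (j , y) → ∀ r → R r
    full {i} {i'} {x} {j} {y} r r' i≢i' c r'' =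
      allCols⇒allRows S (λ { (j , y) → allC y j }) r r''
      where
      all-i : ∀ i → R (i , x)
      all-i = fullRows r r' i≢i' c
      fullCols : ∀ {y} → Y y → ∀ j → C (j , y)
      fullCols {y} (j , c) = allRows⇒allCols (block x y) all-i c
      step : ∀ {y} → Y y → Y (y + 1#)
      step {y} Yy = let j , c , _ = inRow' (all-i iF) w e in j , c
        where
        j₀ = colOf (F x y) iT ∞
        w : W (∞ , (x + y) + 1#)
        w = subst W (cong₂ _,_ (op-colOf (F x y) iT ∞) (cong ((x + y) +_)
              (trans (cong₂ ε T-iT (op-colOf (F x y) iT ∞)) ε-∞))) (value (all-i iT) (fullCols Yy j₀))
        e : (x + (y + 1#)) + ε (T iF) ∞ ≡ (x + y) + 1#
        e = trans (cong ((x + (y + 1#)) +_) (cong (λ t → ε t ∞) T-iF))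
              (trans (identityʳ _) (sym (assoc x y 1#)))
      allC : ∀ y j → C (j , y)
      allC y' = fullCols (generates {Y} step {y} (j , c) y')

    -- Symbols seen from a row of type t, with the twist removed.
    raw : Bool → Q → G → Set
    raw t κ v = W (κ , v + ε t κ)

    raw-≢∞ : ∀ t t' {κ v} → κ ≢ ∞ → raw t κ v → raw t' κ v
    raw-≢∞ t t' {κ} {v} κ≢∞ = subst W (cong (λ e → κ , v + e) (trans (ε-≢∞ t κ≢∞) (sym (ε-≢∞ t' κ≢∞))))

    cell : ∀ {t i x j y} → T i ≡ t → R (i , x) → C (j , y) → raw t (op (F x y) i j) (x + y)
    cell refl = value

    rowRaw : ∀ {t i x y v κ} → T i ≡ t → R (i , x) → raw t κ v → x + y ≡ v →
      ∃ λ j → C (j , y) × op (F x y) i j ≡ κ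
    rowRaw refl r w refl = inRow' r w refl

    δ≢0 : ∀ {x x'} → x ≢ x' → x' - x ≢ 0#
    δ≢0 {x} {x'} x≢x' e = x≢x' (trans (sym (identityʳ x)) (trans (cong (x +_) (sym e)) (x+[z-x] x x')))

    translate : ∀ x x' y → x + (y + (x' - x)) ≡ x' + y
    translate x x' y = trans (cong (x +_) (comm y _)) (trans (sym (assoc x _ y)) (cong (_+ y) (x+[z-x] x x')))

    module Thin (R-thin : ∀ {i i' x} → R (i , x) → R (i' , x) → i ≡ i') {i₀ x₀} (r₀ : R (i₀ , x₀)) where

      C-thin : ∀ {j j' y} → C (j , y) → C (j' , y) → j ≡ j'
      C-thin {j} {j'} {y} c c' with j Fin.≟ j'
      ... | yes e = e
      ... | no j≢j' = let _ , r , i≢ = twoCols⇒twoRows (block x₀ y) r₀ c c' j≢j' in ⊥-elim (i≢ (R-thin r₀ r))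

      -- If one shift `ε t` is correct in all cells, undoing it turns the subsquare into a section.
      -- The translation arises since the symbol of row `i₁` in a column over `y` recurs in row `i₀`
      -- over `y + (x₁ - x₀)`. This covers the subsquares with rows of one type only and those
      -- without ∞.
      uniform⊥ : ∀ t → (∀ {i x j y} → R (i , x) → C (j , y) →
          ε (T i) (op (F x y) i j) ≡ ε t (op (F x y) i j)) →
        ∀ {i₁ x₁ c} → R (i₁ , x₁) → x₀ ≢ x₁ → C c → ⊥
      uniform⊥ t uni {i₁} {x₁} r₁ x₀≢x₁ c = no-section (δ≢0 x₀≢x₁) record
        { R = λ i x → R (i , x) ; C = λ j y → C (j , y) ; W = raw t
        ; R-func = R-thin ; C-func = C-thin ; W-func = W-func
        ; R-step = λ r → R-step r c
        ; C-step = C-step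
        ; value∈ = inside'
        ; row = _ , _ , r₀ ; column = _ , _ , c
        }
        where
        δ = x₁ - x₀
        inside' : ∀ {i x j y} → R (i , x) → C (j , y) → raw t (op (F x y) i j) (x + y)
        inside' {x = x} {y = y} r c = subst (λ e → W (_ , (x + y) + e)) (uni r c) (value r c)
        row : ∀ {i x y v κ} → R (i , x) → raw t κ v → x + y ≡ v → ∃ λ j → C (j , y) × op (F x y) i j ≡ κ
        row {i} {x} {y} {v} {κ} r w e with inRow S r w
        ... | (j , y') , c , e' with cong proj₁ e' | cong proj₂ e'
        ...   | refl | e'' with +-cancelˡ x (trans e (sym (+-cancelʳ (ε t κ)
                                  (trans (cong ((x + y') +_) (sym (uni r c))) e''))))
        ...     | refl = j , c , refl
        col : ∀ {j x y v κ} → C (j , y) → raw t κ v → x + y ≡ v → ∃ λ i → R (i , x) × op (F x y) i j ≡ κ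
        col {j} {x} {y} {v} {κ} c w e with inCol S c w
        ... | (i , x') , r , e' with cong proj₁ e' | cong proj₂ e'
        ...   | refl | e'' with +-cancelʳ y (trans e (sym (+-cancelʳ (ε t κ)
                                  (trans (cong ((x' + y) +_) (sym (uni r c))) e''))))
        ...     | refl = i , r , refl
        W-func : ∀ {κ κ' v} → raw t κ v → raw t κ' v → κ ≡ κ'
        W-func {v = v} w w' with row r₀ w (x+[z-x] x₀ v) | row r₀ w' (x+[z-x] x₀ v)
        ... | j , c , e | j' , c' , e' = trans (sym e) (trans (cong (op (F x₀ (v - x₀)) i₀) (C-thin c c')) e')
        C-step : ∀ {j y} → C (j , y) → Y (y + δ)
        C-step {y = y} c = let j , c' , _ = row r₀ (inside' r₁ c) (translate x₀ x₁ y) in j , c'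
        R-step : ∀ {i x c} → R (i , x) → C c → ∃ λ i' → R (i' , x + δ)
        R-step {x = x} {j , y} r c = let _ , c' = C-step c ; i , r' , _ = col c (inside' r c') shift in i , r'
          where
          shift : (x + δ) + y ≡ x + (y + δ)
          shift = trans (assoc x δ y) (cong (x +_) (comm δ y))

      -- At a border `v` no column lies over `v - x₂`: the symbol of row `i₂` there would have to be
      -- ∞, which rows of type `not t` do not see. The two rows of type `t` make the set of fibres
      -- with columns invariant under δ in both directions, so this gap recurs for `v + δ`. The
      -- symbol of row `i₀` with sum `v + δ` is then ∞, since any other would be seen by `i₂` and
      -- fill the gap. Hence borders are invariant under δ, and the occurrences of ∞ in column `j₀`
      -- carry rows of type `t` along with them.
      sameType⊥ : ∀ t → T i₀ ≡ t → ∀ {i₁ x₁ i₂ x₂ v} → R (i₁ , x₁) → T i₁ ≡ t → x₀ ≢ x₁ →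
        R (i₂ , x₂) → T i₂ ≡ not t → raw t ∞ v → ¬ raw (not t) ∞ v → ⊥
      sameType⊥ t t₀ {i₁} {x₁} {i₂} {x₂} {v} r₁ t₁ x₀≢x₁ r₂ t₂ w ¬w = no-section (δ≢0 x₀≢x₁) record
        { R = λ i x → R (i , x) × T i ≡ t × Border (x + y₀) ; C = λ j y → C (j , y) ; W = raw t
        ; R-func = λ { (r , _) (r' , _) → R-thin r r' } ; C-func = C-thin ; W-func = W-func
        ; R-step = R-step
        ; C-step = C-step
        ; value∈ = λ { (r , e , _) c → cell e r c }
        ; row = i₀ , x₀ , r₀ , t₀ , subst Border (sym (x+[z-x] x₀ v)) (w , ¬w)
        ; column = j₀ , y₀ , c₀
        }
        where
        δ = x₁ - x₀
        y₀ = v - x₀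
        s = not t
        Border : G → Set
        Border v = raw t ∞ v × ¬ raw s ∞ v
        W-func : ∀ {κ κ' v} → raw t κ v → raw t κ' v → κ ≡ κ'
        W-func {v = v} w w' with rowRaw t₀ r₀ w (x+[z-x] x₀ v) | rowRaw t₀ r₀ w' (x+[z-x] x₀ v)
        ... | j , c , e | j' , c' , e' = trans (sym e) (trans (cong (op (F x₀ (v - x₀)) i₀) (C-thin c c')) e')
        C-step : ∀ {j y} → C (j , y) → Y (y + δ)
        C-step {y = y} c = let j , c' , _ = rowRaw t₀ r₀ (cell t₁ r₁ c) (translate x₀ x₁ y) in j , c'
        C-back : ∀ {y} → Y (y + δ) → Y y
        C-back {y} (_ , c) = let j , c' , _ = rowRaw t₁ r₁ (cell t₀ r₀ c) (sym (translate x₀ x₁ y)) in j , c'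
        seen : ∀ {κ v} → raw s κ v → Y (v - x₂)
        seen {v = v} w = let j , c , _ = rowRaw t₂ r₂ w (x+[z-x] x₂ v) in j , c
        unseen : ∀ {v} → Border v → ¬ Y (v - x₂)
        unseen {v} (w , ¬w) (j , c) with op (F x₂ (v - x₂)) i₂ j Fin.≟ ∞ | subst (raw s _) (x+[z-x] x₂ v) (cell t₂ r₂ c)
        ... | yes e | w' = ¬w (subst (λ κ → raw s κ v) e w')
        ... | no κ≢∞ | w' = κ≢∞ (W-func (raw-≢∞ s t κ≢∞ w') w)
        unseen-δ : ∀ {v} → Border v → ¬ Y ((v + δ) - x₂)
        unseen-δ {v} b y = unseen b (C-back (subst Y (swap₂₃ v δ (- x₂)) y))
        Border-step : ∀ {v} → Border v → Border (v + δ)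
        Border-step {v} b@(w , ¬w) with rowRaw t₀ r₀ w (x+[z-x] x₀ v)
        ... | _ , c , _ with C-step c
        ...   | j , c' with op (F x₀ ((v - x₀) + δ)) i₀ j Fin.≟ ∞
                          | subst (raw t _) (trans (sym (assoc x₀ _ δ)) (cong (_+ δ) (x+[z-x] x₀ v))) (cell t₀ r₀ c')
        ...     | yes e | w' = subst (λ κ → raw t κ (v + δ)) e w' , λ w'' → unseen-δ b (seen w'')
        ...     | no κ≢∞ | w' = ⊥-elim (unseen-δ b (seen (raw-≢∞ t s κ≢∞ w')))
        col₀ : ∃ λ j → C (j , y₀) × op (F x₀ y₀) i₀ j ≡ ∞
        col₀ = rowRaw t₀ r₀ w (x+[z-x] x₀ v)
        j₀ = proj₁ col₀
        c₀ = proj₁ (proj₂ col₀)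
        J-j₀ : J j₀ ≡ t
        J-j₀ = trans (sym (same-type x₀ y₀ (proj₂ (proj₂ col₀)))) t₀
        R-step : ∀ {i x} → R (i , x) × T i ≡ t × Border (x + y₀) →
          ∃ λ i' → R (i' , x + δ) × T i' ≡ t × Border ((x + δ) + y₀)
        R-step {i} {x} (r , _ , b) with subst Border (swap₂₃ x y₀ δ) (Border-step b)
        ... | b'@(w' , _) with inCol' c₀ w' (cong (λ t → ((x + δ) + y₀) + ε t ∞) J-j₀)
        ...   | i' , r' , e = i' , r' , trans (same-type (x + δ) y₀ e) J-j₀ , b'

    module Mixed (R-thin : ∀ {i i' x} → R (i , x) → R (i' , x) → i ≡ i')
      {i₀ x₀ i₁ x₁ v} (r₀ : R (i₀ , x₀)) (t₀ : T i₀ ≡ false) (r₁ : R (i₁ , x₁)) (t₁ : T i₁ ≡ true)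
      (w : W (∞ , v)) where

      open Thin R-thin

      W? : Decidable W
      W? s with C? (colOf square (i₀ , x₀) s)
      ... | yes c = yes (subst W (op-colOf square (i₀ , x₀) s) (inside S r₀ c))
      ... | no ¬c = no λ w → let c , Cc , e = inRow S r₀ w in
                      ¬c (subst C (trans (sym (colOf-op square (i₀ , x₀) c)) (cong (colOf square (i₀ , x₀)) e)) Cc)

      raw? : ∀ t v → Dec (raw t ∞ v)
      raw? t v = W? _

      shift : ∀ {v} → raw true ∞ v → raw false ∞ (v + 1#)
      shift {v} = subst (λ u → W (∞ , u)) (trans (cong (v +_) ε-∞) (sym (identityʳ _)))

      shift⁻¹ : ∀ {v} → raw false ∞ (v + 1#) → raw true ∞ v
      shift⁻¹ {v} = subst (λ u → W (∞ , u)) (sym (trans (cong (v +_) ε-∞) (sym (identityʳ _))))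

      w₀ : raw false ∞ v
      w₀ = subst (λ u → W (∞ , u)) (sym (identityʳ v)) w

      w₁ : raw true ∞ (v - 1#)
      w₁ = shift⁻¹ (subst (raw false ∞) (sym ([z-x]+x 1# v)) w₀)

      y₀ y₁ : G
      y₀ = v - x₀
      y₁ = (v - 1#) - x₁

      col₀ : ∃ λ j → C (j , y₀) × op (F x₀ y₀) i₀ j ≡ ∞
      col₀ = rowRaw t₀ r₀ w₀ (x+[z-x] x₀ v)

      col₁ : ∃ λ j → C (j , y₁) × op (F x₁ y₁) i₁ j ≡ ∞
      col₁ = rowRaw t₁ r₁ w₁ (x+[z-x] x₁ _)

      j₀ j₁ : Q
      j₀ = proj₁ col₀
      j₁ = proj₁ col₁
      c₀ : C (j₀ , y₀)
      c₀ = proj₁ (proj₂ col₀)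
      c₁ : C (j₁ , y₁)
      c₁ = proj₁ (proj₂ col₁)

      κ : Q
      κ = op (F x₀ y₁) i₀ j₁

      κ≢∞ : κ ≢ ∞
      κ≢∞ e with trans (sym t₀) (trans (same-type x₀ y₁ e) (trans (sym (same-type x₁ y₁ (proj₂ (proj₂ col₁)))) t₁))
      ... | ()

      ¬w₀ : ¬ raw false ∞ (x₀ + y₁)
      ¬w₀ w' with rowRaw t₀ r₀ w' refl
      ... | j , c , e = κ≢∞ (trans (cong (op (F x₀ y₁) i₀) (C-thin r₀ c₁ c)) e)

      -- Since `raw true ∞ u` amounts to `raw false ∞ (u + 1#)`, the absence of a border would let ∞
      -- spread by steps of one to every sum, against `¬w₀`.
      border-false : ∃ λ u → raw false ∞ u × ¬ raw true ∞ u
      border-false with Fin.any? (λ u → raw? false u ×-dec ¬? (raw? true u))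
      ... | yes b = b
      ... | no ¬b = ⊥-elim (¬w₀ (generates {raw false ∞} step w₀ _))
        where
        step : ∀ {u} → raw false ∞ u → raw false ∞ (u + 1#)
        step {u} r with raw? true u
        ... | yes r' = shift r'
        ... | no ¬r' = ⊥-elim (¬b (u , r , ¬r'))

      border-true : ∃ λ u → raw true ∞ u × ¬ raw false ∞ u
      border-true with Fin.any? (λ u → raw? true u ×-dec ¬? (raw? false u))
      ... | yes b = b
      ... | no ¬b = ⊥-elim (generates {λ u → ¬ raw false ∞ u} (λ {u} ¬r r → ¬b (u , shift⁻¹ r , ¬r)) ¬w₀ _ w₀)

      window⊥ : ∀ {x y} d → x ≡ x₀ + d → y ≡ y₀ + d → (x₀ + y₀) ≡ (x + y) + 1# → ∀ {j j' i} →
        T i ≡ true → op (F x₀ y₀) i₀ j ≡ ∞ → op (F x y) i j' ≡ ∞ → op (F x₀ y) i₀ j' ≢ op (F x y₀) i j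
      window⊥ d refl refl e = no-window x₀ y₀ d 2d+1≡0 t₀
        where
        2d+1≡0 : (d + d) + 1# ≡ 0#
        2d+1≡0 = +-cancelˡ (x₀ + y₀) (trans (sym (assoc _ _ _)) (trans (cong (_+ 1#) regroup)
                   (trans (sym e) (sym (identityʳ _)))))
          where
          regroup : (x₀ + y₀) + (d + d) ≡ (x₀ + d) + (y₀ + d)
          regroup = trans (sym (assoc _ d d)) (trans (cong (_+ d) (swap₂₃ x₀ y₀ d)) (assoc _ y₀ d))

      -- The symbol `κ` of row `i₀` and column `j₁` is traced in column `j₀`. Row `i₀` shows ∞
      -- there. A row other than `i₀` and `i₁` shares its type with one of them and lies over
      -- another fibre, which `sameType⊥` excludes. Row `i₁` completes a window, with ∞ on one
      -- diagonal and `κ` on the other.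
      contradiction : ⊥
      contradiction with inCol S c₀ (value r₀ c₁)
      ... | (i , x) , r , e with T i in t | cong proj₁ e | cong proj₂ e
      ...   | false | eκ | _ with x Fin.≟ x₀
      ...     | no x≢x₀ = let u , b , ¬b = border-false in
                          sameType⊥ r₀ false t₀ r t (λ e → x≢x₀ (sym e)) r₁ t₁ b ¬b
      ...     | yes refl = κ≢∞ (trans (sym eκ) (trans (cong (λ i → op (F x₀ y₀) i j₀) (R-thin r r₀)) (proj₂ (proj₂ col₀))))
      contradiction | (i , x) , r , e | true | eκ | ev with x Fin.≟ x₁
      ...     | no x≢x₁ = let u , b , ¬b = border-true in
                          sameType⊥ r₁ true t₁ r t (λ e → x≢x₁ (sym e)) r₀ t₀ b ¬b
      ...     | yes refl = window⊥ (x₁ - x₀) (sym (x+[z-x] x₀ x₁)) y₁≡ sum≡ t₁ (proj₂ (proj₂ col₀)) (proj₂ (proj₂ col₁))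
                             (trans (sym eκ) (cong (λ i → op (F x₁ y₀) i j₀) (R-thin r r₁)))
        where
        x₁+y₀≡x₀+y₁ : x₁ + y₀ ≡ x₀ + y₁
        x₁+y₀≡x₀+y₁ = trans (sym (plain {t = true} κ≢∞ refl)) (trans (cong (λ κ → (x₁ + y₀) + ε true κ) (sym eκ))
                       (trans ev (plain {t = T i₀} κ≢∞ refl)))
        y₁≡ : y₁ ≡ y₀ + (x₁ - x₀)
        y₁≡ = +-cancelˡ x₀ (trans (sym x₁+y₀≡x₀+y₁) (sym (translate x₀ x₁ y₀)))
        sum≡ : x₀ + y₀ ≡ (x₁ + y₁) + 1#
        sum≡ = trans (x+[z-x] x₀ v) (sym (trans (cong (_+ 1#) (x+[z-x] x₁ _)) ([z-x]+x 1# v)))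

    two-fibres⊥ : (∀ {i i' x} → R (i , x) → R (i' , x) → i ≡ i') →
      ∀ {i₀ x₀ i₁ x₁ c} → R (i₀ , x₀) → R (i₁ , x₁) → x₀ ≢ x₁ → C c → ⊥
    two-fibres⊥ R-thin r₀ r₁ x₀≢x₁ c with typed? true | typed? false
      where
      typed? : ∀ t → Dec (∃ λ i → ∃ λ x → R (i , x) × T i ≡ t)
      typed? t = Fin.any? λ i → Fin.any? λ x → R? (i , x) ×-dec (T i Bool.≟ t)
    ... | no ¬t | _ = Thin.uniform⊥ R-thin r₀ false
                        (λ r _ → cong (λ t → ε t _) (Bool.¬-not (λ e → ¬t (_ , _ , r , e)))) r₁ x₀≢x₁ c
    ... | yes _ | no ¬f = Thin.uniform⊥ R-thin r₀ true
                        (λ r _ → cong (λ t → ε t _) (Bool.¬-not (λ e → ¬f (_ , _ , r , e)))) r₁ x₀≢x₁ c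
    ... | yes (_ , _ , rt , t) | yes (_ , _ , rf , f)
      with Fin.any? (λ i → Fin.any? λ x → Fin.any? λ j → Fin.any? λ y →
             R? (i , x) ×-dec C? (j , y) ×-dec (op (F x y) i j Fin.≟ ∞))
    ...   | no ¬∞ = Thin.uniform⊥ R-thin r₀ false
                      (λ {i} r c → ε-≢∞ (T i) (λ e → ¬∞ (_ , _ , _ , _ , r , c , e))) r₁ x₀≢x₁ c
    ...   | yes (i , x , j , y , r , c' , e) = Mixed.contradiction R-thin rf f rt t
                                              (subst (λ κ → W (κ , (x + y) + ε (T i) κ)) e (value r c'))

  simple : Simple square
  simple {R} {C} {W} R? C? S {i₀ , x₀} {i₁ , x₁} {j , y} r₀ r₁ r₀≢r₁ c
    with Fin.any? (λ x → Fin.any? λ i → Fin.any? λ i' → R? (i , x) ×-dec R? (i' , x) ×-dec ¬? (i Fin.≟ i'))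
  ... | yes (x , i , i' , r , r' , i≢i') = Proof.full R? C? S r r' i≢i' c
  ... | no ¬two = ⊥-elim (Proof.two-fibres⊥ R? C? S thin r₀ r₁ x₀≢x₁ c)
    where
    thin : ∀ {i i' x} → R (i , x) → R (i' , x) → i ≡ i'
    thin {i} {i'} {x} r r' with i Fin.≟ i'
    ... | yes e = e
    ... | no i≢i' = ⊥-elim (¬two (x , i , i' , r , r' , i≢i'))
    x₀≢x₁ : x₀ ≢ x₁
    x₀≢x₁ refl = r₀≢r₁ (cong (_, x₀) (thin r₀ r₁))

-- Cyclic groups

module Zmod (m : ℕ) .{{_ : NonZero m}} where

  opaque
    [_] : ℕ → Fin m
    [ a ] = a mod m

    toℕ-[] : ∀ a → toℕ [ a ] ≡ a % m
    toℕ-[] a = Fin.toℕ-fromℕ< (m%n<n a m)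

  infixl 6 _⊕_
  _⊕_ : Fin m → Fin m → Fin m
  x ⊕ y = [ toℕ x + toℕ y ]

  ⊖_ : Fin m → Fin m
  ⊖ x = [ m ∸ toℕ x ]

  []-cong : ∀ {a b} → a % m ≡ b % m → [ a ] ≡ [ b ]
  []-cong {a} {b} e = Fin.toℕ-injective (trans (toℕ-[] a) (trans e (sym (toℕ-[] b))))

  []-injective : ∀ {a b} → [ a ] ≡ [ b ] → a % m ≡ b % m
  []-injective {a} {b} e = trans (sym (toℕ-[] a)) (trans (cong toℕ e) (toℕ-[] b))

  toℕ-[]-< : ∀ {a} → a < m → toℕ [ a ] ≡ a
  toℕ-[]-< {a} a<m = trans (toℕ-[] a) (m<n⇒m%n≡m a<m)

  [toℕ] : ∀ x → [ toℕ x ] ≡ x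
  [toℕ] x = Fin.toℕ-injective (toℕ-[]-< (Fin.toℕ<n x))

  [a+km] : ∀ a k → [ a + k * m ] ≡ [ a ]
  [a+km] a k = []-cong ([m+kn]%n≡m%n a k m)

  []-⊕ : ∀ a b → [ a ] ⊕ [ b ] ≡ [ a + b ]
  []-⊕ a b = []-cong (trans (cong₂ (λ u v → (u + v) % m) (toℕ-[] a) (toℕ-[] b)) (sym (%-distribˡ-+ a b m)))

  ⊕-[] : ∀ x b → x ⊕ [ b ] ≡ [ toℕ x + b ]
  ⊕-[] x b = trans (cong (_⊕ [ b ]) (sym ([toℕ] x))) ([]-⊕ (toℕ x) b)

  ⊕-assoc : ∀ x y z → (x ⊕ y) ⊕ z ≡ x ⊕ (y ⊕ z)
  ⊕-assoc x y z = begin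
    (x ⊕ y) ⊕ z                    ≡⟨ cong ((x ⊕ y) ⊕_) ([toℕ] z) ⟨
    (x ⊕ y) ⊕ [ toℕ z ]            ≡⟨ []-⊕ _ _ ⟩
    [ (toℕ x + toℕ y) + toℕ z ]    ≡⟨ cong [_] (ℕ.+-assoc (toℕ x) (toℕ y) (toℕ z)) ⟩
    [ toℕ x + (toℕ y + toℕ z) ]    ≡⟨ ⊕-[] x _ ⟨
    x ⊕ (y ⊕ z)                    ∎
    where open ≡-Reasoning

  ⊕-comm : ∀ x y → x ⊕ y ≡ y ⊕ x
  ⊕-comm x y = cong [_] (ℕ.+-comm (toℕ x) (toℕ y))

  ⊕-identityˡ : ∀ x → [ 0 ] ⊕ x ≡ x
  ⊕-identityˡ x = trans (⊕-comm [ 0 ] x) (trans (⊕-[] x 0) (trans (cong [_] (ℕ.+-identityʳ (toℕ x))) ([toℕ] x)))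

  ⊕-inverseʳ : ∀ x → x ⊕ (⊖ x) ≡ [ 0 ]
  ⊕-inverseʳ x = trans (⊕-[] x _) (trans (cong [_] (trans (ℕ.m+[n∸m]≡n (ℕ.<⇒≤ (Fin.toℕ<n x))) (sym (ℕ.*-identityˡ m))))
                   ([a+km] 0 1))

  isAbelianGroup : IsAbelianGroup _≡_ _⊕_ [ 0 ] ⊖_
  isAbelianGroup = record
    { isGroup = record
      { isMonoid = record
        { isSemigroup = record
          { isMagma = record { isEquivalence = isEquivalence ; ∙-cong = cong₂ _⊕_ }
          ; assoc = ⊕-assoc
          }
        ; identity = ⊕-identityˡ , λ x → trans (⊕-comm x [ 0 ]) (⊕-identityˡ x)
        }
      ; inverse = (λ x → trans (⊕-comm (⊖ x) x) (⊕-inverseʳ x)) , ⊕-inverseʳ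
      ; ⁻¹-cong = cong ⊖_
      }
    ; comm = ⊕-comm
    }

  steps : ∀ {P : Fin m → Set} d → (∀ {x} → P x → P (x ⊕ [ d ])) → ∀ t {x} → P x → P (x ⊕ [ t * d ])
  steps {P} d step zero {x} p = subst P (sym (trans (⊕-comm x [ 0 ]) (⊕-identityˡ x))) p
  steps {P} d step (suc t) {x} p = subst P e (step (steps {P} d step t p))
    where
    e : (x ⊕ [ t * d ]) ⊕ [ d ] ≡ x ⊕ [ d + t * d ]
    e = trans (⊕-assoc x _ _) (cong (x ⊕_) (trans ([]-⊕ (t * d) d) (cong [_] (ℕ.+-comm (t * d) d))))

  generates : ∀ {P : Fin m → Set} → (∀ {x} → P x → P (x ⊕ [ 1 ])) → ∀ {x} → P x → ∀ y → P y
  generates {P} step {x} p y = subst P e (steps {P} 1 step (toℕ (y ⊕ (⊖ x))) p)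
    where
    e : x ⊕ [ toℕ (y ⊕ (⊖ x)) * 1 ] ≡ y
    e = begin
      x ⊕ [ toℕ (y ⊕ (⊖ x)) * 1 ]  ≡⟨ cong (λ a → x ⊕ [ a ]) (ℕ.*-identityʳ _) ⟩
      x ⊕ [ toℕ (y ⊕ (⊖ x)) ]      ≡⟨ cong (x ⊕_) ([toℕ] _) ⟩
      x ⊕ (y ⊕ (⊖ x))              ≡⟨ ⊕-comm x _ ⟩
      (y ⊕ (⊖ x)) ⊕ x              ≡⟨ ⊕-assoc y (⊖ x) x ⟩
      y ⊕ ((⊖ x) ⊕ x)              ≡⟨ cong (y ⊕_) (trans (⊕-comm (⊖ x) x) (⊕-inverseʳ x)) ⟩
      y ⊕ [ 0 ]                    ≡⟨ ⊕-comm y [ 0 ] ⟩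
      [ 0 ] ⊕ y                    ≡⟨ ⊕-identityˡ y ⟩
      y                            ∎
      where open ≡-Reasoning

  -- A nonempty set closed under translation by δ contains a coset of a subgroup gℤ/m, where g
  -- depends on δ only.
  record Coset (δ : Fin m) : Set₁ where
    field
      {g o}  : ℕ
      go≡m   : g * o ≡ m
      2≤o    : 2 ≤ o
      member : ∀ {P : Fin m → Set} → (∀ {x} → P x → P (x ⊕ δ)) → ∀ {x} → P x →
        ∃ λ r → r < g × ∀ t → P [ r + t * g ]

  -- A coset of a cyclic group contains cosets of all its subgroups. This serves to pass to
  -- subgroups of order exactly 2 or 3.
  refine : ∀ {δ} (K : Coset δ) {h e} → Coset.o K ≡ h * e → 2 ≤ e → Coset δ
  refine K {h} {e} o≡he 2≤e = record
    { g = g * h ; o = e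
    ; go≡m = trans (ℕ.*-assoc g h e) (trans (cong (g *_) (sym o≡he)) go≡m)
    ; 2≤o = 2≤e
    ; member = λ {P} step p → let r , r<g , all = member {P} step p in
        r , ℕ.<-≤-trans r<g (ℕ.m≤m*n g h {{h≢0}}) ,
        λ t → subst P (cong (λ k → [ r + k ]) (trans (ℕ.*-assoc t h g) (cong (t *_) (ℕ.*-comm h g)))) (all (t * h))
    }
    where
    open Coset K
    h≢0 : NonZero h
    h≢0 = ≢-nonZero λ { refl → ℕ.<⇒≱ 2≤o (ℕ.≤-trans (ℕ.≤-reflexive o≡he) z≤n) }

  private
    coset′ : ∀ {δ} → δ ≢ [ 0 ] → Coset δ
    coset′ {δ} δ≢0 = record { go≡m = trans (ℕ.*-comm g o) (sym m≡og) ; 2≤o = 2≤o ; member = member }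
      where
      d = toℕ δ
      g = gcd d m
      instance
        d≢0 : NonZero d
        d≢0 = ≢-nonZero λ d≡0 → δ≢0 (trans (sym ([toℕ] δ)) (cong [_] d≡0))
      o = _∣_.quotient (gcd[m,n]∣n d m)
      m≡og : m ≡ o * g
      m≡og = _∣_.equality (gcd[m,n]∣n d m)
      g<m : g < m
      g<m = ℕ.≤-<-trans (∣⇒≤ (gcd[m,n]∣m d m)) (Fin.toℕ<n δ)
      2≤o : 2 ≤ o
      2≤o = ℕ.≰⇒> λ o≤1 → ℕ.<⇒≱ g<m (subst (_≤ g) (sym m≡og) (subst (o * g ≤_) (ℕ.*-identityˡ g) (ℕ.*-monoˡ-≤ g o≤1)))
      instance
        g≢0 : NonZero g
        g≢0 = ≢-nonZero λ g≡0 → ℕ.<⇒≢ (ℕ.≤-<-trans z≤n (Fin.toℕ<n δ))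
                (sym (trans m≡og (trans (cong (o *_) g≡0) (ℕ.*-zeroʳ o))))
      multiple : ∃ λ s → [ s * d ] ≡ [ g ]
      multiple with Bézout.identity (gcd-GCD d m)
      ... | Bézout.+- x y e = x , trans (cong [_] (sym e)) ([a+km] g y)
      -- Here `g` is congruent to `- x * d`, and the coefficient `- x` is represented by
      -- `x * pred m`.
      ... | Bézout.-+ x y e = x * pred m , (begin
        [ x * pred m * d ]                          ≡⟨ [a+km] _ y ⟨
        [ x * pred m * d + y * m ]                  ≡⟨ cong (λ a → [ x * pred m * d + a ]) (sym e) ⟩
        [ x * pred m * d + (g + x * d) ]            ≡⟨ cong [_] (lemma x (pred m) d g) ⟩
        [ g + x * d * suc (pred m) ]                ≡⟨ cong (λ a → [ g + x * d * a ]) (ℕ.suc-pred m) ⟩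
        [ g + x * d * m ]                           ≡⟨ [a+km] g (x * d) ⟩
        [ g ]                                       ∎)
        where
        open ≡-Reasoning
        lemma : ∀ x p d g → x * p * d + (g + x * d) ≡ g + x * d * suc p
        lemma = solve-∀
      member : ∀ {P : Fin m → Set} → (∀ {x} → P x → P (x ⊕ δ)) → ∀ {x} → P x →
        ∃ λ r → r < g × ∀ t → P [ r + t * g ]
      -- As `toℕ x` is `r + q * g`, the target is `t - q` steps of length `g` away; `q * pred o`
      -- stands for `- q` modulo `o`.
      member {P} step {x} p = r , m%n<n (toℕ x) g , λ t → subst P (e t) (steps {P} g step-g (t + q * pred o) p)
        where
        r = toℕ x % g
        q = toℕ x / g
        step-g : ∀ {x} → P x → P (x ⊕ [ g ])
        step-g {x} p = let s , e = multiple in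
          subst (λ y → P (x ⊕ y)) e
            (steps {P} d (λ {x} p → subst (λ y → P (x ⊕ y)) (sym ([toℕ] δ)) (step p)) s p)
        e : ∀ t → x ⊕ [ (t + q * pred o) * g ] ≡ [ r + t * g ]
        e t = begin
          x ⊕ [ (t + q * pred o) * g ]             ≡⟨ ⊕-[] x _ ⟩
          [ toℕ x + (t + q * pred o) * g ]         ≡⟨ cong (λ a → [ a + (t + q * pred o) * g ]) (m≡m%n+[m/n]*n (toℕ x) g) ⟩
          [ (r + q * g) + (t + q * pred o) * g ]   ≡⟨ cong [_] (lemma r q g t (pred o)) ⟩
          [ (r + t * g) + q * (suc (pred o) * g) ] ≡⟨ cong (λ a → [ (r + t * g) + q * a ]) (trans (cong (_* g) (ℕ.suc-pred o {{o≢0}})) (sym m≡og)) ⟩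
          [ (r + t * g) + q * m ]                  ≡⟨ [a+km] (r + t * g) q ⟩
          [ r + t * g ]                            ∎
          where
          open ≡-Reasoning
          o≢0 : NonZero o
          o≢0 = >-nonZero (ℕ.≤-trans (s≤s z≤n) 2≤o)
          lemma : ∀ r q g t p → (r + q * g) + (t + q * p) * g ≡ (r + t * g) + q * (suc p * g)
          lemma = solve-∀

  opaque
    coset : ∀ {δ} → δ ≢ [ 0 ] → Coset δ
    coset = coset′

-- Halves of a cyclic group

data Half : Set where
  lower middle upper : Half

module Halves (m : ℕ) .{{_ : NonZero m}} where
  open Zmod m

  -- Comparing `2 x + 1` with `m` makes the division symmetric under `x ↦ m - 1 - x`. A middle
  -- exists only for odd `m`, and it is the `d` with `2 d + 1 = 0` that occurs in windows.
  half : Fin m → Half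
  half x with ℕ.<-cmp (suc (2 * toℕ x)) m
  ... | tri< _ _ _ = lower
  ... | tri≈ _ _ _ = middle
  ... | tri> _ _ _ = upper

  isLower : Half → Bool
  isLower lower = true
  isLower middle = false
  isLower upper = false

  half-lower : ∀ {x} → suc (2 * toℕ x) < m → half x ≡ lower
  half-lower {x} q with ℕ.<-cmp (suc (2 * toℕ x)) m
  ... | tri< _ _ _ = refl
  ... | tri≈ ¬q _ _ = ⊥-elim (¬q q)
  ... | tri> ¬q _ _ = ⊥-elim (¬q q)

  half-upper : ∀ {x} → m < suc (2 * toℕ x) → half x ≡ upper
  half-upper {x} q with ℕ.<-cmp (suc (2 * toℕ x)) m
  ... | tri< _ _ ¬q = ⊥-elim (¬q q)
  ... | tri≈ _ _ ¬q = ⊥-elim (¬q q)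
  ... | tri> _ _ _ = refl

  half-lower⁻¹ : ∀ {x} → half x ≡ lower → suc (2 * toℕ x) < m
  half-lower⁻¹ {x} e with ℕ.<-cmp (suc (2 * toℕ x)) m
  half-lower⁻¹ {x} e | tri< q _ _ = q
  half-lower⁻¹ {x} () | tri≈ _ _ _
  half-lower⁻¹ {x} () | tri> _ _ _

  half-upper⁻¹ : ∀ {x} → half x ≡ upper → m < suc (2 * toℕ x)
  half-upper⁻¹ {x} e with ℕ.<-cmp (suc (2 * toℕ x)) m
  half-upper⁻¹ {x} () | tri< _ _ _
  half-upper⁻¹ {x} () | tri≈ _ _ _
  half-upper⁻¹ {x} e | tri> _ _ q = q

  half-middle⁻¹ : ∀ {x} → half x ≡ middle → suc (2 * toℕ x) ≡ m
  half-middle⁻¹ {x} e with ℕ.<-cmp (suc (2 * toℕ x)) m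
  half-middle⁻¹ {x} () | tri< _ _ _
  half-middle⁻¹ {x} e | tri≈ _ q _ = q
  half-middle⁻¹ {x} () | tri> _ _ _

  module _ {d : Fin m} (2d+1≡0 : (d ⊕ d) ⊕ [ 1 ] ≡ [ 0 ]) where

    -- The right side is a positive multiple of `m` below `2 * m`.
    m≡2d+1 : m ≡ suc (2 * toℕ d)
    m≡2d+1 with m%n≡0⇒n∣m (suc (2 * toℕ d)) m (trans (cong (_% m) (lemma (toℕ d)))
                  (trans ([]-injective (trans (sym ([]-⊕ (toℕ d + toℕ d) 1)) 2d+1≡0)) (m*n%n≡0 0 m)))
      where
      lemma : ∀ d → suc (2 * d) ≡ (d + d) + 1
      lemma = solve-∀
    ... | divides zero ()
    ... | divides (suc zero) e = sym (trans e (ℕ.*-identityˡ m))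
    ... | divides (suc (suc k)) e = ⊥-elim (ℕ.<-irrefl refl (begin-strict
      suc (2 * toℕ d)       <⟨ ℕ.≤-refl ⟩
      2 + 2 * toℕ d         ≡⟨ lemma (toℕ d) ⟩
      2 * suc (toℕ d)       ≤⟨ ℕ.*-monoʳ-≤ 2 (Fin.toℕ<n d) ⟩
      2 * m                 ≤⟨ ℕ.*-monoˡ-≤ m (s≤s (s≤s (z≤n {k}))) ⟩
      suc (suc k) * m       ≡⟨ e ⟨
      suc (2 * toℕ d)       ∎))
      where
      open ≤-Reasoning
      lemma : ∀ d → 2 + 2 * d ≡ 2 * suc d
      lemma = solve-∀

    -- Adding d = (m - 1) / 2 exchanges the two halves, up to the midpoint.
    half-shift-≤ : ∀ x → toℕ x ≤ toℕ d → half (x ⊕ d) ≢ lower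
    half-shift-≤ x x≤d e = ℕ.<⇒≱ (half-lower⁻¹ e) (begin
      m                               ≡⟨ m≡2d+1 ⟩
      suc (2 * toℕ d)                 ≤⟨ s≤s (ℕ.*-monoʳ-≤ 2 (ℕ.m≤n+m (toℕ d) (toℕ x))) ⟩
      suc (2 * (toℕ x + toℕ d))       ≡⟨ cong (λ a → suc (2 * a)) (toℕ-[]-< sum<m) ⟨
      suc (2 * toℕ (x ⊕ d))           ∎)
      where
      open ≤-Reasoning
      sum<m : toℕ x + toℕ d < m
      sum<m = begin-strict
        toℕ x + toℕ d      ≤⟨ ℕ.+-monoˡ-≤ (toℕ d) x≤d ⟩
        toℕ d + toℕ d      <⟨ ℕ.≤-reflexive (cong (λ a → suc (toℕ d + a)) (sym (ℕ.+-identityʳ (toℕ d)))) ⟩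
        suc (2 * toℕ d)    ≡⟨ m≡2d+1 ⟨
        m                  ∎

    half-shift-> : ∀ x → toℕ d < toℕ x → half (x ⊕ d) ≡ lower
    half-shift-> x d<x with ℕ.m≤n⇒∃[o]m+o≡n d<x
    ... | e , d+e≡x = half-lower (begin-strict
      suc (2 * toℕ (x ⊕ d))    ≡⟨ cong (λ a → suc (2 * a)) toℕ≡e ⟩
      suc (2 * e)              <⟨ s≤s (ℕ.*-monoʳ-< 2 e<d) ⟩
      suc (2 * toℕ d)          ≡⟨ m≡2d+1 ⟨
      m                        ∎)
      where
      open ≤-Reasoning
      e<d : e < toℕ d
      e<d = ℕ.+-cancelˡ-< (suc (toℕ d)) e (toℕ d) (begin-strict
        suc (toℕ d) + e       ≡⟨ d+e≡x ⟩
        toℕ x                 <⟨ Fin.toℕ<n x ⟩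
        m                     ≡⟨ m≡2d+1 ⟩
        suc (2 * toℕ d)       ≡⟨ cong (λ a → suc (toℕ d + a)) (ℕ.+-identityʳ (toℕ d)) ⟩
        suc (toℕ d) + toℕ d   ∎)
      lemma : ∀ d e → (suc d + e) + d ≡ e + 1 * suc (2 * d)
      lemma = solve-∀
      e<m : e < m
      e<m = ℕ.<-trans e<d (Fin.toℕ<n d)
      toℕ≡e : toℕ (x ⊕ d) ≡ e
      toℕ≡e = trans (cong toℕ (trans (cong (λ a → [ a + toℕ d ]) (sym d+e≡x))
                (trans (cong [_] (trans (lemma (toℕ d) e) (cong (λ a → e + 1 * a) (sym m≡2d+1)))) ([a+km] e 1))))
                (toℕ-[]-< e<m)

    lower-shift : ∀ x → half x ≡ lower → half (x ⊕ d) ≢ lower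
    lower-shift x e = half-shift-≤ x (ℕ.*-cancelˡ-≤ 2 (ℕ.<⇒≤ (ℕ.+-cancelˡ-< 1 _ _
      (subst (suc (2 * toℕ x) <_) m≡2d+1 (half-lower⁻¹ e)))))

    middle-shift : ∀ x → half x ≡ middle → half (x ⊕ d) ≢ lower
    middle-shift x e = half-shift-≤ x (ℕ.*-cancelˡ-≤ 2 (ℕ.≤-reflexive (ℕ.suc-injective
      (trans (half-middle⁻¹ e) m≡2d+1))))

    upper-shift : ∀ x → half x ≡ upper → half (x ⊕ d) ≡ lower
    upper-shift x e = half-shift-> x (ℕ.*-cancelˡ-< 2 _ _ (ℕ.+-cancelˡ-< 1 _ _
      (subst (_< suc (2 * toℕ x)) m≡2d+1 (half-upper⁻¹ e))))

  -- A coset has one member `r + t * g` in each of the `o` intervals of length `g` that make up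
  -- `0 , … , m - 1`. So the half of a member can be read off `t`, except near the midpoint, where
  -- it may depend on `r`.
  module _ {g o r} (go≡m : g * o ≡ m) (2≤o : 2 ≤ o) (r<g : r < g) where

    term<m : ∀ {t} → t < o → r + t * g < m
    term<m {t} t<o = begin-strict
      r + t * g      <⟨ ℕ.+-monoˡ-< (t * g) r<g ⟩
      suc t * g      ≤⟨ ℕ.*-monoˡ-≤ g t<o ⟩
      o * g          ≡⟨ trans (ℕ.*-comm o g) go≡m ⟩
      m              ∎
      where open ≤-Reasoning

    first-lower : half [ r + 0 * g ] ≡ lower
    first-lower = half-lower (begin-strict
      suc (2 * toℕ [ r + 0 * g ])   ≡⟨ cong (λ a → suc (2 * a)) (toℕ-[]-< (term<m (ℕ.≤-trans (s≤s z≤n) 2≤o))) ⟩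
      suc (2 * (r + 0 * g))         ≡⟨ lemma r g ⟩
      suc (r + r)                   <⟨ ℕ.≤-refl ⟩
      2 + (r + r)                   ≡⟨ lemma' r ⟩
      2 * suc r                     ≤⟨ ℕ.*-monoʳ-≤ 2 r<g ⟩
      2 * g                         ≤⟨ ℕ.*-monoˡ-≤ g 2≤o ⟩
      o * g                         ≡⟨ trans (ℕ.*-comm o g) go≡m ⟩
      m                             ∎)
      where
      open ≤-Reasoning
      lemma : ∀ r g → suc (2 * (r + 0 * g)) ≡ suc (r + r)
      lemma = solve-∀
      lemma' : ∀ r → 2 + (r + r) ≡ 2 * suc r
      lemma' = solve-∀

    late-upper : ∀ {t} → t < o → o ≤ 2 * t → half [ r + t * g ] ≡ upper
    late-upper {t} t<o o≤2t = half-upper (begin-strict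
      m                              ≡⟨ trans (ℕ.*-comm o g) go≡m ⟨
      o * g                          ≤⟨ ℕ.*-monoˡ-≤ g o≤2t ⟩
      2 * t * g                      ≤⟨ ℕ.m≤n+m _ (2 * r) ⟩
      2 * r + 2 * t * g              <⟨ ℕ.≤-refl ⟩
      suc (2 * r + 2 * t * g)        ≡⟨ lemma r t g ⟩
      suc (2 * (r + t * g))          ≡⟨ cong (λ a → suc (2 * a)) (toℕ-[]-< (term<m t<o)) ⟨
      suc (2 * toℕ [ r + t * g ])    ∎)
      where
      open ≤-Reasoning
      lemma : ∀ r t g → suc (2 * r + 2 * t * g) ≡ suc (2 * (r + t * g))
      lemma = solve-∀

    second-lower : 4 ≤ o → half [ r + 1 * g ] ≡ lower
    second-lower 4≤o = half-lower (begin-strict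
      suc (2 * toℕ [ r + 1 * g ])   ≡⟨ cong (λ a → suc (2 * a)) (toℕ-[]-< (term<m 2≤o)) ⟩
      suc (2 * (r + 1 * g))         <⟨ ℕ.≤-refl ⟩
      2 + 2 * (r + 1 * g)           ≡⟨ lemma r g ⟩
      2 * suc r + 2 * g             ≤⟨ ℕ.+-monoˡ-≤ (2 * g) (ℕ.*-monoʳ-≤ 2 r<g) ⟩
      2 * g + 2 * g                 ≡⟨ lemma' g ⟩
      4 * g                         ≤⟨ ℕ.*-monoˡ-≤ g 4≤o ⟩
      o * g                         ≡⟨ trans (ℕ.*-comm o g) go≡m ⟩
      m                             ∎)
      where
      open ≤-Reasoning
      lemma : ∀ r g → 2 + 2 * (r + 1 * g) ≡ 2 * suc r + 2 * g
      lemma = solve-∀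
      lemma' : ∀ g → 2 * g + 2 * g ≡ 4 * g
      lemma' = solve-∀

-- Over a coset a section becomes two sequences `i` and `j` for which the symbol depends only on the
-- sum of the indices modulo `o`. Rows and columns share the step `g`, which comes from `δ` alone;
-- their offsets `r` and `s` may differ.
module SectionOnCoset {m : ℕ} .{{_ : NonZero m}} {Q : Set} {F : Fin m → Fin m → Quasigroup Q} {δ : Fin m}
  (S : Section (Zmod._⊕_ m) F δ) (coset : Zmod.Coset m δ) where

  open Zmod m hiding (coset)
  open Section S
  open Coset coset public using (g; o; go≡m; 2≤o)

  private
    rows : ∃ λ r → r < g × ∀ t → ∃ λ i → R i [ r + t * g ]
    rows = Coset.member coset {λ x → ∃ λ i → R i x} (λ { (_ , r) → R-step r }) (_ , proj₂ (proj₂ row))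

    cols : ∃ λ s → s < g × ∀ t → ∃ λ j → C j [ s + t * g ]
    cols = Coset.member coset {λ y → ∃ λ j → C j y} (λ { (_ , c) → C-step c }) (_ , proj₂ (proj₂ column))

  r s : ℕ
  r = proj₁ rows
  s = proj₁ cols

  r<g : r < g
  r<g = proj₁ (proj₂ rows)

  s<g : s < g
  s<g = proj₁ (proj₂ cols)

  x y : ℕ → Fin m
  x t = [ r + t * g ]
  y t = [ s + t * g ]

  i j : ℕ → Q
  i t = proj₁ (proj₂ (proj₂ rows) t)
  j t = proj₁ (proj₂ (proj₂ cols) t)

  private
    value : ℕ → ℕ → Q
    value t u = op (F (x t) (y u)) (i t) (j u)

    x⊕y : ∀ t u → x t ⊕ y u ≡ [ (r + s) + (t + u) * g ]
    x⊕y t u = trans ([]-⊕ (r + t * g) (s + u * g)) (cong [_] (lemma r t s u g))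
      where
      lemma : ∀ r t s u g → (r + t * g) + (s + u * g) ≡ (r + s) + (t + u) * g
      lemma = solve-∀

  period : ∀ a t → [ a + (t + o) * g ] ≡ [ a + t * g ]
  period a t = trans (cong [_] (trans (lemma a t o g) (cong (λ k → (a + t * g) + 1 * k) go≡m))) ([a+km] _ 1)
    where
    lemma : ∀ a t o g → a + (t + o) * g ≡ (a + t * g) + 1 * (g * o)
    lemma = solve-∀

  i-period : i o ≡ i 0
  i-period = R-func (subst (R (i o)) (period r 0) (proj₂ (proj₂ (proj₂ rows) o))) (proj₂ (proj₂ (proj₂ rows) 0))

  agree-at : ∀ {t u t' u'} → x t ⊕ y u ≡ x t' ⊕ y u' → value t u ≡ value t' u'
  agree-at {t} {u} {t'} {u'} e = W-func
    (subst (W _) e (value∈ (proj₂ (proj₂ (proj₂ rows) t)) (proj₂ (proj₂ (proj₂ cols) u))))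
    (value∈ (proj₂ (proj₂ (proj₂ rows) t')) (proj₂ (proj₂ (proj₂ cols) u')))

  agree : ∀ t u t' u' → t + u ≡ t' + u' → value t u ≡ value t' u'
  agree t u t' u' e = agree-at (trans (x⊕y t u) (trans (cong (λ k → [ (r + s) + k * g ]) e) (sym (x⊕y t' u'))))

  agree-wrap : ∀ t u t' u' → t + u ≡ (t' + u') + o → value t u ≡ value t' u'
  agree-wrap t u t' u' e = agree-at (trans (x⊕y t u) (trans (cong (λ k → [ (r + s) + k * g ]) e)
    (trans (period (r + s) (t' + u')) (sym (x⊕y t' u')))))

-- Prime fibres

even-or-odd : ∀ n → ∃ λ h → n ≡ 2 * h ⊎ n ≡ suc (2 * h)
even-or-odd zero = 0 , inj₁ refl
even-or-odd (suc n) with even-or-odd n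
... | h , inj₁ e = h , inj₂ (cong suc e)
... | h , inj₂ e = suc h , inj₁ (trans (cong suc e) (cong suc (sym (ℕ.+-suc h (h + 0)))))

last-true : ∀ (f : ℕ → Bool) n → f 0 ≡ true → f n ≡ false → ∃ λ c → f c ≡ true × f (suc c) ≡ false
last-true f zero e e' = ⊥-elim (Bool.not-¬ e' e)
last-true f (suc n) e e' with f n in q
... | true = n , q , e'
... | false = last-true f n e q

module PrimeField (p : ℕ) (prime : Prime p) (5≤p : 5 ≤ p) where

  instance
    p≢0 : NonZero p
    p≢0 = prime⇒nonZero prime

  open Zmod p renaming (_⊕_ to infixl 6 _∔_; ⊖_ to infix 8 -_) public

  abelianGroup : AbelianGroup _ _
  abelianGroup = record { isAbelianGroup = isAbelianGroup }

  open AbelianGroup abelianGroup public using (identityˡ; identityʳ; inverseˡ; inverseʳ; commutativeMonoid)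
  open AbelianGroupProperties abelianGroup public
    using (∙-cancelˡ; ∙-cancelʳ; ⁻¹-involutive; inverseʳ-unique; inverseˡ-unique; x∙y⁻¹≈ε⇒x≈y)
  open CommutativeMonoidSolver commutativeMonoid public using (solve; _⊜_) renaming (_⊕_ to infixl 6 _:+_)

  Q = Fin p

  small : ∀ {a b} → a < 5 → b < 5 → a ≢ b → [ a ] ≢ [ b ]
  small a<5 b<5 a≢b e = a≢b (trans (sym (toℕ-[]-< (ℕ.<-≤-trans a<5 5≤p)))
    (trans (cong toℕ e) (toℕ-[]-< (ℕ.<-≤-trans b<5 5≤p))))

  multiple-zero : ∀ k .{{_ : NonZero k}} x → k < 5 → [ k * toℕ x ] ≡ [ 0 ] → x ≡ [ 0 ]
  multiple-zero k x k<5 e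
    with euclidsLemma k (toℕ x) prime (m%n≡0⇒n∣m (k * toℕ x) p (trans ([]-injective e) (m*n%n≡0 0 p)))
  ... | inj₁ p∣k = ⊥-elim (ℕ.<⇒≱ (ℕ.<-≤-trans k<5 5≤p) (∣⇒≤ p∣k))
  ... | inj₂ p∣x with toℕ x in q
  ...   | zero = trans (sym ([toℕ] x)) (cong [_] q)
  ...   | suc _ = ⊥-elim (ℕ.<⇒≱ (subst (_< p) q (Fin.toℕ<n x)) (∣⇒≤ p∣x))

  double-zero : ∀ x → x ∔ x ≡ [ 0 ] → x ≡ [ 0 ]
  double-zero x e = multiple-zero 2 x (s≤s (s≤s (s≤s z≤n)))
    (trans (cong (λ a → [ toℕ x + a ]) (ℕ.+-identityʳ (toℕ x))) e)

  triple-zero : ∀ x → x ∔ (x ∔ x) ≡ [ 0 ] → x ≡ [ 0 ]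
  triple-zero x e = multiple-zero 3 x (s≤s (s≤s (s≤s (s≤s z≤n))))
    (trans (cong (λ a → [ toℕ x + (toℕ x + a) ]) (ℕ.+-identityʳ (toℕ x))) (trans (sym (⊕-[] x _)) e))

  double-injective : ∀ x y → x ∔ x ≡ y ∔ y → x ≡ y
  double-injective x y e = x∙y⁻¹≈ε⇒x≈y x y (double-zero (x ∔ - y) (begin
    (x ∔ - y) ∔ (x ∔ - y)   ≡⟨ solve 2 (λ x y → (x :+ y) :+ (x :+ y) ⊜ (x :+ x) :+ (y :+ y)) refl x (- y) ⟩
    (x ∔ x) ∔ (- y ∔ - y)   ≡⟨ cong (_∔ (- y ∔ - y)) e ⟩
    (y ∔ y) ∔ (- y ∔ - y)   ≡⟨ solve 2 (λ x y → (x :+ x) :+ (y :+ y) ⊜ (x :+ y) :+ (x :+ y)) refl y (- y) ⟩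
    (y ∔ - y) ∔ (y ∔ - y)   ≡⟨ cong₂ _∔_ (inverseʳ y) (inverseʳ y) ⟩
    [ 0 ] ∔ [ 0 ]           ≡⟨ identityˡ _ ⟩
    [ 0 ]                   ∎))
    where open ≡-Reasoning

  -- For the identity, `θ i ∔ i` vanishes at 0 only; exchanging 0 with another element removes this
  -- zero (`swap02-sum`). The partner 2 avoids 1 and its negative, the rows of type true.
  swap02 : Q → Q
  swap02 i with i Fin.≟ [ 0 ] | i Fin.≟ [ 2 ]
  ... | yes _ | _     = [ 2 ]
  ... | no _  | yes _ = [ 0 ]
  ... | no _  | no _  = i

  2≢0 : [ 2 ] ≢ [ 0 ]
  2≢0 = small (s≤s (s≤s (s≤s z≤n))) (s≤s z≤n) λ ()

  swap02-0 : swap02 [ 0 ] ≡ [ 2 ]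
  swap02-0 with [ 0 ] Fin.≟ [ 0 ] | [ 0 ] Fin.≟ [ 2 ]
  ... | yes _ | _ = refl
  ... | no ¬e | _ = ⊥-elim (¬e refl)

  swap02-2 : swap02 [ 2 ] ≡ [ 0 ]
  swap02-2 with [ 2 ] Fin.≟ [ 0 ] | [ 2 ] Fin.≟ [ 2 ]
  ... | yes e | _ = ⊥-elim (2≢0 e)
  ... | no _ | yes _ = refl
  ... | no _ | no ¬e = ⊥-elim (¬e refl)

  swap02-cases : ∀ i → (i ≡ [ 0 ] × swap02 i ≡ [ 2 ]) ⊎ (i ≡ [ 2 ] × swap02 i ≡ [ 0 ]) ⊎
    (i ≢ [ 0 ] × i ≢ [ 2 ] × swap02 i ≡ i)
  swap02-cases i with i Fin.≟ [ 0 ] | i Fin.≟ [ 2 ]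
  ... | yes e | _ = inj₁ (e , refl)
  ... | no _ | yes e = inj₂ (inj₁ (e , refl))
  ... | no i≢0 | no i≢2 = inj₂ (inj₂ (i≢0 , i≢2 , refl))

  swap02-involutive : ∀ i → swap02 (swap02 i) ≡ i
  swap02-involutive i with swap02-cases i
  ... | inj₁ (refl , e) = trans (cong swap02 e) swap02-2
  ... | inj₂ (inj₁ (refl , e)) = trans (cong swap02 e) swap02-0
  ... | inj₂ (inj₂ (i≢0 , i≢2 , e)) = trans (cong swap02 e) e

  swap02-sum : ∀ i → swap02 i ∔ i ≢ [ 0 ]
  swap02-sum i s with swap02-cases i
  ... | inj₁ (refl , e) = 2≢0 (trans (sym (identityʳ _)) (trans (cong (_∔ [ 0 ]) (sym e)) s))
  ... | inj₂ (inj₁ (refl , e)) = 2≢0 (trans (sym (identityˡ _)) (trans (cong (_∔ [ 2 ]) (sym e)) s))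
  ... | inj₂ (inj₂ (i≢0 , _ , e)) = i≢0 (double-zero i (trans (cong (_∔ i) (sym e)) s))

  -- The set is closed under negation and avoids 0 and 2, so all `θ` preserve types. With ∞ = 0 the
  -- column of ∞ in row `i` is `- θ i`, so it has the type of `i`.
  T : Q → Bool
  T i = does (i Fin.≟ [ 1 ]) ∨ does (i Fin.≟ - [ 1 ])

  T-1 : T [ 1 ] ≡ true
  T-1 = cong (_∨ does ([ 1 ] Fin.≟ - [ 1 ])) (dec-true ([ 1 ] Fin.≟ [ 1 ]) refl)

  T-false : ∀ {i} → i ≢ [ 1 ] → i ≢ - [ 1 ] → T i ≡ false
  T-false {i} i≢1 i≢-1 = cong₂ _∨_ (dec-false (i Fin.≟ [ 1 ]) i≢1) (dec-false (i Fin.≟ - [ 1 ]) i≢-1)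

  ≢-1 : ∀ {i} → i ∔ [ 1 ] ≢ [ 0 ] → i ≢ - [ 1 ]
  ≢-1 s refl = s (inverseˡ [ 1 ])

  T-0 : T [ 0 ] ≡ false
  T-0 = T-false (small (s≤s z≤n) (s≤s (s≤s z≤n)) λ ())
    (≢-1 (λ e → small {1} {0} (s≤s (s≤s z≤n)) (s≤s z≤n) (λ ()) (trans (sym (identityˡ _)) e)))

  T-2 : T [ 2 ] ≡ false
  T-2 = T-false (small (s≤s (s≤s (s≤s z≤n))) (s≤s (s≤s z≤n)) λ ())
    (≢-1 (λ e → small {3} {0} (s≤s (s≤s (s≤s (s≤s z≤n)))) (s≤s z≤n) (λ ()) (trans (sym ([]-⊕ 2 1)) e)))

  T-neg : ∀ i → T (- i) ≡ T i
  T-neg i = trans (cong₂ _∨_ (same (- i) [ 1 ] i (- [ 1 ]) (λ e → trans (sym (⁻¹-involutive i)) (cong -_ e))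
                                       (λ e → trans (cong -_ e) (⁻¹-involutive [ 1 ])))
                             (same (- i) (- [ 1 ]) i [ 1 ] (λ e → trans (sym (⁻¹-involutive i)) (trans (cong -_ e) (⁻¹-involutive [ 1 ])))
                                       (cong -_)))
                  (Bool.∨-comm (does (i Fin.≟ - [ 1 ])) (does (i Fin.≟ [ 1 ])))
    where
    same : ∀ (a b c d : Q) → (a ≡ b → c ≡ d) → (c ≡ d → a ≡ b) → does (a Fin.≟ b) ≡ does (c Fin.≟ d)
    same a b c d f g with c Fin.≟ d
    ... | yes e = dec-true (a Fin.≟ b) (g e)
    ... | no ¬e = dec-false (a Fin.≟ b) (λ e → ¬e (f e))

  T-swap : ∀ i → T (swap02 i) ≡ T i
  T-swap i with swap02-cases i
  ... | inj₁ (refl , e) = trans (cong T e) (trans T-2 (sym T-0))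
  ... | inj₂ (inj₁ (refl , e)) = trans (cong T e) (trans T-0 (sym T-2))
  ... | inj₂ (inj₂ (_ , _ , e)) = cong T e

  swap02-T : ∀ {i} → T i ≡ true → swap02 i ≡ i
  swap02-T {i} t with swap02-cases i
  ... | inj₁ (refl , _) = ⊥-elim (Bool.not-¬ T-0 t)
  ... | inj₂ (inj₁ (refl , _)) = ⊥-elim (Bool.not-¬ T-2 t)
  ... | inj₂ (inj₂ (_ , _ , e)) = e

  double-T : ∀ {i} → T i ≡ true → i ∔ i ≢ [ 0 ]
  double-T {i} t e = Bool.not-¬ T-0 (trans (sym (cong T (double-zero i e))) t)

  -- For negation `θ i ∔ i` is always zero and for the transposition never. This clash excludes
  -- sections, which meet both halves. At the midpoint the transposition would allow a window with
  -- `i = 0` and `i' = 1`, both sums being 2.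
  θ : Bool → Half → Q → Q
  θ false _      i = i
  θ true  lower  i = - i
  θ true  middle i = i
  θ true  upper  i = swap02 i

  θ-involutive : ∀ b h i → θ b h (θ b h i) ≡ i
  θ-involutive false _ i = refl
  θ-involutive true lower i = ⁻¹-involutive i
  θ-involutive true middle i = refl
  θ-involutive true upper i = swap02-involutive i

  T-θ : ∀ b h i → T (θ b h i) ≡ T i
  T-θ false _ i = refl
  T-θ true lower i = T-neg i
  T-θ true middle i = refl
  T-θ true upper i = T-swap i

  table : (θ : Q → Q) → (∀ i → θ (θ i) ≡ i) → Quasigroup Q
  table θ invol = record
    { op = λ i j → θ i ∔ j
    ; colOf = λ i κ → - θ i ∔ κ
    ; rowOf = λ j κ → θ (κ ∔ - j)
    ; op-colOf = λ i κ → trans (sym (⊕-assoc _ _ κ)) (trans (cong (_∔ κ) (inverseʳ (θ i))) (identityˡ κ))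
    ; colOf-op = λ i j → trans (sym (⊕-assoc _ _ j)) (trans (cong (_∔ j) (inverseˡ (θ i))) (identityˡ j))
    ; op-rowOf = λ j κ → trans (cong (_∔ j) (invol _)) (trans (⊕-assoc κ _ j) (trans (cong (κ ∔_) (inverseˡ j)) (identityʳ κ)))
    ; rowOf-op = λ i j → trans (cong θ (trans (⊕-assoc _ j _) (trans (cong (θ i ∔_) (inverseʳ j)) (identityʳ _)))) (invol i)
    }

  closed⇒full : ∀ {P : Q → Set} {δ} → δ ≢ [ 0 ] → (∀ {x} → P x → P (x ∔ δ)) → ∀ {x} → P x → ∀ y → P y
  closed⇒full {P} δ≢0 step h y = lemma (coset δ≢0)
    where
    lemma : Coset _ → P y
    lemma record { g = g ; o = o ; go≡m = go≡p ; 2≤o = 2≤o ; member = member }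
      with r , r<g , all ← member {P} step h
      with prime⇒irreducible prime (divides o (trans (sym go≡p) (ℕ.*-comm g o)))
    ... | inj₁ refl = subst P (trans (cong [_] (trans (cong (_+ toℕ y * 1) (ℕ.n<1⇒n≡0 r<g)) (ℕ.*-identityʳ (toℕ y)))) ([toℕ] y))
                        (all (toℕ y))
    ... | inj₂ refl = ⊥-elim (ℕ.<⇒≢ 2≤o (sym (ℕ.*-cancelˡ-≡ o 1 p (trans go≡p (sym (ℕ.*-identityʳ p))))))

  -- Following symbols from one row to the other translates the columns by the nonzero constant `δ`,
  -- and this generates the group of prime order.
  table-simple : ∀ θ invol → Simple (table θ invol)
  table-simple θ invol {R} {C} {W} _ _ S {i} {i'} {j} r r' i≢i' c =
    allCols⇒allRows S (closed⇒full {C} δ≢0 step c) r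
    where
    δ = - θ i' ∔ θ i
    δ≢0 : δ ≢ [ 0 ]
    δ≢0 e = i≢i' (trans (sym (invol i)) (trans (cong θ θi≡θi') (invol i')))
      where
      θi≡θi' : θ i ≡ θ i'
      θi≡θi' = trans (inverseʳ-unique (- θ i') (θ i) e) (⁻¹-involutive (θ i'))
    step : ∀ {j} → C j → C (j ∔ δ)
    step {j} c with inRow S r' (inside S r c)
    ... | j' , c' , e = subst C (∙-cancelˡ (θ i') j' (j ∔ δ) (trans e (sym shifted))) c'
      where
      shifted : θ i' ∔ (j ∔ (- θ i' ∔ θ i)) ≡ θ i ∔ j
      shifted = trans (solve 4 (λ a b c d → a :+ (b :+ (c :+ d)) ⊜ (a :+ c) :+ (d :+ b)) refl (θ i') j (- θ i') (θ i))
                  (trans (cong (_∔ (θ i ∔ j)) (inverseʳ (θ i'))) (identityˡ _))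

  -- The data of a section along a coset of odd order 2k + 1: i and b are the values of the rows on
  -- the two halves of the columns.
  module OddSection (i b j : ℕ → Q) (k c : ℕ)
    (wrap : ∀ t → b t ∔ j 0 ≡ i (suc t) ∔ j (2 * k))
    (jump : ∀ t → i t ∔ j (suc c) ≡ b (suc t) ∔ j c)
    (i-period : i (suc (2 * k)) ≡ i 0) (b-period : b (suc (2 * k)) ≡ b 0)
    (b₀ : b 0 ≡ - i 0) (b₁ : k ≢ 1 → b 1 ≡ - i 1) (b-last : b (2 * k) ≡ swap02 (i (2 * k))) where

    open ≡-Reasoning

    u v : Q
    u = j 0 ∔ - j (2 * k)
    v = j (suc c) ∔ - j c

    solved : ∀ a a' b c → a ∔ b ≡ a' ∔ c → a' ≡ a ∔ (b ∔ - c)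
    solved a a' b c e = trans (sym (trans (⊕-assoc a' c (- c)) (trans (cong (a' ∔_) (inverseʳ c)) (identityʳ a'))))
      (trans (cong (_∔ - c) (sym e)) (⊕-assoc a b (- c)))

    i-suc : ∀ t → i (suc t) ≡ b t ∔ u
    i-suc t = solved (b t) (i (suc t)) (j 0) (j (2 * k)) (wrap t)

    b-suc : ∀ t → b (suc t) ≡ i t ∔ v
    b-suc t = solved (i t) (b (suc t)) (j (suc c)) (j c) (jump t)

    -- One step exchanges the roles of `i` and `b`, up to the constants `u` and `v`; two steps
    -- restore them and preserve the difference.
    two-steps : ∀ t d → b t ≡ i t ∔ d → b (suc (suc t)) ≡ i (suc (suc t)) ∔ d
    two-steps t d e = begin
      b (suc (suc t))         ≡⟨ b-suc (suc t) ⟩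
      i (suc t) ∔ v           ≡⟨ cong (_∔ v) (i-suc t) ⟩
      (b t ∔ u) ∔ v           ≡⟨ cong (λ a → (a ∔ u) ∔ v) e ⟩
      ((i t ∔ d) ∔ u) ∔ v     ≡⟨ solve 4 (λ a d u v → ((a :+ d) :+ u) :+ v ⊜ ((a :+ v) :+ u) :+ d) refl (i t) d u v ⟩
      ((i t ∔ v) ∔ u) ∔ d     ≡⟨ cong (λ a → (a ∔ u) ∔ d) (sym (b-suc t)) ⟩
      (b (suc t) ∔ u) ∔ d     ≡⟨ cong (_∔ d) (sym (i-suc (suc t))) ⟩
      i (suc (suc t)) ∔ d     ∎

    difference : ∀ a a' → a' ≡ a ∔ (a' ∔ - a)
    difference a a' = trans (sym (identityʳ a')) (trans (cong (a' ∔_) (sym (inverseʳ a)))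
      (solve 3 (λ a a' c → a' :+ (a :+ c) ⊜ a :+ (a' :+ c)) refl a a' (- a)))

    D D₁ : Q
    D = b 0 ∔ - i 0
    D₁ = b 1 ∔ - i 1

    b-odd : ∀ t → b (suc (2 * t)) ≡ i (suc (2 * t)) ∔ D₁
    b-odd zero = difference (i 1) (b 1)
    b-odd (suc t) = subst (λ a → b (suc a) ≡ i (suc a) ∔ D₁) (lemma t) (two-steps (suc (2 * t)) D₁ (b-odd t))
      where
      lemma : ∀ t → suc (suc (2 * t)) ≡ 2 * suc t
      lemma = solve-∀

    -- Even and odd indices have constant differences of their own; going once around the odd period
    -- links the two.
    D₁≡D : D₁ ≡ D
    D₁≡D = ∙-cancelˡ (i 0) _ _ (begin
      i 0 ∔ D₁               ≡⟨ cong (_∔ D₁) (sym i-period) ⟩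
      i (suc (2 * k)) ∔ D₁   ≡⟨ sym (b-odd k) ⟩
      b (suc (2 * k))        ≡⟨ b-period ⟩
      b 0                    ≡⟨ difference (i 0) (b 0) ⟩
      i 0 ∔ D                ∎)

    b≡i+D : ∀ t → b t ≡ i t ∔ D
    b≡i+D zero = difference (i 0) (b 0)
    b≡i+D (suc zero) = trans (difference (i 1) (b 1)) (cong (i 1 ∔_) D₁≡D)
    b≡i+D (suc (suc t)) = two-steps t D (b≡i+D t)

    E : Q
    E = D ∔ u

    i-step : ∀ t → i (suc t) ≡ i t ∔ E
    i-step t = trans (i-suc t) (trans (cong (_∔ u) (b≡i+D t)) (⊕-assoc (i t) D u))

    lower-sum : ∀ t → b t ≡ - i t → (i t ∔ D) ∔ i t ≡ [ 0 ]
    lower-sum t e = trans (cong (_∔ i t) (trans (sym (b≡i+D t)) e)) (inverseˡ (i t))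

    no-step : i 1 ≡ i 0 → E ≡ [ 0 ]
    no-step e = ∙-cancelˡ (i 0) _ _ (trans (sym (i-step 0)) (trans e (sym (identityʳ (i 0)))))

    three-steps : k ≡ 1 → E ≡ [ 0 ]
    three-steps k≡1 = triple-zero E (∙-cancelˡ (i 0) _ _ (begin
      i 0 ∔ (E ∔ (E ∔ E))   ≡⟨ solve 2 (λ a e → a :+ (e :+ (e :+ e)) ⊜ ((a :+ e) :+ e) :+ e) refl (i 0) E ⟩
      ((i 0 ∔ E) ∔ E) ∔ E   ≡⟨ cong (λ a → (a ∔ E) ∔ E) (sym (i-step 0)) ⟩
      (i 1 ∔ E) ∔ E         ≡⟨ cong (_∔ E) (sym (i-step 1)) ⟩
      i 2 ∔ E               ≡⟨ sym (i-step 2) ⟩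
      i 3                   ≡⟨ cong (λ k → i (suc (2 * k))) (sym k≡1) ⟩
      i (suc (2 * k))       ≡⟨ i-period ⟩
      i 0                   ≡⟨ sym (identityʳ (i 0)) ⟩
      i 0 ∔ [ 0 ]           ∎))

    two-lower : k ≢ 1 → E ≡ [ 0 ]
    two-lower k≢1 = no-step (double-injective _ _ (∙-cancelʳ D _ _ (begin
      (i 1 ∔ i 1) ∔ D       ≡⟨ solve 2 (λ a d → (a :+ a) :+ d ⊜ (a :+ d) :+ a) refl (i 1) D ⟩
      (i 1 ∔ D) ∔ i 1       ≡⟨ lower-sum 1 (b₁ k≢1) ⟩
      [ 0 ]                 ≡⟨ sym (lower-sum 0 b₀) ⟩
      (i 0 ∔ D) ∔ i 0       ≡⟨ solve 2 (λ a d → (a :+ d) :+ a ⊜ (a :+ a) :+ d) refl (i 0) D ⟩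
      (i 0 ∔ i 0) ∔ D       ∎)))

    -- The rows form an arithmetic progression with difference `E`. A lower row satisfies
    -- `2 i + D = 0`, so two of them are equal. For order 3 only one row is sure to be lower, but
    -- there periodicity gives `3 E = 0`.
    E≡0 : E ≡ [ 0 ]
    E≡0 with k ℕ.≟ 1
    ... | yes k≡1 = three-steps k≡1
    ... | no k≢1 = two-lower k≢1

    i-const : ∀ t → i t ≡ i 0
    i-const zero = refl
    i-const (suc t) = trans (i-step t) (trans (cong (i t ∔_) E≡0) (trans (identityʳ (i t)) (i-const t)))

    -- Now all rows equal `i 0`, so `2 i + D = 0` holds at the last, upper row too; there `i + D` is
    -- `swap02 i`.
    contradiction : ⊥
    contradiction = swap02-sum (i (2 * k)) (begin
      swap02 (i (2 * k)) ∔ i (2 * k)   ≡⟨ cong (_∔ i (2 * k)) (trans (sym b-last) (b≡i+D (2 * k))) ⟩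
      (i (2 * k) ∔ D) ∔ i (2 * k)      ≡⟨ cong (λ a → (a ∔ D) ∔ a) (i-const (2 * k)) ⟩
      (i 0 ∔ D) ∔ i 0                  ≡⟨ lower-sum 0 b₀ ⟩
      [ 0 ]                            ∎)

  -- Adding the two equations cancels `i` and both columns and leaves `swap02 i' ∔ i' = 0`.
  module EvenSection (i i' j j' : Q) (e₁ : - i ∔ j ≡ i' ∔ j') (e₂ : i ∔ j' ≡ swap02 i' ∔ j) where

    open ≡-Reasoning

    contradiction : ⊥
    contradiction = swap02-sum i' (∙-cancelʳ (j' ∔ j) _ _ (begin
      (swap02 i' ∔ i') ∔ (j' ∔ j)    ≡⟨ solve 4 (λ a b c d → (a :+ b) :+ (c :+ d) ⊜ (b :+ c) :+ (a :+ d)) refl (swap02 i') i' j' j ⟩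
      (i' ∔ j') ∔ (swap02 i' ∔ j)    ≡⟨ cong₂ _∔_ (sym e₁) (sym e₂) ⟩
      (- i ∔ j) ∔ (i ∔ j')           ≡⟨ solve 4 (λ a b c d → (a :+ b) :+ (c :+ d) ⊜ (a :+ c) :+ (d :+ b)) refl (- i) j i j' ⟩
      (- i ∔ i) ∔ (j' ∔ j)           ≡⟨ cong (_∔ (j' ∔ j)) (inverseˡ i) ⟩
      [ 0 ] ∔ (j' ∔ j)               ∎))

  module Blocks (m : ℕ) .{{_ : NonZero m}} where
    private
      module G = Zmod m
      open Halves m
      infixl 6 _⊕_
      _⊕_ = G._⊕_

    low : Fin m → Bool
    low y = isLower (half y)

    F : Fin m → Fin m → Quasigroup Q
    F x y = table (θ (low y) (half x)) (θ-involutive (low y) (half x))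

    same-type : ∀ x y {i j} → op (F x y) i j ≡ [ 0 ] → T i ≡ T j
    same-type x y {i} {j} e = trans (sym (T-θ (low y) (half x) i))
      (trans (sym (T-neg (θ (low y) (half x) i))) (cong T (sym (inverseʳ-unique _ j e))))

    -- Adding the equations eliminates `j` and `j'`. If `y` and `y ⊕ d` have the same flag, both
    -- sides are doubles, and halving them contradicts the types. Otherwise one summand on each side
    -- is untouched by `θ`, and the halves of `x` and `x ⊕ d` decide, using that `swap02` fixes the
    -- rows of type true.
    no-window : ∀ x y d {i i' j j'} → (d ⊕ d) ⊕ G.[ 1 ] ≡ G.[ 0 ] → T i ≡ false → T i' ≡ true →
      op (F x y) i j ≡ [ 0 ] → op (F (x ⊕ d) (y ⊕ d)) i' j' ≡ [ 0 ] →
      op (F x (y ⊕ d)) i j' ≢ op (F (x ⊕ d) y) i' j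
    no-window x y d {i} {i'} {j} {j'} 2d+1≡0 t t' e₀ e₁ e =
      cases (low y) (low (y ⊕ d)) (half x) (half (x ⊕ d)) refl refl sums
      where
      open ≡-Reasoning
      i≢i' : i ≢ i'
      i≢i' refl = Bool.not-¬ t t'
      sums : θ (low y) (half x) i ∔ θ (low (y ⊕ d)) (half x) i ≡
             θ (low y) (half (x ⊕ d)) i' ∔ θ (low (y ⊕ d)) (half (x ⊕ d)) i'
      sums = ∙-cancelʳ (j ∔ j') _ _ (begin
        (a ∔ b) ∔ (j ∔ j')      ≡⟨ solve 4 (λ a b j j' → (a :+ b) :+ (j :+ j') ⊜ (a :+ j) :+ (b :+ j')) refl a b j j' ⟩
        (a ∔ j) ∔ (b ∔ j')      ≡⟨ cong₂ _∔_ e₀ e ⟩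
        [ 0 ] ∔ (b' ∔ j)        ≡⟨ cong (_∔ (b' ∔ j)) (sym e₁) ⟩
        (a' ∔ j') ∔ (b' ∔ j)    ≡⟨ solve 4 (λ a b j j' → (a :+ j') :+ (b :+ j) ⊜ (b :+ a) :+ (j :+ j')) refl a' b' j j' ⟩
        (b' ∔ a') ∔ (j ∔ j')    ∎)
        where
        a = θ (low y) (half x) i
        b = θ (low (y ⊕ d)) (half x) i
        a' = θ (low (y ⊕ d)) (half (x ⊕ d)) i'
        b' = θ (low y) (half (x ⊕ d)) i'
      unmixed : ∀ b h h' → θ b h i ∔ θ b h i ≢ θ b h' i' ∔ θ b h' i'
      unmixed b h h' s = Bool.not-¬ t (trans (sym (T-θ b h i))
        (trans (cong T (double-injective (θ b h i) (θ b h' i') s)) (trans (T-θ b h' i') t')))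
      mixed : ∀ h h' → half x ≡ h → half (x ⊕ d) ≡ h' → θ true h i ∔ i ≢ θ true h' i' ∔ i'
      mixed lower lower e e' s = lower-shift 2d+1≡0 x e e'
      mixed lower middle e e' s = double-T {i'} t' (trans (sym s) (inverseˡ i))
      mixed lower upper e e' s = double-T {i'} t' (trans (cong (_∔ i') (sym (swap02-T {i'} t'))) (trans (sym s) (inverseˡ i)))
      mixed middle lower e e' s = middle-shift 2d+1≡0 x e e'
      mixed middle middle e e' s = i≢i' (double-injective i i' s)
      mixed middle upper e e' s = i≢i' (double-injective i i' (trans s (cong (_∔ i') (swap02-T {i'} t'))))
      mixed upper lower e e' s = swap02-sum i (trans s (inverseˡ i'))
      mixed upper middle e e' s with trans (sym e') (upper-shift 2d+1≡0 x e)
      ... | ()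
      mixed upper upper e e' s with trans (sym e') (upper-shift 2d+1≡0 x e)
      ... | ()
      cases : ∀ b b' h h' → half x ≡ h → half (x ⊕ d) ≡ h' → θ b h i ∔ θ b' h i ≢ θ b h' i' ∔ θ b' h' i'
      cases true true h h' e e' s = unmixed true h h' s
      cases false false h h' e e' s = unmixed false h h' s
      cases true false h h' e e' s = mixed h h' e e' s
      cases false true h h' e e' s = mixed h h' e e'
        (trans (⊕-comm _ i) (trans s (⊕-comm i' _)))

    module OnCoset {δ} (S : Section _⊕_ F δ) (coset : G.Coset δ) where

      open SectionOnCoset S coset

      b : ℕ → Q
      b t = θ true (half (x t)) (i t)

      at-low : ∀ t u → low (y u) ≡ true → op (F (x t) (y u)) (i t) (j u) ≡ b t ∔ j u
      at-low t u = cong (λ b → θ b (half (x t)) (i t) ∔ j u)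

      at-high : ∀ t u → low (y u) ≡ false → op (F (x t) (y u)) (i t) (j u) ≡ i t ∔ j u
      at-high t u = cong (λ b → θ b (half (x t)) (i t) ∔ j u)

      b-lower : ∀ t → half (x t) ≡ lower → b t ≡ - i t
      b-lower t = cong (λ h → θ true h (i t))

      b-upper : ∀ t → half (x t) ≡ upper → b t ≡ swap02 (i t)
      b-upper t = cong (λ h → θ true h (i t))

      x₀-lower : half (x 0) ≡ lower
      x₀-lower = first-lower go≡m 2≤o r<g
      low-y₀ : low (y 0) ≡ true
      low-y₀ = cong isLower (first-lower go≡m 2≤o s<g)
      x-upper : ∀ {t} → t < o → o ≤ 2 * t → half (x t) ≡ upper
      x-upper = late-upper go≡m 2≤o r<g
      low-y : ∀ {t} → t < o → o ≤ 2 * t → low (y t) ≡ false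
      low-y t<o o≤2t = cong isLower (late-upper go≡m 2≤o s<g t<o o≤2t)

      -- The indices 0 and `h` span a coset of the subgroup of order two, with one member in each
      -- half.
      even : ∀ h → o ≡ 2 * h → ⊥
      even h o≡2h = EvenSection.contradiction (i 0) (i h) (j 0) (j h) e₁ e₂
        where
        h<o : h < o
        h<o = subst (h <_) (sym o≡2h) (ℕ.m<m+n h (subst (0 <_) (sym (ℕ.+-identityʳ h)) (ℕ.n≢0⇒n>0 λ { refl →
          ℕ.<⇒≱ 2≤o (ℕ.≤-trans (ℕ.≤-reflexive o≡2h) z≤n) })))
        o≤2h : o ≤ 2 * h
        o≤2h = ℕ.≤-reflexive o≡2h
        h+h≡o : h + h ≡ 0 + o
        h+h≡o = trans (cong (h +_) (sym (ℕ.+-identityʳ h))) (sym o≡2h)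
        e₁ : - i 0 ∔ j 0 ≡ i h ∔ j h
        e₁ = trans (cong (_∔ j 0) (sym (b-lower 0 x₀-lower))) (trans (sym (at-low 0 0 low-y₀))
               (trans (sym (agree-wrap h h 0 0 h+h≡o)) (at-high h h (low-y h<o o≤2h))))
        e₂ : i 0 ∔ j h ≡ swap02 (i h) ∔ j 0
        e₂ = trans (sym (at-high 0 h (low-y h<o o≤2h))) (trans (agree 0 h h 0 (sym (ℕ.+-identityʳ h)))
               (trans (at-low h 0 low-y₀) (cong (_∔ j 0) (b-upper h (x-upper h<o o≤2h)))))

      -- `wrap` compares the lower column 0 with the upper column `2 * k`, whose indices differ by
      -- one step backwards around the cycle; `jump` compares the adjacent columns where lowness
      -- ends.
      odd : ∀ k → o ≡ suc (2 * k) → ⊥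
      odd k o≡2k+1 = OddSection.contradiction i b j k c wrap jump
        (trans (cong i (sym o≡2k+1)) i-period)
        (trans (cong b (sym o≡2k+1)) (cong₂ (θ true) (cong half (period r 0)) i-period))
        (b-lower 0 x₀-lower)
        (λ k≢1 → b-lower 1 (second-lower go≡m 2≤o r<g (4≤o (ℕ.≤∧≢⇒< 1≤k (λ e → k≢1 (sym e))))))
        (b-upper n (x-upper n<o o≤2n))
        where
        n : ℕ
        n = 2 * k
        n<o : n < o
        n<o = ℕ.≤-reflexive (sym o≡2k+1)
        1≤k : 1 ≤ k
        1≤k = ℕ.n≢0⇒n>0 λ { refl → ℕ.<⇒≱ 2≤o (ℕ.≤-reflexive o≡2k+1) }
        o≤2n : o ≤ 2 * n
        o≤2n = ℕ.≤-trans (ℕ.≤-reflexive (trans o≡2k+1 (ℕ.+-comm 1 n)))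
                 (ℕ.+-monoʳ-≤ n (ℕ.≤-trans 1≤k (ℕ.≤-trans (ℕ.m≤n*m k 2) (ℕ.≤-reflexive (sym (ℕ.+-identityʳ n))))))
        4≤o : 2 ≤ k → 4 ≤ o
        4≤o 2≤k = ℕ.≤-trans (ℕ.*-monoʳ-≤ 2 2≤k) (ℕ.<⇒≤ n<o)
        fall : ∃ λ c → low (y c) ≡ true × low (y (suc c)) ≡ false
        fall = last-true (λ t → low (y t)) n low-y₀ (low-y n<o o≤2n)
        c : ℕ
        c = proj₁ fall
        wrap : ∀ t → b t ∔ j 0 ≡ i (suc t) ∔ j n
        wrap t = trans (sym (at-low t 0 low-y₀)) (trans (sym (agree-wrap (suc t) n t 0
          (trans (sym (ℕ.+-suc t n)) (cong₂ _+_ (sym (ℕ.+-identityʳ t)) (sym o≡2k+1)))))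
          (at-high (suc t) n (low-y n<o o≤2n)))
        jump : ∀ t → i t ∔ j (suc c) ≡ b (suc t) ∔ j c
        jump t = trans (sym (at-high t (suc c) (proj₂ (proj₂ fall)))) (trans (agree t (suc c) (suc t) c (ℕ.+-suc t c))
          (at-low (suc t) c (proj₁ (proj₂ fall))))

      contradiction : ⊥
      contradiction with even-or-odd o
      ... | h , inj₁ e = even h e
      ... | k , inj₂ e = odd k e

    no-section : ∀ {δ} → δ ≢ G.[ 0 ] → ¬ Section _⊕_ F δ
    no-section δ≢0 S = OnCoset.contradiction S (G.coset δ≢0)

    module L = Twist G.isAbelianGroup G.[ 1 ] G.generates F
      (λ x y → table-simple (θ (low y) (half x)) (θ-involutive (low y) (half x)))
      [ 0 ] T T same-type {iF = [ 0 ]} {iT = [ 1 ]} T-0 T-1 no-section no-window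

-- Fibres given by tables

allᵇ : ∀ {n} → (Fin n → Bool) → Bool
allᵇ {zero} f = true
allᵇ {suc n} f = f Fin.zero ∧ allᵇ (λ i → f (Fin.suc i))

∧-true : ∀ {a b} → a ∧ b ≡ true → a ≡ true × b ≡ true
∧-true {true} e = refl , e

allᵇ-sound : ∀ {n} {f : Fin n → Bool} → allᵇ f ≡ true → ∀ i → f i ≡ true
allᵇ-sound {suc n} e Fin.zero = proj₁ (∧-true e)
allᵇ-sound {suc n} e (Fin.suc i) = allᵇ-sound (proj₂ (∧-true e)) i

_==_ : ∀ {n} → Fin n → Fin n → Bool
Fin.zero == Fin.zero = true
Fin.suc i == Fin.suc j = i == j
_ == _ = false

==-sound : ∀ {n} (i j : Fin n) → i == j ≡ true → i ≡ j
==-sound Fin.zero Fin.zero e = refl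
==-sound (Fin.suc i) (Fin.suc j) e = cong Fin.suc (==-sound i j e)
==-sound Fin.zero (Fin.suc j) ()
==-sound (Fin.suc i) Fin.zero ()

==-refl : ∀ {n} (i : Fin n) → i == i ≡ true
==-refl Fin.zero = refl
==-refl (Fin.suc i) = ==-refl i

infixr 4 _⇒ᵇ_
_⇒ᵇ_ : Bool → Bool → Bool
true ⇒ᵇ b = b
false ⇒ᵇ _ = true

⇒ᵇ-sound : ∀ {a b} → (a ⇒ᵇ b) ≡ true → a ≡ true → b ≡ true
⇒ᵇ-sound {true} e _ = e

all-true : ∀ {n} → Vec Bool n → Bool
all-true [] = true
all-true (b ∷ bs) = b ∧ all-true bs

all-true-sound : ∀ {n} (bs : Vec Bool n) → all-true bs ≡ true → ∀ i → lookup bs i ≡ true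
all-true-sound (b ∷ bs) e Fin.zero = proj₁ (∧-true e)
all-true-sound (b ∷ bs) e (Fin.suc i) = all-true-sound bs (proj₂ (∧-true e)) i

-- The entry of the second vector below an occurrence of s in the first.
follow : ∀ {A : Set} {n k} → Vec (Fin n) k → Vec A k → A → Fin n → A
follow [] [] d s = d
follow (x ∷ xs) (y ∷ ys) d s = if x == s then y else follow xs ys d s

follow-sound : ∀ {A : Set} {n k} (xs : Vec (Fin n) k) (ys : Vec A k) d s → (∃ λ i → lookup xs i ≡ s) →
  ∃ λ i → lookup xs i ≡ s × follow xs ys d s ≡ lookup ys i
follow-sound (x ∷ xs) (y ∷ ys) d s (i , e) with x == s in q
... | true = Fin.zero , ==-sound x s q , refl
follow-sound (x ∷ xs) (y ∷ ys) d s (Fin.zero , e) | false =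
  ⊥-elim (Bool.not-¬ q (subst (λ t → x == t ≡ true) e (==-refl x)))
follow-sound (x ∷ xs) (y ∷ ys) d s (Fin.suc i , e) | false =
  let j , e₁ , e₂ = follow-sound xs ys d s (i , e) in Fin.suc j , e₁ , e₂

Table : ℕ → Set
Table n = Vec (Vec (Fin n) n) n

nth : {A : Set} → A → List A → ℕ → A
nth d [] _ = d
nth d (x ∷ xs) zero = x
nth d (x ∷ xs) (suc k) = nth d xs k

fromLists : ∀ n .{{_ : NonZero n}} → List (List ℕ) → Table n
fromLists n t = Vec.tabulate λ i → Vec.tabulate λ j → nth 0 (nth [] t (toℕ i)) (toℕ j) mod n

transpose : ∀ {n} → Table n → Table n
transpose t = Vec.tabulate λ j → Vec.tabulate λ i → lookup (lookup t i) j

explore : ∀ {n} → (α β γ : Fin n → Fin n) → ℕ → List (Fin n) → Vec Bool n → Bool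
explore α β γ zero _ _ = false
explore α β γ (suc k) [] seen = all-true seen
explore α β γ (suc k) (s ∷ todo) seen =
  if lookup seen s then explore α β γ k todo seen
  else explore α β γ k (α s ∷ β s ∷ γ s ∷ todo) (seen [ s ]≔ true)

module _ {n} {α β γ : Fin n → Fin n} {W : Fin n → Set}
  (Wα : ∀ {s} → W s → W (α s)) (Wβ : ∀ {s} → W s → W (β s)) (Wγ : ∀ {s} → W s → W (γ s)) where

  explore-sound : ∀ k todo seen → All W todo → (∀ s → lookup seen s ≡ true → W s) →
    explore α β γ k todo seen ≡ true → ∀ s → W s
  explore-sound (suc k) [] seen _ ok e s = ok s (all-true-sound seen e s)
  explore-sound (suc k) (s ∷ todo) seen (w ∷ ws) ok e with lookup seen s
  ... | true = explore-sound k todo seen ws ok e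
  ... | false = explore-sound k _ _ (Wα w ∷ Wβ w ∷ Wγ w ∷ ws) ok' e
    where
    ok' : ∀ t → lookup (seen [ s ]≔ true) t ≡ true → W t
    ok' t e with t Fin.≟ s
    ... | yes refl = w
    ... | no t≢s = ok t (trans (sym (Vec.lookup∘updateAt′ t s t≢s seen)) e)

rows-injective? : ∀ {n} → Table n → Bool
rows-injective? t = allᵇ λ r → allᵇ λ c → allᵇ λ c' →
  (lookup (lookup t r) c == lookup (lookup t r) c') ⇒ᵇ (c == c')

rows-injective : ∀ {n} (t : Table n) → rows-injective? t ≡ true → ∀ r {c c'} →
  lookup (lookup t r) c ≡ lookup (lookup t r) c' → c ≡ c'
rows-injective t inj r {c} {c'} e = ==-sound c c' (⇒ᵇ-sound (allᵇ-sound (allᵇ-sound (allᵇ-sound inj r) c) c')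
  (subst (λ s → lookup (lookup t r) c == s ≡ true) e (==-refl (lookup (lookup t r) c))))

column : ∀ {n} → Table n → Fin n → Fin n → Fin n
column {n} t r s = follow (lookup t r) (Vec.allFin n) s s

column-sound : ∀ {n} (t : Table n) → rows-injective? t ≡ true → ∀ r {c s} → lookup (lookup t r) c ≡ s → column t r s ≡ c
column-sound {n} t inj r {c} {s} e = let c' , e₁ , e₂ = follow-sound (lookup t r) (Vec.allFin n) s s (c , e) in
  trans e₂ (trans (Vec.lookup-allFin c') (rows-injective t inj r (trans e₁ (sym e))))

-- Whether two rows r, r' and a column c always generate the whole square. The symbols of a subsquare
-- containing them are permuted by passing from row r to row r', and from column c to the columns c'
-- and c'' which are the next ones on the row cycle of c.
generated? : ∀ {n} → Table n → Table n → Bool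
generated? {n} t tᵀ = allᵇ λ r → allᵇ λ r' → (toℕ r <ᵇ toℕ r') ⇒ᵇ allᵇ λ c → generates r r' c
  where
  generates : Fin n → Fin n → Fin n → Bool
  generates r r' c = explore α (follow col (lookup tᵀ c') s₀) (follow col (lookup tᵀ c'') s₀)
    -- Each of `n` new symbols puts three on the list, so there are at most `3 * n + 1` removals and
    -- one final test; this fits once `n ≥ 2`, and for `n = 1` there is no pair of rows.
    (4 * n) (s₀ ∷ []) (replicate n false)
    where
    row = lookup t r
    col = lookup tᵀ c
    s₀ = lookup row c
    α = follow row (lookup t r') s₀
    next : Fin n → Fin n
    next d = follow row (Vec.allFin n) c (lookup (lookup t r') d)
    c' = next c
    c'' = next c'

module FromTable {n : ℕ} (t : Table n)
  (rows! : rows-injective? t ≡ true) (cols! : rows-injective? (transpose t) ≡ true) where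

  private
    f : Fin n → Fin n → Fin n
    f i j = lookup (lookup t i) j

    fᵀ : ∀ i j → lookup (lookup (transpose t) j) i ≡ f i j
    fᵀ i j = trans (cong (λ v → lookup v i) (Vec.lookup∘tabulate _ j)) (Vec.lookup∘tabulate _ i)

    row-inj : ∀ r {c c'} → f r c ≡ f r c' → c ≡ c'
    row-inj = rows-injective t rows!

    col-inj : ∀ c {r r'} → f r c ≡ f r' c → r ≡ r'
    col-inj c {r} {r'} e = rows-injective (transpose t) cols! c (trans (fᵀ r c) (trans e (sym (fᵀ r' c))))

    onto : (g : Fin n → Fin n) → (∀ {x y} → g x ≡ g y → x ≡ y) → ∀ s → ∃ λ c → g c ≡ s
    onto g g-inj s = let c , _ , e = injective-onto g g-inj {λ _ → ⊤} (λ _ → tt) {s} tt in c , e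

  table : Quasigroup (Fin n)
  table = record
    { op = f
    ; colOf = λ r s → proj₁ (onto (f r) (row-inj r) s)
    ; rowOf = λ c s → proj₁ (onto (λ r → f r c) (col-inj c) s)
    ; op-colOf = λ r s → proj₂ (onto (f r) (row-inj r) s)
    ; colOf-op = λ r c → row-inj r (proj₂ (onto (f r) (row-inj r) (f r c)))
    ; op-rowOf = λ c s → proj₂ (onto (λ r → f r c) (col-inj c) s)
    ; rowOf-op = λ r c → col-inj c (proj₂ (onto (λ r → f r c) (col-inj c) (f r c)))
    }

  table-simple : generated? t (transpose t) ≡ true → Simple table
  table-simple gen {R} {C} {W} _ _ S {r} {r'} {c} Rr Rr' r≢r' Cc q with inCol S Cc (allW (f q c))
    where
    Wf : ∀ {i j} → R i → C j → W (f i j)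
    Wf = inside S
    col∈ : ∀ {i s} → R i → W s → ∀ {j} → f i j ≡ s → C j
    col∈ {i} Ri Ws e = let d , Cd , e' = inRow S Ri Ws in subst C (row-inj i (trans e' (sym e))) Cd
    row∈ : ∀ {j s} → C j → W s → ∀ {i} → f i j ≡ s → R i
    row∈ {j} Cj Ws e = let d , Rd , e' = inCol S Cj Ws in subst R (col-inj j (trans e' (sym e))) Rd
    full : ∀ {r r'} → R r → R r' → (toℕ r <ᵇ toℕ r') ≡ true → ∀ s → W s
    full {r} {r'} Rr Rr' r<r' = explore-sound Wα (Wβ Cc') (Wβ Cc'') (4 * n) _ (replicate n false) (Wf Rr Cc ∷ []) none
      (allᵇ-sound (⇒ᵇ-sound (allᵇ-sound (allᵇ-sound gen r) r') r<r') c)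
      where
      Wα : ∀ {s} → W s → W (follow (lookup t r) (lookup t r') (f r c) s)
      Wα {s} Ws = let j , e , e' = follow-sound (lookup t r) (lookup t r') (f r c) s (onto (f r) (row-inj r) s) in
        subst W (sym e') (Wf Rr' (col∈ Rr Ws e))
      next∈ : ∀ {d} → C d → C (follow (lookup t r) (Vec.allFin n) c (f r' d))
      next∈ {d} Cd = let j , e , e' = follow-sound (lookup t r) (Vec.allFin n) c (f r' d) (onto (f r) (row-inj r) (f r' d)) in
        subst C (sym (trans e' (Vec.lookup-allFin j))) (col∈ Rr (Wf Rr' Cd) e)
      Cc' = next∈ Cc
      Cc'' = next∈ Cc'
      Wβ : ∀ {d} → C d → ∀ {s} → W s → W (follow (lookup (transpose t) c) (lookup (transpose t) d) (f r c) s)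
      Wβ {d} Cd {s} Ws = let i₀ , e₀ = onto (λ i → f i c) (col-inj c) s
                             i , e , e' = follow-sound (lookup (transpose t) c) (lookup (transpose t) d) (f r c) s (i₀ , trans (fᵀ i₀ c) e₀) in
        subst W (sym (trans e' (fᵀ i d))) (Wf (row∈ Cc Ws (trans (sym (fᵀ i c)) e)) Cd)
      none : ∀ s → lookup (replicate n false) s ≡ true → W s
      none s e = ⊥-elim (Bool.not-¬ (Vec.lookup-replicate s false) e)
    allW : ∀ s → W s
    allW with Fin.<-cmp r r'
    ... | tri< r<r' _ _ = full Rr Rr' (Equivalence.to Bool.T-≡ (ℕ.<⇒<ᵇ r<r'))
    ... | tri≈ _ e _ = ⊥-elim (r≢r' e)
    ... | tri> _ _ r'<r = full Rr' Rr (Equivalence.to Bool.T-≡ (ℕ.<⇒<ᵇ r'<r))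
  ... | i , Ri , e = subst R (col-inj c e) Ri

module _ {A : Set} (q : Quasigroup A) {θ θ⁻¹ : A → A}
  (invˡ : ∀ i → θ⁻¹ (θ i) ≡ i) (invʳ : ∀ i → θ (θ⁻¹ i) ≡ i) where

  permuteRows : Quasigroup A
  permuteRows = record
    { op = λ r c → op q (θ r) c
    ; colOf = λ r s → colOf q (θ r) s
    ; rowOf = λ c s → θ⁻¹ (rowOf q c s)
    ; op-colOf = λ r s → op-colOf q (θ r) s
    ; colOf-op = λ r c → colOf-op q (θ r) c
    ; op-rowOf = λ c s → trans (cong (λ r → op q r c) (invʳ _)) (op-rowOf q c s)
    ; rowOf-op = λ r c → trans (cong θ⁻¹ (rowOf-op q (θ r) c)) (invˡ r)
    }

  permuteRows-simple : Simple q → Simple permuteRows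
  permuteRows-simple simple {R} {C} {W} R? C? S {r} {r'} Rr Rr' r≢r' Cc t =
    subst R (invˡ t) (simple (λ i → R? (θ⁻¹ i)) C? S' (back Rr) (back Rr')
      (λ e → r≢r' (trans (sym (invˡ r)) (trans (cong θ⁻¹ e) (invˡ r')))) Cc (θ t))
    where
    back : ∀ {i} → R i → R (θ⁻¹ (θ i))
    back {i} = subst R (sym (invˡ i))
    S' : Subsquare q (λ i → R (θ⁻¹ i)) C W
    S' = record
      { inside = λ {i} {c} Ri Cc → subst (λ k → W (op q k c)) (invʳ i) (inside S Ri Cc)
      ; inRow = λ {i} Ri Ws → let c , Cc , e = inRow S Ri Ws in c , Cc , trans (cong (λ k → op q k c) (sym (invʳ i))) e
      ; inCol = λ Cc Ws → let i , Ri , e = inCol S Cc Ws in θ i , back Ri , e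
      }

-- Finite checks for windows and sections

does-sound : ∀ {P : Set} (d : Dec P) → does d ≡ true → P
does-sound (yes p) _ = p

==-complete : ∀ {n} {i j : Fin n} → i ≡ j → i == j ≡ true
==-complete {i = i} refl = ==-refl i

not-true : ∀ {a} → not a ≡ true → a ≢ true
not-true {false} _ ()

_at_,_ : ∀ {n} → Table n → Fin n → Fin n → Fin n
t at i , j = lookup (lookup t i) j

module Checks {n : ℕ} where

  -- The rows determine the columns of a window, as the places of `ω` in `t₀₀` and `t₁₁`; only pairs
  -- of rows are searched.
  window? : (T : Fin n → Bool) (ω : Fin n) (t₀₀ t₀₁ t₁₀ t₁₁ : Table n) → Bool
  window? T ω t₀₀ t₀₁ t₁₀ t₁₁ = allᵇ λ i → not (T i) ⇒ᵇ allᵇ λ i' → T i' ⇒ᵇ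
    not ((t₀₁ at i , column t₁₁ i' ω) == (t₁₀ at i' , column t₀₀ i ω))

  window-sound : ∀ T ω t₀₀ t₀₁ t₁₀ t₁₁ → rows-injective? t₀₀ ≡ true → rows-injective? t₁₁ ≡ true →
    window? T ω t₀₀ t₀₁ t₁₀ t₁₁ ≡ true → ∀ i i' j j' → T i ≡ false → T i' ≡ true →
    t₀₀ at i , j ≡ ω → t₁₁ at i' , j' ≡ ω → t₀₁ at i , j' ≢ t₁₀ at i' , j
  window-sound T ω t₀₀ t₀₁ t₁₀ t₁₁ ri₀₀ ri₁₁ ok i i' j j' t t' e e' s = not-true
    (⇒ᵇ-sound (allᵇ-sound (⇒ᵇ-sound (allᵇ-sound ok i) (cong not t)) i') t')
    (==-complete (trans (cong (t₀₁ at i ,_) (column-sound t₁₁ ri₁₁ i' e'))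
      (trans s (cong (t₁₀ at i' ,_) (sym (column-sound t₀₀ ri₀₀ i e))))))

  -- A section over a subgroup of order 2 or 3 is a 2 × 2 or 3 × 3 array, with the (i , k) entry taken
  -- from the square tᵢₖ, that is the table of a cyclic group.
  section₂? : (t₀₀ t₀₁ t₁₀ t₁₁ : Table n) → Bool
  section₂? t₀₀ t₀₁ t₁₀ t₁₁ = allᵇ λ i → allᵇ λ i' → allᵇ λ j →
    not ((t₀₁ at i , column t₁₁ i' (t₀₀ at i , j)) == (t₁₀ at i' , j))

  section₂-sound : ∀ t₀₀ t₀₁ t₁₀ t₁₁ → rows-injective? t₁₁ ≡ true → section₂? t₀₀ t₀₁ t₁₀ t₁₁ ≡ true →
    ∀ i i' j j' → t₁₁ at i' , j' ≡ t₀₀ at i , j → t₀₁ at i , j' ≢ t₁₀ at i' , j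
  section₂-sound t₀₀ t₀₁ t₁₀ t₁₁ ri₁₁ ok i i' j j' e s = not-true (allᵇ-sound (allᵇ-sound (allᵇ-sound ok i) i') j)
    (==-complete (trans (cong (t₀₁ at i ,_) (column-sound t₁₁ ri₁₁ i' e)) s))

  module _ (t₀₀ t₀₁ t₀₂ t₁₀ t₁₁ t₁₂ t₂₀ t₂₁ t₂₂ : Table n) where

    private
      row₂? : (j₀ j₁ j₂ k₀ k₁ k₂ : Fin n) → Bool
      row₂? j₀ j₁ j₂ k₀ k₁ k₂ = allᵇ λ i → ((t₂₀ at i , j₀) == k₂) ⇒ᵇ ((t₂₁ at i , j₁) == k₀) ⇒ᵇ
        not ((t₂₂ at i , j₂) == k₁)

      step₂ : (i₀ i₁ j₀ j₁ k₁ k₂ j₂ : Fin n) → Bool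
      step₂ i₀ i₁ j₀ j₁ k₁ k₂ j₂ = ((t₁₂ at i₁ , j₂) == (t₀₀ at i₀ , j₀)) ⇒ᵇ row₂? j₀ j₁ j₂ (t₀₀ at i₀ , j₀) k₁ k₂

      step₁ : (i₀ i₁ j₀ j₁ k₁ k₂ : Fin n) → Bool
      step₁ i₀ i₁ j₀ j₁ k₁ k₂ = step₂ i₀ i₁ j₀ j₁ k₁ k₂ (column t₀₂ i₀ k₂)

      step₀ : (i₀ i₁ j₀ k₁ j₁ : Fin n) → Bool
      step₀ i₀ i₁ j₀ k₁ j₁ = step₁ i₀ i₁ j₀ j₁ k₁ (t₁₁ at i₁ , j₁)

      start : (i₀ i₁ j₀ k₁ : Fin n) → Bool
      start i₀ i₁ j₀ k₁ = step₀ i₀ i₁ j₀ k₁ (column t₀₁ i₀ k₁)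

    -- The rows `i₀`, `i₁` and the column `j₀` give the symbols `k₀` and `k₁`; row `i₀` then locates
    -- `j₁`, which gives `k₂` and finally `j₂`. The (1 , 2) entry is tested before `i₂` is searched.
    section₃? : Bool
    section₃? = allᵇ λ i₀ → allᵇ λ i₁ → allᵇ λ j₀ → start i₀ i₁ j₀ (t₁₀ at i₁ , j₀)

    section₃-sound : rows-injective? t₀₁ ≡ true → rows-injective? t₀₂ ≡ true → section₃? ≡ true →
      ∀ i₀ i₁ i₂ j₀ j₁ j₂ → t₀₁ at i₀ , j₁ ≡ t₁₀ at i₁ , j₀ →
      t₀₂ at i₀ , j₂ ≡ t₁₁ at i₁ , j₁ → t₁₂ at i₁ , j₂ ≡ t₀₀ at i₀ , j₀ →
      t₂₀ at i₂ , j₀ ≡ t₁₁ at i₁ , j₁ → t₂₁ at i₂ , j₁ ≡ t₀₀ at i₀ , j₀ →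
      t₂₂ at i₂ , j₂ ≢ t₁₀ at i₁ , j₀
    section₃-sound ri₀₁ ri₀₂ ok i₀ i₁ i₂ j₀ j₁ j₂ e₀₁ e₀₂ e₁₂ e₂₀ e₂₁ e₂₂ = not-true
      (⇒ᵇ-sound (⇒ᵇ-sound (allᵇ-sound (⇒ᵇ-sound
        (subst (λ j₂ → step₂ i₀ i₁ j₀ j₁ k₁ k₂ j₂ ≡ true) (column-sound t₀₂ ri₀₂ i₀ e₀₂)
          (subst (λ j₁ → step₀ i₀ i₁ j₀ k₁ j₁ ≡ true) (column-sound t₀₁ ri₀₁ i₀ e₀₁)
            (allᵇ-sound (allᵇ-sound (allᵇ-sound ok i₀) i₁) j₀)))
        (==-complete e₁₂)) i₂) (==-complete e₂₀)) (==-complete e₂₁))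
      (==-complete e₂₂)
      where
      k₁ = t₁₀ at i₁ , j₀
      k₂ = t₁₁ at i₁ , j₁

open Checks

-- Table fibres over cyclic groups of odd and of even order

first : ℕ → Bool
first zero = true
first (suc _) = false

record IsSimpleTable {n : ℕ} (t : Table n) : Set where
  field
    rows-inj : rows-injective? t ≡ true
    cols-inj : rows-injective? (transpose t) ≡ true
    simple   : generated? t (transpose t) ≡ true

-- `ω` is the symbol ∞, `α` and `β` are the rows of type true, and `ζ` witnesses type false.
record OddTable (n : ℕ) : Set where
  field
    t       : Table n
    θ       : Vec (Fin n) n
    ω α β ζ : Fin n

  T : Fin n → Bool
  T i = (i == α) ∨ (i == β)

  perm : Fin n → Fin n
  perm i = lookup θ i

  t′ : Table n
  t′ = tabulate λ i → lookup t (perm i)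

-- For a cyclic group all of whose nontrivial subgroups have order divisible by 3: the fibre is t′ over
-- the first third of the rows and columns, and t elsewhere.
record IsOddTable {n : ℕ} (D : OddTable n) : Set where
  open OddTable D
  field
    valid      : IsSimpleTable t
    rows-inj′  : rows-injective? t′ ≡ true
    ζ-type     : T ζ ≡ false
    perm-inj   : allᵇ (λ i → allᵇ λ j → (perm i == perm j) ⇒ᵇ (i == j)) ≡ true
    perm-types : allᵇ (λ i → does (T (perm i) Bool.≟ T i)) ≡ true
    window     : window? T ω t t t t ≡ true
    window₀₀   : window? T ω t′ t t t ≡ true
    window₀₁   : window? T ω t t′ t t ≡ true
    window₁₀   : window? T ω t t t′ t ≡ true
    window₁₁   : window? T ω t t t t′ ≡ true
    section    : section₃? t′ t t t t t t t t ≡ true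

module OddBlocks {n : ℕ} {D : OddTable n} (isOdd : IsOddTable D) (m : ℕ) .{{_ : NonZero m}}
  (3∣ : ∀ {o} → 2 ≤ o → o ∣ m → 3 ∣ o) where

  open OddTable D
  open IsOddTable isOdd
  open IsSimpleTable valid
  private
    module G = Zmod m
    infixl 6 _⊕_
    _⊕_ = G._⊕_

    θ-inj : ∀ {i j} → perm i ≡ perm j → i ≡ j
    θ-inj {i} {j} e = ==-sound i j (⇒ᵇ-sound (allᵇ-sound (allᵇ-sound perm-inj i) j) (==-complete e))

    θ-onto : ∀ i → ∃ λ j → perm j ≡ i
    θ-onto i = let j , _ , e = injective-onto perm θ-inj {λ _ → ⊤} (λ _ → tt) {i} tt in j , e

    q : Quasigroup (Fin n)
    q = FromTable.table t rows-inj cols-inj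

    θ⁻¹ : Fin n → Fin n
    θ⁻¹ i = proj₁ (θ-onto i)

    invʳ : ∀ i → perm (θ⁻¹ i) ≡ i
    invʳ i = proj₂ (θ-onto i)

    invˡ : ∀ i → θ⁻¹ (perm i) ≡ i
    invˡ i = θ-inj (invʳ (perm i))

    square : Bool → Quasigroup (Fin n)
    square false = q
    square true = permuteRows q {perm} {θ⁻¹} invˡ invʳ

    square-simple : ∀ b → Simple (square b)
    square-simple false = FromTable.table-simple t rows-inj cols-inj simple
    square-simple true = permuteRows-simple q invˡ invʳ (FromTable.table-simple t rows-inj cols-inj simple)

    J : Fin n → Bool
    J j = T (rowOf q j ω)

    square-types : ∀ b {i j} → op (square b) i j ≡ ω → T i ≡ J j
    square-types false {i} {j} refl = cong T (sym (rowOf-op q i j))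
    square-types true {i} {j} refl = trans (sym (does-sound (T (perm i) Bool.≟ T i) (allᵇ-sound perm-types i)))
      (cong T (sym (rowOf-op q (perm i) j)))

    A : Bool → Table n
    A b = if b then t′ else t

    A-inj : ∀ b → rows-injective? (A b) ≡ true
    A-inj false = rows-inj
    A-inj true = rows-inj′

    op-square : ∀ b i j → op (square b) i j ≡ A b at i , j
    op-square false i j = refl
    op-square true i j = cong (λ row → lookup row j) (sym (Vec.lookup∘tabulate _ i))

    Ω : Fin m → Bool
    Ω x = 3 * suc (toℕ x) ≤ᵇ m

    Ω⇒ : ∀ {x} → Ω x ≡ true → 3 * suc (toℕ x) ≤ m
    Ω⇒ e = ℕ.≤ᵇ⇒≤ _ _ (Equivalence.from Bool.T-≡ e)

    ⇒Ω : ∀ {x} → 3 * suc (toℕ x) ≤ m → Ω x ≡ true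
    ⇒Ω e = Equivalence.to Bool.T-≡ (ℕ.≤⇒≤ᵇ e)

    F : Fin m → Fin m → Quasigroup (Fin n)
    F x y = square (Ω x ∧ Ω y)

    -- A shift by about half of `m` leaves the first third. So at most one of the four blocks of a
    -- window carries `t′`, which is why five window checks suffice.
    Ω-disjoint : ∀ {x d} → (d ⊕ d) ⊕ G.[ 1 ] ≡ G.[ 0 ] → Ω x ≡ true → Ω (x ⊕ d) ≢ true
    Ω-disjoint {x} {d} 2d+1≡0 e e' = ℕ.<⇒≱ (begin-strict
      m                               ≡⟨ m≡ ⟩
      suc (2 * toℕ d)                 <⟨ s≤s (s≤s (ℕ.*-monoˡ-≤ (toℕ d) (s≤s (s≤s (z≤n {1}))))) ⟩
      2 + 3 * toℕ d                   ≤⟨ ℕ.m≤n+m _ (1 + 3 * toℕ x) ⟩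
      (1 + 3 * toℕ x) + (2 + 3 * toℕ d) ≡⟨ lemma (toℕ x) (toℕ d) ⟩
      3 * suc (toℕ x + toℕ d)         ≡⟨ cong (λ a → 3 * suc a) (sym (G.toℕ-[]-< sum<m)) ⟩
      3 * suc (toℕ (x ⊕ d))           ∎) (Ω⇒ {x ⊕ d} e')
      where
      open ℕ.≤-Reasoning
      m≡ : m ≡ suc (2 * toℕ d)
      m≡ = Halves.m≡2d+1 m {d} 2d+1≡0
      lemma : ∀ x d → (1 + 3 * x) + (2 + 3 * d) ≡ 3 * suc (x + d)
      lemma = solve-∀
      x≤d : toℕ x ≤ toℕ d
      x≤d = ℕ.≮⇒≥ λ d<x → ℕ.<⇒≱ (begin-strict
        m                         ≡⟨ m≡ ⟩
        suc (2 * toℕ d)           <⟨ s≤s (s≤s (ℕ.*-monoˡ-≤ (toℕ d) (s≤s (s≤s (z≤n {1}))))) ⟩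
        2 + 3 * toℕ d             ≤⟨ ℕ.+-mono-≤ (s≤s (s≤s (z≤n {1}))) (ℕ.*-monoʳ-≤ 3 (ℕ.<⇒≤ d<x)) ⟩
        3 + 3 * toℕ x             ≡⟨ ℕ.*-suc 3 (toℕ x) ⟨
        3 * suc (toℕ x)           ∎) (Ω⇒ {x} e)
      sum<m : toℕ x + toℕ d < m
      sum<m = begin-strict
        toℕ x + toℕ d      ≤⟨ ℕ.+-monoˡ-≤ (toℕ d) x≤d ⟩
        toℕ d + toℕ d      <⟨ ℕ.≤-reflexive (cong (λ a → suc (toℕ d + a)) (sym (ℕ.+-identityʳ (toℕ d)))) ⟩
        suc (2 * toℕ d)    ≡⟨ m≡ ⟨
        m                  ∎

    no-window : ∀ x y d {i i' j j'} → (d ⊕ d) ⊕ G.[ 1 ] ≡ G.[ 0 ] → T i ≡ false → T i' ≡ true →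
      op (F x y) i j ≡ ω → op (F (x ⊕ d) (y ⊕ d)) i' j' ≡ ω →
      op (F x (y ⊕ d)) i j' ≢ op (F (x ⊕ d) y) i' j
    no-window x y d {i} {i'} {j} {j'} 2d+1≡0 t t' =
      cases (Ω x) (Ω (x ⊕ d)) (Ω y) (Ω (y ⊕ d)) (Ω-disjoint {x} 2d+1≡0) (Ω-disjoint {y} 2d+1≡0)
      where
      from-table : ∀ b₀₀ b₀₁ b₁₀ b₁₁ → window? T ω (A b₀₀) (A b₀₁) (A b₁₀) (A b₁₁) ≡ true →
        op (square b₀₀) i j ≡ ω → op (square b₁₁) i' j' ≡ ω →
        op (square b₀₁) i j' ≢ op (square b₁₀) i' j
      from-table b₀₀ b₀₁ b₁₀ b₁₁ ok e e' s = window-sound T ω (A b₀₀) (A b₀₁) (A b₁₀) (A b₁₁) (A-inj b₀₀) (A-inj b₁₁) ok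
        i i' j j' t t' (trans (sym (op-square b₀₀ i j)) e) (trans (sym (op-square b₁₁ i' j')) e')
        (trans (sym (op-square b₀₁ i j')) (trans s (op-square b₁₀ i' j)))
      cases : ∀ a a' b b' → (a ≡ true → a' ≢ true) → (b ≡ true → b' ≢ true) →
        op (square (a ∧ b)) i j ≡ ω → op (square (a' ∧ b')) i' j' ≡ ω →
        op (square (a ∧ b')) i j' ≢ op (square (a' ∧ b)) i' j
      cases true true _ _ da _ = ⊥-elim (da refl refl)
      cases true false true true _ db = ⊥-elim (db refl refl)
      cases false true true true _ db = ⊥-elim (db refl refl)
      cases true false true false _ _ = from-table true false false false window₀₀
      cases true false false true _ _ = from-table false true false false window₀₁
      cases true false false false _ _ = from-table false false false false window
      cases false true true false _ _ = from-table false false true false window₁₀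
      cases false true false true _ _ = from-table false false false true window₁₁
      cases false true false false _ _ = from-table false false false false window
      cases false false _ _ _ _ = from-table false false false false window

    module OnCoset {δ} (S : Section _⊕_ F δ) (coset : G.Coset δ) (3≡o : G.Coset.o coset ≡ 3) where

      open SectionOnCoset S coset

      3g≡m : 3 * g ≡ m
      3g≡m = trans (ℕ.*-comm 3 g) (trans (cong (g *_) (sym 3≡o)) go≡m)

      -- With `3 * g = m` the three members lie in different thirds, so a section of order 3 meets
      -- `t′` in its (0 , 0) entry only.
      Ω-term : ∀ {r} → r < g → ∀ t → t < 3 → Ω G.[ r + t * g ] ≡ first t
      Ω-term {r} r<g zero _ = ⇒Ω {G.[ r + 0 * g ]} (begin
        3 * suc (toℕ G.[ r + 0 * g ])  ≡⟨ cong (λ a → 3 * suc a) (trans (cong (λ a → toℕ G.[ a ]) (ℕ.+-identityʳ r)) (G.toℕ-[]-< r<m)) ⟩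
        3 * suc r                      ≤⟨ ℕ.*-monoʳ-≤ 3 r<g ⟩
        3 * g                          ≡⟨ 3g≡m ⟩
        m                              ∎)
        where
        open ℕ.≤-Reasoning
        r<m : r < m
        r<m = ℕ.<-≤-trans r<g (ℕ.≤-trans (ℕ.m≤n*m g 3) (ℕ.≤-reflexive 3g≡m))
      Ω-term {r} r<g (suc t) t<3 = Bool.¬-not λ e → ℕ.<⇒≱ (begin-strict
        m                                    ≡⟨ 3g≡m ⟨
        3 * g                                <⟨ ℕ.*-monoʳ-< 3 (s≤s (ℕ.≤-trans (ℕ.m≤m+n g (t * g)) (ℕ.m≤n+m _ r))) ⟩
        3 * suc (r + suc t * g)              ≡⟨ cong (λ a → 3 * suc a) (G.toℕ-[]-< term<m) ⟨
        3 * suc (toℕ G.[ r + suc t * g ])    ∎) (Ω⇒ {G.[ r + suc t * g ]} e)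
        where
        open ℕ.≤-Reasoning
        term<m : r + suc t * g < m
        term<m = ℕ.<-≤-trans (ℕ.+-monoˡ-< (suc t * g) r<g) (ℕ.≤-trans (ℕ.*-monoˡ-≤ g t<3) (ℕ.≤-reflexive 3g≡m))

      entry : ∀ t u → t < 3 → u < 3 → op (F (x t) (y u)) (i t) (j u) ≡ A (first t ∧ first u) at i t , j u
      entry t u t<3 u<3 = trans (cong₂ (λ a b → op (square (a ∧ b)) (i t) (j u)) (Ω-term r<g t t<3) (Ω-term s<g u u<3))
        (op-square (first t ∧ first u) (i t) (j u))

      0<3 : 0 < 3
      0<3 = s≤s z≤n
      1<3 : 1 < 3
      1<3 = s≤s 0<3'
        where
        0<3' : 0 < 2
        0<3' = s≤s z≤n
      2<3 : 2 < 3
      2<3 = ℕ.≤-refl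

      contradiction : ⊥
      contradiction = section₃-sound t′ t t t t t t t t rows-inj rows-inj section (i 0) (i 1) (i 2) (j 0) (j 1) (j 2)
        (trans (sym (entry 0 1 0<3 1<3)) (trans (agree 0 1 1 0 refl) (entry 1 0 1<3 0<3)))
        (trans (sym (entry 0 2 0<3 2<3)) (trans (agree 0 2 1 1 refl) (entry 1 1 1<3 1<3)))
        (trans (sym (entry 1 2 1<3 2<3)) (trans (agree-wrap 1 2 0 0 (sym 3≡o)) (entry 0 0 0<3 0<3)))
        (trans (sym (entry 2 0 2<3 0<3)) (trans (agree 2 0 1 1 refl) (entry 1 1 1<3 1<3)))
        (trans (sym (entry 2 1 2<3 1<3)) (trans (agree-wrap 2 1 0 0 (sym 3≡o)) (entry 0 0 0<3 0<3)))
        (trans (sym (entry 2 2 2<3 2<3)) (trans (agree-wrap 2 2 1 0 (cong suc (sym 3≡o))) (entry 1 0 1<3 0<3)))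

    no-section : ∀ {δ} → δ ≢ G.[ 0 ] → ¬ Section _⊕_ F δ
    no-section δ≢0 S = lemma (G.coset δ≢0)
      where
      lemma : G.Coset _ → ⊥
      lemma K with 3∣ (G.Coset.2≤o K) (divides (G.Coset.g K) (sym (G.Coset.go≡m K)))
      ... | divides h e = OnCoset.contradiction S (G.refine K {h} {3} e (s≤s (s≤s z≤n))) refl

  module L = Twist G.isAbelianGroup G.[ 1 ] G.generates F (λ x y → square-simple (Ω x ∧ Ω y))
    ω T J (λ x y → square-types (Ω x ∧ Ω y)) {iF = ζ} {iT = α} ζ-type (cong (_∨ (α == β)) (==-refl α)) no-section no-window

record EvenTable (n : ℕ) : Set where
  field
    t₀ t₁ t₂        : Table n
    ω α β α′ β′ ζ : Fin n

  T J : Fin n → Bool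
  T i = (i == α) ∨ (i == β)
  J j = (j == α′) ∨ (j == β′)

  -- The arguments say whether y and x are in the lower half.
  square : Bool → Bool → Table n
  square false _    = t₀
  square true true  = t₁
  square true false = t₂

record IsEvenTable {n : ℕ} (D : EvenTable n) : Set where
  open EvenTable D
  types? : Table n → Bool
  types? t = allᵇ λ i → allᵇ λ j → ((t at i , j) == ω) ⇒ᵇ does (T i Bool.≟ J j)
  field
    valid₀   : IsSimpleTable t₀
    valid₁   : IsSimpleTable t₁
    valid₂   : IsSimpleTable t₂
    ζ-type   : T ζ ≡ false
    types₀   : types? t₀ ≡ true
    types₁   : types? t₁ ≡ true
    types₂   : types? t₂ ≡ true
    section₂ : section₂? t₁ t₀ t₂ t₀ ≡ true
    -- In a coset of order 3 the first member is lower and the last upper; `a` and `b` cover both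
    -- possibilities for the middle row and the middle column.
    section₃ : ∀ a b → section₃? t₁ (square b true) t₀ (square true a) (square b a) t₀ t₂ (square b false) t₀ ≡ true

module EvenBlocks {n : ℕ} {D : EvenTable n} (isEven : IsEvenTable D) (m : ℕ) .{{_ : NonZero m}}
  (2∣m : 2 ∣ m) (2∣3∣ : ∀ {o} → 2 ≤ o → o ∣ m → 2 ∣ o ⊎ 3 ∣ o) where

  open EvenTable D
  open IsEvenTable isEven
  private
    module G = Zmod m
    open Halves m
    infixl 6 _⊕_
    _⊕_ = G._⊕_

    square-valid : ∀ b a → IsSimpleTable (square b a)
    square-valid false a = valid₀
    square-valid true true = valid₁
    square-valid true false = valid₂

    square-types : ∀ b a → types? (square b a) ≡ true
    square-types false a = types₀
    square-types true true = types₁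
    square-types true false = types₂

    q : ∀ b a → Quasigroup (Fin n)
    q b a = FromTable.table (square b a) rows-inj cols-inj
      where open IsSimpleTable (square-valid b a)

    q-simple : ∀ b a → Simple (q b a)
    q-simple b a = FromTable.table-simple (square b a) rows-inj cols-inj simple
      where open IsSimpleTable (square-valid b a)

    q-types : ∀ b a {i j} → op (q b a) i j ≡ ω → T i ≡ J j
    q-types b a {i} {j} e = does-sound (T i Bool.≟ J j)
      (⇒ᵇ-sound (allᵇ-sound (allᵇ-sound (square-types b a) i) j) (==-complete e))

    low : Fin m → Bool
    low x = isLower (half x)

    F : Fin m → Fin m → Quasigroup (Fin n)
    F x y = q (low y) (low x)

    no-window : ∀ x y d {i i' j j'} → (d ⊕ d) ⊕ G.[ 1 ] ≡ G.[ 0 ] → T i ≡ false → T i' ≡ true →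
      op (F x y) i j ≡ ω → op (F (x ⊕ d) (y ⊕ d)) i' j' ≡ ω →
      op (F x (y ⊕ d)) i j' ≢ op (F (x ⊕ d) y) i' j
    -- A window would force `m = 2 d + 1`, but `m` is even.
    no-window x y d 2d+1≡0 with ∣1⇒≡1 (∣m+n∣m⇒∣n (subst (2 ∣_) (trans (m≡2d+1 {d} 2d+1≡0) (ℕ.+-comm 1 _)) 2∣m) (m∣m*n (toℕ d)))
    ... | ()

    module OnCoset {δ} (S : Section _⊕_ F δ) (coset : G.Coset δ) where

      open SectionOnCoset S coset

      low-x₀ : low (x 0) ≡ true
      low-x₀ = cong isLower (first-lower go≡m 2≤o r<g)
      low-y₀ : low (y 0) ≡ true
      low-y₀ = cong isLower (first-lower go≡m 2≤o s<g)
      high-x : ∀ {t} → t < o → o ≤ 2 * t → low (x t) ≡ false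
      high-x t<o o≤2t = cong isLower (late-upper go≡m 2≤o r<g t<o o≤2t)
      high-y : ∀ {t} → t < o → o ≤ 2 * t → low (y t) ≡ false
      high-y t<o o≤2t = cong isLower (late-upper go≡m 2≤o s<g t<o o≤2t)

      entry : ∀ t u {a b} → low (x t) ≡ a → low (y u) ≡ b → op (F (x t) (y u)) (i t) (j u) ≡ square b a at i t , j u
      entry t u refl refl = refl

      two : o ≡ 2 → ⊥
      two o≡2 = section₂-sound t₁ t₀ t₂ t₀ (IsSimpleTable.rows-inj valid₀) section₂ (i 0) (i 1) (j 0) (j 1)
        (trans (sym (entry 1 1 x₁ y₁)) (trans (agree-wrap 1 1 0 0 (sym o≡2)) (entry 0 0 low-x₀ low-y₀)))
        (trans (sym (entry 0 1 low-x₀ y₁)) (trans (agree 0 1 1 0 refl) (entry 1 0 x₁ low-y₀)))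
        where
        x₁ = high-x (ℕ.≤-reflexive (sym o≡2)) (ℕ.≤-reflexive o≡2)
        y₁ = high-y (ℕ.≤-reflexive (sym o≡2)) (ℕ.≤-reflexive o≡2)

      three : o ≡ 3 → ⊥
      three o≡3 = section₃-sound t₁ (square b true) t₀ (square true a) (square b a) t₀ t₂ (square b false) t₀
        (IsSimpleTable.rows-inj (square-valid b true)) (IsSimpleTable.rows-inj valid₀) (section₃ a b)
        (i 0) (i 1) (i 2) (j 0) (j 1) (j 2)
        (trans (sym (entry 0 1 low-x₀ refl)) (trans (agree 0 1 1 0 refl) (entry 1 0 refl low-y₀)))
        (trans (sym (entry 0 2 low-x₀ y₂)) (trans (agree 0 2 1 1 refl) (entry 1 1 refl refl)))
        (trans (sym (entry 1 2 refl y₂)) (trans (agree-wrap 1 2 0 0 (sym o≡3)) (entry 0 0 low-x₀ low-y₀)))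
        (trans (sym (entry 2 0 x₂ low-y₀)) (trans (agree 2 0 1 1 refl) (entry 1 1 refl refl)))
        (trans (sym (entry 2 1 x₂ refl)) (trans (agree-wrap 2 1 0 0 (sym o≡3)) (entry 0 0 low-x₀ low-y₀)))
        (trans (sym (entry 2 2 x₂ y₂)) (trans (agree-wrap 2 2 1 0 (cong suc (sym o≡3))) (entry 1 0 refl low-y₀)))
        where
        a = low (x 1)
        b = low (y 1)
        o≤4 : o ≤ 4
        o≤4 = subst (_≤ 4) (sym o≡3) (ℕ.n≤1+n 3)
        x₂ = high-x {2} (ℕ.≤-reflexive (sym o≡3)) o≤4
        y₂ = high-y {2} (ℕ.≤-reflexive (sym o≡3)) o≤4

    no-section : ∀ {δ} → δ ≢ G.[ 0 ] → ¬ Section _⊕_ F δ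
    no-section δ≢0 S = lemma (G.coset δ≢0)
      where
      lemma : G.Coset _ → ⊥
      lemma K with 2∣3∣ (G.Coset.2≤o K) (divides (G.Coset.g K) (sym (G.Coset.go≡m K)))
      ... | inj₁ (divides h e) = OnCoset.two S (G.refine K {h} {2} e ℕ.≤-refl) refl
      ... | inj₂ (divides h e) = OnCoset.three S (G.refine K {h} {3} e (s≤s (s≤s z≤n))) refl

  module L = Twist G.isAbelianGroup G.[ 1 ] G.generates F (λ x y → q-simple (low y) (low x))
    ω T J (λ x y → q-types (low y) (low x)) {iF = ζ} {iT = α} ζ-type (cong (_∨ (α == β)) (==-refl α)) no-section no-window

-- The explicit squares

fromList : ∀ n .{{_ : NonZero n}} → List ℕ → Vec (Fin n) n
fromList n l = tabulate λ i → nth 0 l (toℕ i) mod n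

simple₁ : IsSimpleTable (fromLists 1 ((0 ∷ []) ∷ []))
simple₁ = record { rows-inj = refl ; cols-inj = refl ; simple = refl }

simple₂ : IsSimpleTable (fromLists 2 ((0 ∷ 1 ∷ []) ∷ (1 ∷ 0 ∷ []) ∷ []))
simple₂ = record { rows-inj = refl ; cols-inj = refl ; simple = refl }

simple₃ : IsSimpleTable (fromLists 3 ((0 ∷ 1 ∷ 2 ∷ []) ∷ (1 ∷ 2 ∷ 0 ∷ []) ∷ (2 ∷ 0 ∷ 1 ∷ []) ∷ []))
simple₃ = record { rows-inj = refl ; cols-inj = refl ; simple = refl }

-- The squares of orders 8 to 18 and their parameters were found by computer search.

table₈ : List (List ℕ)
table₈ =
  (3 ∷ 2 ∷ 5 ∷ 7 ∷ 4 ∷ 6 ∷ 1 ∷ 0 ∷ []) ∷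
  (1 ∷ 6 ∷ 3 ∷ 0 ∷ 5 ∷ 7 ∷ 2 ∷ 4 ∷ []) ∷
  (7 ∷ 4 ∷ 2 ∷ 5 ∷ 3 ∷ 0 ∷ 6 ∷ 1 ∷ []) ∷
  (4 ∷ 0 ∷ 6 ∷ 1 ∷ 7 ∷ 2 ∷ 5 ∷ 3 ∷ []) ∷
  (5 ∷ 1 ∷ 0 ∷ 4 ∷ 2 ∷ 3 ∷ 7 ∷ 6 ∷ []) ∷
  (0 ∷ 5 ∷ 7 ∷ 6 ∷ 1 ∷ 4 ∷ 3 ∷ 2 ∷ []) ∷
  (6 ∷ 3 ∷ 1 ∷ 2 ∷ 0 ∷ 5 ∷ 4 ∷ 7 ∷ []) ∷
  (2 ∷ 7 ∷ 4 ∷ 3 ∷ 6 ∷ 1 ∷ 0 ∷ 5 ∷ []) ∷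
  []

square₈ : Table 8
square₈ = fromLists 8 table₈

simple₈ : IsSimpleTable square₈
simple₈ = record { rows-inj = refl ; cols-inj = refl ; simple = refl }

odd₈ : OddTable 8
odd₈ = record
  { t = square₈
  ; θ = fromList 8 (5 ∷ 2 ∷ 6 ∷ 4 ∷ 7 ∷ 0 ∷ 1 ∷ 3 ∷ [])
  ; ω = # 3 ; α = # 5 ; β = # 0 ; ζ = # 1
  }

odd₈-valid : IsOddTable odd₈
odd₈-valid = record
  { valid = simple₈ ; rows-inj′ = refl ; ζ-type = refl ; perm-inj = refl ; perm-types = refl
  ; window = refl ; window₀₀ = refl ; window₀₁ = refl ; window₁₀ = refl ; window₁₁ = refl ; section = refl
  }

table₉ : List (List ℕ)
table₉ =
  (1 ∷ 3 ∷ 6 ∷ 2 ∷ 0 ∷ 8 ∷ 4 ∷ 7 ∷ 5 ∷ []) ∷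
  (6 ∷ 2 ∷ 4 ∷ 7 ∷ 3 ∷ 1 ∷ 0 ∷ 5 ∷ 8 ∷ []) ∷
  (0 ∷ 7 ∷ 3 ∷ 5 ∷ 8 ∷ 4 ∷ 2 ∷ 1 ∷ 6 ∷ []) ∷
  (7 ∷ 1 ∷ 8 ∷ 4 ∷ 6 ∷ 0 ∷ 5 ∷ 3 ∷ 2 ∷ []) ∷
  (3 ∷ 8 ∷ 2 ∷ 0 ∷ 5 ∷ 7 ∷ 1 ∷ 6 ∷ 4 ∷ []) ∷
  (5 ∷ 4 ∷ 0 ∷ 3 ∷ 1 ∷ 6 ∷ 8 ∷ 2 ∷ 7 ∷ []) ∷
  (8 ∷ 6 ∷ 5 ∷ 1 ∷ 4 ∷ 2 ∷ 7 ∷ 0 ∷ 3 ∷ []) ∷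
  (4 ∷ 0 ∷ 7 ∷ 6 ∷ 2 ∷ 5 ∷ 3 ∷ 8 ∷ 1 ∷ []) ∷
  (2 ∷ 5 ∷ 1 ∷ 8 ∷ 7 ∷ 3 ∷ 6 ∷ 4 ∷ 0 ∷ []) ∷
  []

square₉ : Table 9
square₉ = fromLists 9 table₉

simple₉ : IsSimpleTable square₉
simple₉ = record { rows-inj = refl ; cols-inj = refl ; simple = refl }

odd₉ : OddTable 9
odd₉ = record
  { t = square₉
  ; θ = fromList 9 (5 ∷ 6 ∷ 1 ∷ 8 ∷ 7 ∷ 0 ∷ 4 ∷ 3 ∷ 2 ∷ [])
  ; ω = # 5 ; α = # 5 ; β = # 0 ; ζ = # 1
  }

odd₉-valid : IsOddTable odd₉
odd₉-valid = record
  { valid = simple₉ ; rows-inj′ = refl ; ζ-type = refl ; perm-inj = refl ; perm-types = refl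
  ; window = refl ; window₀₀ = refl ; window₀₁ = refl ; window₁₀ = refl ; window₁₁ = refl ; section = refl
  }

table₁₂ : List (List ℕ)
table₁₂ =
  ( 1 ∷ 11 ∷  5 ∷ 10 ∷  2 ∷  0 ∷  8 ∷  7 ∷  9 ∷  4 ∷  3 ∷  6 ∷ []) ∷
  ( 6 ∷  4 ∷  8 ∷  2 ∷  3 ∷ 11 ∷ 10 ∷  5 ∷  0 ∷  1 ∷  9 ∷  7 ∷ []) ∷
  ( 3 ∷  9 ∷  1 ∷  0 ∷ 11 ∷  8 ∷  4 ∷  2 ∷  5 ∷  6 ∷  7 ∷ 10 ∷ []) ∷
  (10 ∷  1 ∷  0 ∷  7 ∷  6 ∷  9 ∷ 11 ∷  4 ∷  3 ∷  2 ∷  5 ∷  8 ∷ []) ∷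
  ( 8 ∷  0 ∷  2 ∷  3 ∷  4 ∷  5 ∷  7 ∷  9 ∷  1 ∷ 10 ∷  6 ∷ 11 ∷ []) ∷
  ( 5 ∷  6 ∷  9 ∷ 11 ∷  8 ∷  7 ∷  3 ∷ 10 ∷  2 ∷  0 ∷  1 ∷  4 ∷ []) ∷
  ( 2 ∷ 10 ∷  7 ∷  8 ∷  9 ∷  4 ∷  1 ∷  0 ∷  6 ∷  3 ∷ 11 ∷  5 ∷ []) ∷
  ( 0 ∷  5 ∷  4 ∷  1 ∷ 10 ∷  2 ∷  9 ∷  6 ∷ 11 ∷  7 ∷  8 ∷  3 ∷ []) ∷
  ( 4 ∷  7 ∷ 11 ∷  5 ∷  0 ∷ 10 ∷  6 ∷  3 ∷  8 ∷  9 ∷  2 ∷  1 ∷ []) ∷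
  (11 ∷  2 ∷ 10 ∷  6 ∷  1 ∷  3 ∷  0 ∷  8 ∷  7 ∷  5 ∷  4 ∷  9 ∷ []) ∷
  ( 9 ∷  8 ∷  3 ∷  4 ∷  7 ∷  6 ∷  5 ∷  1 ∷ 10 ∷ 11 ∷  0 ∷  2 ∷ []) ∷
  ( 7 ∷  3 ∷  6 ∷  9 ∷  5 ∷  1 ∷  2 ∷ 11 ∷  4 ∷  8 ∷ 10 ∷  0 ∷ []) ∷
  []

square₁₂ : Table 12
square₁₂ = fromLists 12 table₁₂

simple₁₂ : IsSimpleTable square₁₂
simple₁₂ = record { rows-inj = refl ; cols-inj = refl ; simple = refl }

odd₁₂ : OddTable 12
odd₁₂ = record
  { t = square₁₂
  ; θ = fromList 12 (2 ∷ 3 ∷ 1 ∷ 11 ∷ 6 ∷ 4 ∷ 9 ∷ 5 ∷ 10 ∷ 7 ∷ 8 ∷ 0 ∷ [])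
  ; ω = # 0 ; α = # 10 ; β = # 8 ; ζ = # 0
  }

odd₁₂-valid : IsOddTable odd₁₂
odd₁₂-valid = record
  { valid = simple₁₂ ; rows-inj′ = refl ; ζ-type = refl ; perm-inj = refl ; perm-types = refl
  ; window = refl ; window₀₀ = refl ; window₀₁ = refl ; window₁₀ = refl ; window₁₁ = refl ; section = refl
  }

table₁₆ : List (List ℕ)
table₁₆ =
  ( 5 ∷ 15 ∷  6 ∷ 14 ∷  8 ∷ 12 ∷  0 ∷  7 ∷  9 ∷ 11 ∷  2 ∷  1 ∷  3 ∷ 10 ∷ 13 ∷  4 ∷ []) ∷
  (14 ∷  4 ∷ 15 ∷  7 ∷ 13 ∷  9 ∷  6 ∷  1 ∷ 10 ∷  8 ∷  0 ∷  3 ∷ 11 ∷  2 ∷  5 ∷ 12 ∷ []) ∷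
  ( 4 ∷ 12 ∷  7 ∷ 13 ∷  2 ∷  5 ∷ 10 ∷ 14 ∷  0 ∷  3 ∷ 11 ∷  9 ∷ 15 ∷  6 ∷  1 ∷  8 ∷ []) ∷
  (13 ∷  5 ∷ 12 ∷  6 ∷  4 ∷  3 ∷ 15 ∷ 11 ∷  2 ∷  1 ∷  8 ∷ 10 ∷  7 ∷ 14 ∷  9 ∷  0 ∷ []) ∷
  (12 ∷  8 ∷  4 ∷  3 ∷  1 ∷ 11 ∷  2 ∷ 10 ∷  7 ∷ 14 ∷  9 ∷  0 ∷ 13 ∷ 15 ∷  6 ∷  5 ∷ []) ∷
  ( 9 ∷ 13 ∷  2 ∷  5 ∷ 10 ∷  0 ∷ 11 ∷  3 ∷ 15 ∷  6 ∷  1 ∷  8 ∷ 14 ∷ 12 ∷  4 ∷  7 ∷ []) ∷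
  ( 6 ∷  1 ∷ 14 ∷ 10 ∷  0 ∷  8 ∷  3 ∷  9 ∷ 11 ∷  2 ∷  5 ∷ 12 ∷  4 ∷  7 ∷ 15 ∷ 13 ∷ []) ∷
  ( 0 ∷  7 ∷ 11 ∷ 15 ∷  9 ∷  1 ∷  8 ∷  2 ∷  3 ∷ 10 ∷ 13 ∷  4 ∷  6 ∷  5 ∷ 12 ∷ 14 ∷ []) ∷
  ( 1 ∷  3 ∷ 10 ∷  9 ∷ 11 ∷  2 ∷  5 ∷ 12 ∷ 13 ∷  7 ∷ 14 ∷  6 ∷  0 ∷  4 ∷  8 ∷ 15 ∷ []) ∷
  ( 2 ∷  0 ∷  8 ∷ 11 ∷  3 ∷ 10 ∷ 13 ∷  4 ∷  6 ∷ 12 ∷  7 ∷ 15 ∷  5 ∷  1 ∷ 14 ∷  9 ∷ []) ∷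
  ( 8 ∷ 11 ∷  3 ∷  1 ∷  7 ∷ 14 ∷  9 ∷  0 ∷ 12 ∷  4 ∷ 15 ∷  5 ∷ 10 ∷ 13 ∷  2 ∷  6 ∷ []) ∷
  (10 ∷  9 ∷  0 ∷  2 ∷ 15 ∷  6 ∷  1 ∷  8 ∷  5 ∷ 13 ∷  4 ∷ 14 ∷ 12 ∷ 11 ∷  7 ∷  3 ∷ []) ∷
  (15 ∷  6 ∷  1 ∷  8 ∷  5 ∷  7 ∷ 14 ∷ 13 ∷  4 ∷  0 ∷ 12 ∷ 11 ∷  9 ∷  3 ∷ 10 ∷  2 ∷ []) ∷
  ( 7 ∷ 14 ∷  9 ∷  0 ∷  6 ∷  4 ∷ 12 ∷ 15 ∷  1 ∷  5 ∷ 10 ∷ 13 ∷  2 ∷  8 ∷  3 ∷ 11 ∷ []) ∷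
  ( 3 ∷ 10 ∷ 13 ∷  4 ∷ 12 ∷ 15 ∷  7 ∷  5 ∷ 14 ∷  9 ∷  6 ∷  2 ∷  8 ∷  0 ∷ 11 ∷  1 ∷ []) ∷
  (11 ∷  2 ∷  5 ∷ 12 ∷ 14 ∷ 13 ∷  4 ∷  6 ∷  8 ∷ 15 ∷  3 ∷  7 ∷  1 ∷  9 ∷  0 ∷ 10 ∷ []) ∷
  []

square₁₆ : Table 16
square₁₆ = fromLists 16 table₁₆

simple₁₆ : IsSimpleTable square₁₆
simple₁₆ = record { rows-inj = refl ; cols-inj = refl ; simple = refl }

odd₁₆ : OddTable 16
odd₁₆ = record
  { t = square₁₆
  ; θ = fromList 16 (6 ∷ 3 ∷ 10 ∷ 1 ∷ 9 ∷ 0 ∷ 12 ∷ 15 ∷ 13 ∷ 14 ∷ 2 ∷ 5 ∷ 4 ∷ 8 ∷ 11 ∷ 7 ∷ [])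
  ; ω = # 10 ; α = # 8 ; β = # 13 ; ζ = # 0
  }

odd₁₆-valid : IsOddTable odd₁₆
odd₁₆-valid = record
  { valid = simple₁₆ ; rows-inj′ = refl ; ζ-type = refl ; perm-inj = refl ; perm-types = refl
  ; window = refl ; window₀₀ = refl ; window₀₁ = refl ; window₁₀ = refl ; window₁₁ = refl ; section = refl
  }

table₁₈ : List (List ℕ)
table₁₈ =
  (16 ∷  9 ∷ 13 ∷  7 ∷  6 ∷ 10 ∷  4 ∷  1 ∷ 14 ∷ 11 ∷  3 ∷  5 ∷ 12 ∷ 17 ∷  0 ∷  2 ∷  8 ∷ 15 ∷ []) ∷
  (15 ∷ 17 ∷ 10 ∷ 14 ∷  8 ∷  7 ∷ 11 ∷  5 ∷  2 ∷ 16 ∷ 12 ∷  4 ∷  6 ∷ 13 ∷  9 ∷  1 ∷  3 ∷  0 ∷ []) ∷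
  ( 3 ∷ 16 ∷  9 ∷ 11 ∷ 15 ∷  0 ∷  8 ∷ 12 ∷  6 ∷  1 ∷ 17 ∷ 13 ∷  5 ∷  7 ∷ 14 ∷ 10 ∷  2 ∷  4 ∷ []) ∷
  ( 7 ∷  4 ∷ 17 ∷ 10 ∷ 12 ∷ 16 ∷  1 ∷  0 ∷ 13 ∷  5 ∷  2 ∷  9 ∷ 14 ∷  6 ∷  8 ∷ 15 ∷ 11 ∷  3 ∷ []) ∷
  (14 ∷  8 ∷  5 ∷  9 ∷ 11 ∷ 13 ∷ 17 ∷  2 ∷  1 ∷  4 ∷  6 ∷  3 ∷ 10 ∷ 15 ∷  7 ∷  0 ∷ 16 ∷ 12 ∷ []) ∷
  ( 2 ∷ 15 ∷  0 ∷  6 ∷ 10 ∷ 12 ∷ 14 ∷  9 ∷  3 ∷ 13 ∷  5 ∷  7 ∷  4 ∷ 11 ∷ 16 ∷  8 ∷  1 ∷ 17 ∷ []) ∷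
  ( 4 ∷  3 ∷ 16 ∷  1 ∷  7 ∷ 11 ∷ 13 ∷ 15 ∷ 10 ∷  9 ∷ 14 ∷  6 ∷  8 ∷  5 ∷ 12 ∷ 17 ∷  0 ∷  2 ∷ []) ∷
  (11 ∷  5 ∷  4 ∷ 17 ∷  2 ∷  8 ∷ 12 ∷ 14 ∷ 16 ∷  3 ∷ 10 ∷ 15 ∷  7 ∷  0 ∷  6 ∷ 13 ∷  9 ∷  1 ∷ []) ∷
  (17 ∷ 12 ∷  6 ∷  5 ∷  9 ∷  3 ∷  0 ∷ 13 ∷ 15 ∷  2 ∷  4 ∷ 11 ∷ 16 ∷  8 ∷  1 ∷  7 ∷ 14 ∷ 10 ∷ []) ∷
  ( 1 ∷ 13 ∷  7 ∷ 12 ∷  4 ∷  2 ∷ 10 ∷  6 ∷  9 ∷ 14 ∷  0 ∷ 17 ∷ 11 ∷ 16 ∷ 15 ∷  3 ∷  5 ∷  8 ∷ []) ∷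
  (10 ∷  2 ∷ 14 ∷  8 ∷ 13 ∷  5 ∷  3 ∷ 11 ∷  7 ∷  0 ∷ 15 ∷  1 ∷  9 ∷ 12 ∷ 17 ∷ 16 ∷  4 ∷  6 ∷ []) ∷
  ( 8 ∷ 11 ∷  3 ∷ 15 ∷  0 ∷ 14 ∷  6 ∷  4 ∷ 12 ∷  7 ∷  1 ∷ 16 ∷  2 ∷ 10 ∷ 13 ∷  9 ∷ 17 ∷  5 ∷ []) ∷
  (13 ∷  0 ∷ 12 ∷  4 ∷ 16 ∷  1 ∷ 15 ∷  7 ∷  5 ∷  6 ∷  8 ∷  2 ∷ 17 ∷  3 ∷ 11 ∷ 14 ∷ 10 ∷  9 ∷ []) ∷
  ( 6 ∷ 14 ∷  1 ∷ 13 ∷  5 ∷ 17 ∷  2 ∷ 16 ∷  8 ∷ 10 ∷  7 ∷  0 ∷  3 ∷  9 ∷  4 ∷ 12 ∷ 15 ∷ 11 ∷ []) ∷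
  ( 0 ∷  7 ∷ 15 ∷  2 ∷ 14 ∷  6 ∷  9 ∷  3 ∷ 17 ∷ 12 ∷ 11 ∷  8 ∷  1 ∷  4 ∷ 10 ∷  5 ∷ 13 ∷ 16 ∷ []) ∷
  ( 9 ∷  1 ∷  8 ∷ 16 ∷  3 ∷ 15 ∷  7 ∷ 10 ∷  4 ∷ 17 ∷ 13 ∷ 12 ∷  0 ∷  2 ∷  5 ∷ 11 ∷  6 ∷ 14 ∷ []) ∷
  ( 5 ∷ 10 ∷  2 ∷  0 ∷ 17 ∷  4 ∷ 16 ∷  8 ∷ 11 ∷ 15 ∷  9 ∷ 14 ∷ 13 ∷  1 ∷  3 ∷  6 ∷ 12 ∷  7 ∷ []) ∷
  (12 ∷  6 ∷ 11 ∷  3 ∷  1 ∷  9 ∷  5 ∷ 17 ∷  0 ∷  8 ∷ 16 ∷ 10 ∷ 15 ∷ 14 ∷  2 ∷  4 ∷  7 ∷ 13 ∷ []) ∷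
  []

square₁₈ : Table 18
square₁₈ = fromLists 18 table₁₈

simple₁₈ : IsSimpleTable square₁₈
simple₁₈ = record { rows-inj = refl ; cols-inj = refl ; simple = refl }

odd₁₈ : OddTable 18
odd₁₈ = record
  { t = square₁₈
  ; θ = fromList 18 (2 ∷ 11 ∷ 1 ∷ 8 ∷ 12 ∷ 13 ∷ 16 ∷ 9 ∷ 3 ∷ 4 ∷ 15 ∷ 17 ∷ 10 ∷ 0 ∷ 6 ∷ 7 ∷ 14 ∷ 5 ∷ [])
  ; ω = # 10 ; α = # 8 ; β = # 3 ; ζ = # 0
  }

odd₁₈-valid : IsOddTable odd₁₈
odd₁₈-valid = record
  { valid = simple₁₈ ; rows-inj′ = refl ; ζ-type = refl ; perm-inj = refl ; perm-types = refl
  ; window = refl ; window₀₀ = refl ; window₀₁ = refl ; window₁₀ = refl ; window₁₁ = refl ; section = refl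
  }

table₁₆′ : List (List ℕ)
table₁₆′ =
  (12 ∷  0 ∷  8 ∷ 10 ∷  7 ∷  1 ∷ 11 ∷  2 ∷  6 ∷ 15 ∷ 13 ∷  9 ∷  3 ∷  5 ∷ 14 ∷  4 ∷ []) ∷
  ( 1 ∷ 13 ∷ 11 ∷  9 ∷  0 ∷  6 ∷  3 ∷ 10 ∷ 14 ∷  7 ∷  8 ∷ 12 ∷  4 ∷  2 ∷  5 ∷ 15 ∷ []) ∷
  (10 ∷  8 ∷ 14 ∷  2 ∷  9 ∷  0 ∷  5 ∷  3 ∷ 15 ∷ 11 ∷  4 ∷ 13 ∷ 12 ∷  6 ∷  1 ∷  7 ∷ []) ∷
  ( 9 ∷ 11 ∷  3 ∷ 15 ∷  1 ∷  8 ∷  2 ∷  4 ∷ 10 ∷ 14 ∷ 12 ∷  5 ∷  7 ∷ 13 ∷  6 ∷  0 ∷ []) ∷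
  ( 3 ∷  5 ∷ 15 ∷  6 ∷  8 ∷  4 ∷ 12 ∷ 14 ∷  7 ∷  1 ∷ 10 ∷  0 ∷  2 ∷ 11 ∷  9 ∷ 13 ∷ []) ∷
  ( 4 ∷  2 ∷  7 ∷ 14 ∷  5 ∷  9 ∷ 15 ∷ 13 ∷  0 ∷  6 ∷  1 ∷ 11 ∷ 10 ∷  3 ∷ 12 ∷  8 ∷ []) ∷
  (13 ∷  4 ∷  1 ∷  7 ∷ 14 ∷ 12 ∷ 10 ∷  6 ∷  8 ∷  2 ∷  5 ∷  3 ∷ 11 ∷ 15 ∷  0 ∷  9 ∷ []) ∷
  ( 5 ∷ 12 ∷  6 ∷  0 ∷ 13 ∷ 15 ∷  7 ∷ 11 ∷  3 ∷  9 ∷  2 ∷  4 ∷ 14 ∷ 10 ∷  8 ∷  1 ∷ []) ∷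
  (14 ∷  7 ∷  5 ∷  1 ∷ 11 ∷ 13 ∷  6 ∷ 12 ∷  4 ∷  8 ∷  0 ∷  2 ∷ 15 ∷  9 ∷  3 ∷ 10 ∷ []) ∷
  ( 6 ∷ 15 ∷  0 ∷  4 ∷ 12 ∷ 10 ∷ 13 ∷  7 ∷  9 ∷  5 ∷  3 ∷  1 ∷  8 ∷ 14 ∷ 11 ∷  2 ∷ []) ∷
  ( 7 ∷  3 ∷ 12 ∷  5 ∷  4 ∷ 14 ∷  9 ∷ 15 ∷  2 ∷  0 ∷  6 ∷ 10 ∷  1 ∷  8 ∷ 13 ∷ 11 ∷ []) ∷
  ( 2 ∷  6 ∷  4 ∷ 13 ∷ 15 ∷  5 ∷ 14 ∷  8 ∷  1 ∷  3 ∷ 11 ∷  7 ∷  9 ∷  0 ∷ 10 ∷ 12 ∷ []) ∷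
  (15 ∷  9 ∷  2 ∷  8 ∷ 10 ∷  3 ∷  1 ∷  5 ∷ 11 ∷ 13 ∷  7 ∷ 14 ∷  0 ∷ 12 ∷  4 ∷  6 ∷ []) ∷
  ( 8 ∷ 14 ∷  9 ∷  3 ∷  2 ∷ 11 ∷  4 ∷  0 ∷ 12 ∷ 10 ∷ 15 ∷  6 ∷ 13 ∷  1 ∷  7 ∷  5 ∷ []) ∷
  ( 0 ∷ 10 ∷ 13 ∷ 11 ∷  3 ∷  7 ∷  8 ∷  1 ∷  5 ∷ 12 ∷  9 ∷ 15 ∷  6 ∷  4 ∷  2 ∷ 14 ∷ []) ∷
  (11 ∷  1 ∷ 10 ∷ 12 ∷  6 ∷  2 ∷  0 ∷  9 ∷ 13 ∷  4 ∷ 14 ∷  8 ∷  5 ∷  7 ∷ 15 ∷  3 ∷ []) ∷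
  []

table₁₆″ : List (List ℕ)
table₁₆″ =
  ( 5 ∷  3 ∷  4 ∷ 14 ∷ 15 ∷  6 ∷  9 ∷ 13 ∷  1 ∷  7 ∷  2 ∷ 11 ∷  0 ∷ 12 ∷ 10 ∷  8 ∷ []) ∷
  ( 2 ∷  4 ∷ 15 ∷  5 ∷  7 ∷ 14 ∷ 12 ∷  8 ∷  6 ∷  0 ∷ 10 ∷  3 ∷ 13 ∷  1 ∷  9 ∷ 11 ∷ []) ∷
  ( 6 ∷ 12 ∷  7 ∷  1 ∷ 11 ∷ 15 ∷ 13 ∷  4 ∷  0 ∷  9 ∷  3 ∷  5 ∷  8 ∷ 10 ∷  2 ∷ 14 ∷ []) ∷
  (13 ∷  7 ∷  0 ∷  6 ∷ 14 ∷ 10 ∷  5 ∷ 12 ∷  8 ∷  1 ∷  4 ∷  2 ∷ 11 ∷  9 ∷ 15 ∷  3 ∷ []) ∷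
  (11 ∷  2 ∷ 13 ∷  9 ∷  1 ∷  7 ∷  0 ∷ 10 ∷  4 ∷  8 ∷ 14 ∷ 12 ∷  5 ∷  3 ∷  6 ∷ 15 ∷ []) ∷
  ( 3 ∷ 10 ∷  8 ∷ 12 ∷  6 ∷  0 ∷ 11 ∷  1 ∷  9 ∷  5 ∷ 13 ∷ 15 ∷  2 ∷  4 ∷ 14 ∷  7 ∷ []) ∷
  (15 ∷ 11 ∷  9 ∷  0 ∷  2 ∷  8 ∷  3 ∷  5 ∷ 12 ∷ 14 ∷  6 ∷ 10 ∷  4 ∷ 13 ∷  7 ∷  1 ∷ []) ∷
  (10 ∷ 14 ∷  1 ∷  8 ∷  9 ∷  3 ∷  4 ∷  2 ∷ 15 ∷ 13 ∷ 11 ∷  7 ∷ 12 ∷  5 ∷  0 ∷  6 ∷ []) ∷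
  ( 9 ∷ 15 ∷ 10 ∷  3 ∷  8 ∷  4 ∷  2 ∷  0 ∷ 13 ∷ 11 ∷ 12 ∷  6 ∷  7 ∷ 14 ∷  1 ∷  5 ∷ []) ∷
  (14 ∷  8 ∷  2 ∷ 11 ∷  5 ∷  9 ∷  1 ∷  3 ∷ 10 ∷ 12 ∷  7 ∷ 13 ∷ 15 ∷  6 ∷  4 ∷  0 ∷ []) ∷
  ( 8 ∷  1 ∷ 11 ∷ 13 ∷  0 ∷  2 ∷ 10 ∷  6 ∷ 14 ∷  4 ∷ 15 ∷  9 ∷  3 ∷  7 ∷  5 ∷ 12 ∷ []) ∷
  ( 0 ∷  9 ∷ 12 ∷ 10 ∷  3 ∷  1 ∷  7 ∷ 11 ∷  5 ∷ 15 ∷  8 ∷ 14 ∷  6 ∷  2 ∷ 13 ∷  4 ∷ []) ∷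
  (12 ∷  0 ∷  6 ∷  4 ∷ 13 ∷ 11 ∷ 14 ∷  7 ∷  3 ∷ 10 ∷  5 ∷  1 ∷  9 ∷ 15 ∷  8 ∷  2 ∷ []) ∷
  ( 1 ∷ 13 ∷  5 ∷  7 ∷ 10 ∷ 12 ∷  6 ∷ 15 ∷ 11 ∷  2 ∷  0 ∷  4 ∷ 14 ∷  8 ∷  3 ∷  9 ∷ []) ∷
  ( 4 ∷  6 ∷ 14 ∷  2 ∷ 12 ∷  5 ∷ 15 ∷  9 ∷  7 ∷  3 ∷  1 ∷  8 ∷ 10 ∷  0 ∷ 11 ∷ 13 ∷ []) ∷
  ( 7 ∷  5 ∷  3 ∷ 15 ∷  4 ∷ 13 ∷  8 ∷ 14 ∷  2 ∷  6 ∷  9 ∷  0 ∷  1 ∷ 11 ∷ 12 ∷ 10 ∷ []) ∷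
  []

even₁₆ : EvenTable 16
even₁₆ = record
  { t₀ = square₁₆ ; t₁ = fromLists 16 table₁₆′ ; t₂ = fromLists 16 table₁₆″
  ; ω = # 0 ; α = # 2 ; β = # 5 ; α′ = # 8 ; β′ = # 5 ; ζ = # 0
  }

even₁₆-valid : IsEvenTable even₁₆
even₁₆-valid = record
  { valid₀ = simple₁₆
  ; valid₁ = record { rows-inj = refl ; cols-inj = refl ; simple = refl }
  ; valid₂ = record { rows-inj = refl ; cols-inj = refl ; simple = refl }
  ; ζ-type = refl ; types₀ = refl ; types₁ = refl ; types₂ = refl
  ; section₂ = refl
  ; section₃ = λ { true true → refl ; true false → refl ; false true → refl ; false false → refl }
  }

-- Factorisation of the order

Exists : ℕ → Set
Exists n = Σ (Matrix n) λ L → IsLatin L × IsNinfty L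

exists-product : ∀ {a m} {q : Quasigroup (Fin a × Fin m)} → Simple q → Exists (a * m)
exists-product {q = q} simple = matrix , isLatin , isNinfty simple
  where open ToMatrix Fin.*↔× q

exists-table : ∀ {n} {t : Table n} → IsSimpleTable t → Exists n
exists-table {t = t} valid = matrix , isLatin , isNinfty (FromTable.table-simple t rows-inj cols-inj simple)
  where
  open IsSimpleTable valid
  open ToMatrix (↔-id _) (FromTable.table t rows-inj cols-inj)

-- n = 2^i 3^j
Smooth : ℕ → Set
Smooth n = ∀ {o} → 2 ≤ o → o ∣ n → 2 ∣ o ⊎ 3 ∣ o

large-prime-or-smooth : ∀ n .{{_ : NonZero n}} → (∃ λ p → Prime p × 5 ≤ p × p ∣ n) ⊎ Smooth n
large-prime-or-smooth n with ℕ.anyUpTo? (λ p → prime? p ×-dec (5 ≤? p) ×-dec (p ∣? n)) (suc n)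
... | yes (p , _ , p-prime , 5≤p , p∣n) = inj₁ (p , p-prime , 5≤p , p∣n)
... | no none = inj₂ smooth
  where
  small : ∀ p → Prime p → p ∣ n → p ≡ 2 ⊎ p ≡ 3
  small 0 p-prime _ = ⊥-elim (¬prime[0] p-prime)
  small 1 p-prime _ = ⊥-elim (¬prime[1] p-prime)
  small 2 _ _ = inj₁ refl
  small 3 _ _ = inj₂ refl
  small 4 p-prime _ = ⊥-elim (from-no (prime? 4) p-prime)
  small p@(suc (suc (suc (suc (suc _))))) p-prime p∣n =
    ⊥-elim (none (p , s≤s (∣⇒≤ p∣n) , p-prime , s≤s (s≤s (s≤s (s≤s (s≤s z≤n)))) , p∣n))
  smooth : Smooth n
  smooth {suc o} 2≤o o∣n with factorise (suc o)
  ... | record { factors = [] ; isFactorisation = e } = ⊥-elim (ℕ.<⇒≢ 2≤o (sym e))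
  ... | record { factors = p ∷ ps ; isFactorisation = e ; factorsPrime = p-prime ∷ _ } = helper
    where
    p∣o : p ∣ suc o
    p∣o = subst (p ∣_) (sym e) (m∣m*n _)
    helper : 2 ∣ suc o ⊎ 3 ∣ suc o
    helper with small p p-prime (∣-trans p∣o o∣n)
    ... | inj₁ refl = inj₁ p∣o
    ... | inj₂ refl = inj₂ p∣o

module _ {n : ℕ} .{{_ : NonZero n}} (smooth : Smooth n) where

  nonZero-factor : ∀ a m → n ≡ a * m → NonZero m
  nonZero-factor a zero e = ⊥-elim (≢-nonZero⁻¹ n (trans e (ℕ.*-zeroʳ a)))
  nonZero-factor a (suc m) e = _

  factor-odd : ∀ {m} → m ∣ n → ¬ 2 ∣ m → ∀ {o} → 2 ≤ o → o ∣ m → 3 ∣ o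
  factor-odd m∣n 2∤m 2≤o o∣m with smooth 2≤o (∣-trans o∣m m∣n)
  ... | inj₁ 2∣o = ⊥-elim (2∤m (∣-trans 2∣o o∣m))
  ... | inj₂ 3∣o = 3∣o

  exists-odd : ∀ {a} m {D : OddTable a} → IsOddTable D → n ≡ a * m → ¬ 2 ∣ m → Exists n
  exists-odd {a} m valid e 2∤m = subst Exists (sym e)
    (exists-product (OddBlocks.L.simple valid m (factor-odd (divides a e) 2∤m)))
    where instance m≢0 = nonZero-factor a m e

  exists-even : ∀ {a} m {D : EvenTable a} → IsEvenTable D → n ≡ a * m → 2 ∣ m → Exists n
  exists-even {a} m valid e 2∣m = subst Exists (sym e)
    (exists-product (EvenBlocks.L.simple valid m 2∣m (λ 2≤o o∣m → smooth 2≤o (∣-trans o∣m (divides a e)))))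
    where instance m≢0 = nonZero-factor a m e

  factor-3 : ∀ a m → n ≡ a * m → ¬ 2 ∣ m → m ≡ 1 ⊎ 3 ∣ m
  factor-3 a zero e _ = ⊥-elim (≢-nonZero⁻¹ n (trans e (ℕ.*-zeroʳ a)))
  factor-3 a (suc zero) e _ = inj₁ refl
  factor-3 a (suc (suc m)) e 2∤m = inj₂ (factor-odd (divides a e) 2∤m (s≤s (s≤s z≤n)) ∣-refl)

  regroup : ∀ a b {m} k → n ≡ a * m → m ≡ k * b → n ≡ a * b * k
  regroup a b k e e' = trans e (trans (cong (a *_) (trans e' (ℕ.*-comm k b))) (sym (ℕ.*-assoc a b k)))

  odd-quotient : ∀ {m} k b → m ≡ k * b → ¬ 2 ∣ m → ¬ 2 ∣ k
  odd-quotient k b e 2∤m 2∣k = 2∤m (subst (2 ∣_) (sym e) (∣m⇒∣m*n b 2∣k))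

  -- The exponent of 2 in `n` selects the fibre: 9, 18, 12 and 8 for the exponents 0 to 3, and 16
  -- beyond. The fibres 9, 18 and 12 also need factors 3; the orders without enough of them are 1,
  -- 2, 3 and the excluded 4 and 6.
  exists-smooth : n ≢ 4 → n ≢ 6 → Exists n
  exists-smooth n≢4 n≢6 with 2 ∣? n
  ... | no 2∤n = odd
    where
    e₁ : n ≡ 1 * n
    e₁ = sym (ℕ.*-identityˡ n)
    odd : Exists n
    odd with factor-3 1 n e₁ 2∤n
    ... | inj₁ refl = exists-table simple₁
    ... | inj₂ (divides k e) with factor-3 3 k (regroup 1 3 k e₁ e) (odd-quotient k 3 e 2∤n)
    ...   | inj₁ refl = subst Exists (sym e) (exists-table simple₃)
    ...   | inj₂ (divides k' e') = exists-odd k' odd₉-valid (regroup 3 3 k' (regroup 1 3 k e₁ e) e')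
                                     (odd-quotient k' 3 e' (odd-quotient k 3 e 2∤n))
  ... | yes (divides k e) with 2 ∣? k
  ...   | no 2∤k = twice-odd
    where
    e₂ : n ≡ 2 * k
    e₂ = trans e (ℕ.*-comm k 2)
    twice-odd : Exists n
    twice-odd with factor-3 2 k e₂ 2∤k
    ... | inj₁ refl = subst Exists (sym e) (exists-table simple₂)
    ... | inj₂ (divides k' e') with factor-3 6 k' (regroup 2 3 k' e₂ e') (odd-quotient k' 3 e' 2∤k)
    ...   | inj₁ refl = ⊥-elim (n≢6 (regroup 2 3 1 e₂ e'))
    ...   | inj₂ (divides k'' e'') = exists-odd k'' odd₁₈-valid (regroup 6 3 k'' (regroup 2 3 k' e₂ e') e'')
                                       (odd-quotient k'' 3 e'' (odd-quotient k' 3 e' 2∤k))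
  ...   | yes (divides l f) with 2 ∣? l
  ...     | no 2∤l = four-odd
    where
    e₄ : n ≡ 4 * l
    e₄ = regroup 2 2 l (trans e (ℕ.*-comm k 2)) f
    four-odd : Exists n
    four-odd with factor-3 4 l e₄ 2∤l
    ... | inj₁ refl = ⊥-elim (n≢4 e₄)
    ... | inj₂ (divides l' f') = exists-odd l' odd₁₂-valid (regroup 4 3 l' e₄ f') (odd-quotient l' 3 f' 2∤l)
  ...     | yes (divides h g) with 2 ∣? h
  ...       | no 2∤h = exists-odd h odd₈-valid (regroup 4 2 h (regroup 2 2 l (trans e (ℕ.*-comm k 2)) f) g) 2∤h
  ...       | yes (divides s r) = sixteen
    where
    e₁₆ : n ≡ 16 * s
    e₁₆ = regroup 8 2 s (regroup 4 2 h (regroup 2 2 l (trans e (ℕ.*-comm k 2)) f) g) r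
    sixteen : Exists n
    sixteen with 2 ∣? s
    ... | yes 2∣s = exists-even s even₁₆-valid e₁₆ 2∣s
    ... | no 2∤s = exists-odd s odd₁₆-valid e₁₆ 2∤s

exists-prime : ∀ {n p} .{{_ : NonZero n}} → Prime p → 5 ≤ p → p ∣ n → Exists n
exists-prime {n} {p} p-prime 5≤p (divides m e) = subst Exists (sym (trans e (ℕ.*-comm m p)))
  (exists-product (PrimeField.Blocks.L.simple p p-prime 5≤p m))
  where
  instance
    m≢0 : NonZero m
    m≢0 = ≢-nonZero λ { refl → ≢-nonZero⁻¹ n e }

theorem3p1 : (n : ℕ) → NonZero n → n ≢ 4 → n ≢ 6 →
    Σ (Matrix n) λ L → IsLatin L × IsNinfty L
theorem3p1 n n≢0 n≢4 n≢6 with large-prime-or-smooth n {{n≢0}}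
... | inj₁ (p , p-prime , 5≤p , p∣n) = exists-prime {{n≢0}} p-prime 5≤p p∣n
... | inj₂ smooth = exists-smooth {{n≢0}} smooth n≢4 n≢6
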